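{- For $g\geq 1$, call a cell of the tropical Schottky locus $A^{\mathrm{cogr}}_g$ a $GL_g(\mathbb{Z})$-orbit of cones of the form $\sigma_A$, where $A$ is a $g\times n$ totally unimodular matrix whose column matroid is a simple cographic matroid (of rank at most $g$), and define its dimension to be the dimension of $\sigma_A$. Then: (i) $A^{\mathrm{cogr}}_3$ has $9$ cells, and the numbers of cells of dimensions $0,1,\dots,6$ are $(1,1,1,2,2,1,1)$; (ii) $A^{\mathrm{cogr}}_4$ has $25$ cells, and the numbers of cells of dimensions $0,1,\dots,9$ are $(1,1,1,2,3,4,5,4,2,2)$; (iii) $A^{\mathrm{cogr}}_5$ has $92$ cells, and the numbers of cells of dimensions $0,1,\dots,12$ are $(1,1,1,2,3,5,9,12,15,17,15,7,4)$.
   Context: A matrix is totally unimodular if every square submatrix has determinant in $\{0,1,-1\}$. A matroid is simple if it has no loops and no parallel elements; it is cographic if it is the dual $M^*(G)$ of the cycle matroid of a finite graph $G$. Cographic matroids are regular, i.e. representable by totally unimodular matrices. For a $g\times n$ totally unimodular matrix $A$ with columns $v_1,\dots,v_n$, $\sigma_A=\mathbb{R}_{>0}\langle v_1v_1^T,\dots,v_nv_n^T\rangle$, an open cone in the space of $g\times g$ real symmetric matrices, on which $X\in GL_g(\mathbb{Z})$ acts by $Q\mapsto X^TQX$. It is known that the $GL_g(\mathbb{Z})$-orbit of $\sigma_A$ depends only on the column matroid of $A$ and not on the choice of totally unimodular representing matrix (the empty matroid gives the cone $\{0\}$). -}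

module Defs where

open import Data.Nat as ℕ using (ℕ; zero; suc; _≤_)
open import Data.Integer as ℤ using (ℤ; +_; -[1+_])
open import Data.Rational as ℚ using (ℚ; _/_)
open import Data.Fin using (Fin; zero; suc; punchIn; _≟_)
open import Data.Bool using (Bool; true; false; not; if_then_else_)
open import Data.Product using (Σ; ∃; _×_; _,_; proj₁; proj₂)
open import Data.Sum using (_⊎_)
open import Data.List using (List; []; _∷_; length; filter)
open import Data.List as List using (lookup)
open import Data.Fin.Base using (toℕ)
open import Data.Vec.Functional using ()
open import Relation.Nullary using (does)
open import Relation.Binary.PropositionalEquality using (_≡_)
open import Function using (_∘_)

sumℤ : ∀ {n} → (Fin n → ℤ) → ℤ
sumℤ {zero}  f = + 0
sumℤ {suc n} f = f zero ℤ.+ sumℤ (f ∘ suc)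

sumℚ : ∀ {n} → (Fin n → ℚ) → ℚ
sumℚ {zero}  f = ℚ.0ℚ
sumℚ {suc n} f = f zero ℚ.+ sumℚ (f ∘ suc)

sumℕ : ∀ {n} → (Fin n → ℕ) → ℕ
sumℕ {zero}  f = 0
sumℕ {suc n} f = f zero ℕ.+ sumℕ (f ∘ suc)

toℚ : ℤ → ℚ
toℚ z = z / 1

Mat : ℕ → ℕ → Set
Mat m n = Fin m → Fin n → ℤ

sign : ℕ → ℤ
sign zero = + 1
sign (suc k) = ℤ.- sign k

det : ∀ k → Mat k k → ℤ
det zero    M = + 1
det (suc k) M = sumℤ λ j → sign (toℕ j) ℤ.* (M zero j ℤ.* det k (λ r c → M (suc r) (punchIn j c)))

-- every square submatrix has determinant 0, 1 or -1
-- (row/column selections need not be injective; repeated rows/columns give det 0)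
TotallyUnimodular : ∀ {g n} → Mat g n → Set
TotallyUnimodular {g} {n} A =
  ∀ k (r : Fin k → Fin g) (c : Fin k → Fin n) →
    let d = det k (λ i j → A (r i) (c j)) in
    (d ≡ + 0) ⊎ (d ≡ + 1) ⊎ (d ≡ -[1+ 0 ])

-- Column matroid of A: a set S ⊆ columns (as Fin n → Bool) is independent
-- iff the columns in S are linearly independent (over ℤ, equivalently ℚ).

Subset : ℕ → Set
Subset n = Fin n → Bool

size : ∀ {n} → Subset n → ℕ
size S = sumℕ λ i → if S i then 1 else 0

SupportedIn : ∀ {n} → Subset n → (Fin n → ℤ) → Set
SupportedIn S c = ∀ i → S i ≡ false → c i ≡ + 0

Indep : ∀ {g n} → Mat g n → Subset n → Set
Indep {g} {n} A S =
  ∀ (c : Fin n → ℤ) → SupportedIn S c →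
    (∀ r → sumℤ (λ i → c i ℤ.* A r i) ≡ + 0) → ∀ i → c i ≡ + 0

singleton : ∀ {n} → Fin n → Subset n
singleton i k = does (k ≟ i)

pair : ∀ {n} → Fin n → Fin n → Subset n
pair i j k = does (k ≟ i) Data.Bool.∨ does (k ≟ j)

Simple : ∀ {g n} → Mat g n → Set
Simple A = (∀ i → Indep A (singleton i)) × (∀ i j → (i ≡ j → Data.Empty.⊥) → Indep A (pair i j))
  where import Data.Empty

-- Graphs (finite multigraphs, loops allowed): V vertices, edges Fin n,
-- edge e joins proj₁ (ends e) and proj₂ (ends e).

Ends : ℕ → ℕ → Set
Ends V n = Fin n → Fin V × Fin V

data Reach {V n} (ends : Ends V n) (T : Subset n) (u : Fin V) : Fin V → Set where
  here : Reach ends T u u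
  fwd  : ∀ e → T e ≡ true → Reach ends T u (proj₁ (ends e)) → Reach ends T u (proj₂ (ends e))
  bwd  : ∀ e → T e ≡ true → Reach ends T u (proj₂ (ends e)) → Reach ends T u (proj₁ (ends e))

-- independent sets of the bond matroid M*(G): S is independent iff
-- E ∖ S contains a spanning forest of G, i.e. deleting S does not
-- disconnect the endpoints of any edge of G.
CoIndep : ∀ {V n} → Ends V n → Subset n → Set
CoIndep ends S = ∀ e → Reach ends (not ∘ S) (proj₁ (ends e)) (proj₂ (ends e))

-- column matroid of A is cographic: isomorphic to M*(G) for some graph G
-- (relabelling the edges of G, the isomorphism may be taken to be the identity on Fin n)
Cographic : ∀ {g n} → Mat g n → Set
Cographic {g} {n} A =
  Σ ℕ λ V → Σ (Ends V n) λ ends → ∀ S → (Indep A S → CoIndep ends S) × (CoIndep ends S → Indep A S)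

SymQ : ℕ → Set
SymQ g = Fin g → Fin g → ℚ

InCone : ∀ {g n} → Mat g n → SymQ g → Set
InCone {g} {n} A Q =
  Σ (Fin n → ℚ) λ λs → (∀ i → ℚ.0ℚ ℚ.< λs i) ×
    (∀ r s → Q r s ≡ sumℚ (λ i → λs i ℚ.* toℚ (A r i ℤ.* A s i)))

mulℤ : ∀ {g} → Mat g g → Mat g g → Mat g g
mulℤ X Y r s = sumℤ λ k → X r k ℤ.* Y k s

idℤ : ∀ {g} → Mat g g
idℤ r s = if does (r ≟ s) then + 1 else + 0

InGL : ∀ {g} → Mat g g → Set
InGL {g} X = Σ (Mat g g) λ Y → (∀ r s → mulℤ X Y r s ≡ idℤ r s) × (∀ r s → mulℤ Y X r s ≡ idℤ r s)

act : ∀ {g} → Mat g g → SymQ g → SymQ g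
act X Q r s = sumℚ λ a → sumℚ λ b → toℚ (X a r) ℚ.* (Q a b ℚ.* toℚ (X b s))

SameOrbit : ∀ {g n m} → Mat g n → Mat g m → Set
SameOrbit {g} A B =
  Σ (Mat g g) λ X → InGL X ×
    ((∀ Q → InCone A Q → InCone B (act X Q)) ×
     (∀ P → InCone B P → Σ (SymQ g) λ Q → InCone A Q × (∀ r s → act X Q r s ≡ P r s)))

-- dimension of σ_A = dimension of the span of the v_i v_iᵀ
-- = maximal size of a linearly independent subfamily of them

OuterIndep : ∀ {g n} → Mat g n → Subset n → Set
OuterIndep {g} {n} A S =
  ∀ (c : Fin n → ℤ) → SupportedIn S c →
    (∀ r s → sumℤ (λ i → c i ℤ.* (A r i ℤ.* A s i)) ≡ + 0) → ∀ i → c i ≡ + 0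

IsDim : ∀ {g n} → Mat g n → ℕ → Set
IsDim {g} {n} A d =
  (Σ (Subset n) λ S → size S ≡ d × OuterIndep A S) × (∀ S → OuterIndep A S → size S ≤ d)

record Admissible (g : ℕ) : Set where
  constructor adm
  field
    n     : ℕ
    A     : Mat g n
    tu    : TotallyUnimodular A
    simp  : Simple A
    cogr  : Cographic A

countEq : ∀ {N} → (Fin N → ℕ) → ℕ → ℕ
countEq f d = sumℕ λ k → if does (f k ℕ.≟ d) then 1 else 0

HasCells : (g total : ℕ) → List ℕ → Set
HasCells g total counts =
  Σ (Fin total → Admissible g) λ reps →
  Σ (Fin total → ℕ) λ dims →
    (∀ k → IsDim (Admissible.A (reps k)) (dims k)) ×
    (∀ k l → SameOrbit (Admissible.A (reps k)) (Admissible.A (reps l)) → k ≡ l) ×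
    (∀ (a : Admissible g) → Σ (Fin total) λ k → SameOrbit (Admissible.A a) (Admissible.A (reps k))) ×
    (∀ (d : Fin (length counts)) → countEq dims (toℕ d) ≡ lookup counts d)

{-# OPTIONS --safe #-}
-- Deleting a column of A deletes an element of its matroid, and this keeps the matroid simple and cographic (deletion in M*(G) is
-- contraction in G). So, by induction on the number of columns, A is equivalent to a representative [C | I] with one more
-- column v, where equivalence allows GL_g(ℤ), signs and permutations of the columns. Total unimodularity is not invariant under
-- GL_g(ℤ), but it implies that relations between columns lift from ℤ/p to ℤ, which is. Lifting forces v, up to equivalence,
-- to be either the next unit vector or a vector with entries 0, 1, -1 in the span of I. For each of these finitely many v
-- a certificate shows that v is parallel to a column, or that lifting fails (Camion's criterion), or that M(K₅), M(K₃,₃) or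
-- a subdivision of M(K₅) is a submatroid, or it gives an equivalence of [v | C | I] with a representative. The three bad matroids
-- are not cographic because the vertex stars of G would have too few edges in total.
--
-- The representatives are network matrices of rooted trees, hence totally unimodular, and cographic. For each element
-- i there are two vectors x, y of the row space whose supports meet exactly in i, so Q ↦ xᵀ Q y is a functional dual to the
-- vᵢ vᵢᵀ; hence these are independent and the dimension is the number of columns. Equal simplicial cones have equal rays, so
-- the binary code generated by the rows, up to GL_g, is an invariant of the orbit, and a statistic of its weights takes
-- different values on the representatives.

module Submission where

open import Defs
open import Data.Nat as ℕ using (ℕ; zero; suc; z≤n; s≤s)
import Data.Nat.Properties as ℕₚ
open import Data.Integer as ℤ using (ℤ; -[1+_]; _+_; _*_; -_; _-_; 0ℤ; 1ℤ) renaming (+_ to pos)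
import Data.Integer.Properties as ℤₚ
open import Data.Integer.Divisibility.Signed using (_∣_; divides; ∣m∣n⇒∣m+n; ∣m⇒∣-m; ∣m⇒∣m*n; ∣n⇒∣m*n; ∣⇒∣ᵤ)
open import Data.Integer.Tactic.RingSolver using (solve-∀)
open import Data.Rational as ℚ using (ℚ; 0ℚ)
import Data.Rational.Properties as ℚₚ
open import Data.Fin using (Fin; zero; suc; punchIn; punchOut; toℕ; _≟_; _↑ˡ_)
import Data.Fin.Properties as Finₚ
import Data.Fin.Permutation as Perm
open import Data.Bool using (Bool; true; false; not; if_then_else_; _∧_; _∨_)
import Data.Bool.Properties as Boolₚ
open import Data.Product using (Σ; ∃; _×_; _,_; proj₁; proj₂)
open import Data.Sum using (_⊎_; inj₁; inj₂; [_,_]′)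
open import Data.Empty using (⊥; ⊥-elim)
open import Data.Unit using (⊤; tt)
open import Data.List as List using (List; []; _∷_)
open import Data.Vec as Vec using (Vec; []; _∷_; lookup)
import Data.Vec.Properties as Vecₚ
open import Data.Vec.Functional as VF using (updateAt)
open import Relation.Nullary using (¬_; Dec; yes; no; does; contradiction)
open import Relation.Nullary.Decidable using (dec-true; dec-false; ¬?; _×-dec_; _⊎-dec_)
open import Relation.Binary.PropositionalEquality
open import Function using (_∘_; id; const)
import Algebra.Properties.Semiring.Sum as SemiringSum
open import Algebra.Bundles using (module CommutativeRing)
import Data.Rational.Unnormalised as ℚᵘ
import Data.Rational.Unnormalised.Properties as ℚᵘₚ
import Data.Nat.DivMod as ℕ/
import Data.Integer.DivMod as ℤ/
import Data.Nat.Divisibility as ℕ∣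
open import Data.Maybe using (Maybe; just; nothing)
open import Data.Nat.Induction using (<-wellFounded)
open import Induction.WellFounded using (Acc; acc)
import Relation.Binary

-- The induction removes columns, so it sees submatroids and not minors. This is why a third bad
-- matroid appears: in rank 5 an M(K₅)-minor may arise by contracting one element, and splitting a
-- vertex of K₅ into two vertices of degree at least 2 either subdivides an edge or creates a K₃,₃.
-- That the three matroids suffice comes out of the certificates, which cover every candidate
-- column. The counts behind the exclusion are tight. If M(K₅), with 10 elements and corank 6, were
-- M*(G), then G would have at least 7 vertices with nonempty stars, each of size at least 3, but
-- 7·3 > 2·10. For M(K₃,₃), with 9 elements, corank 4 and girth 4, the contradiction is 5·4 > 2·9.
-- In the subdivided graph one of the two series elements gets weight 0, which brings back the count
-- for K₅. The candidates are finite in number because a new column, reduced modulo one of its own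
-- entries, satisfies a relation with unit vectors whose lift exists only if that entry is 0 or
-- divides 1.

-- Finite sums

sumℤ≡sum : ∀ {n} (f : Fin n → ℤ) → sumℤ f ≡ SemiringSum.sum ℤₚ.+-*-semiring f
sumℤ≡sum {zero}  f = refl
sumℤ≡sum {suc n} f = cong (f zero +_) (sumℤ≡sum (f ∘ suc))

sumℚ≡sum : ∀ {n} (f : Fin n → ℚ) → sumℚ f ≡ SemiringSum.sum (CommutativeRing.semiring ℚₚ.+-*-commutativeRing) f
sumℚ≡sum {zero}  f = refl
sumℚ≡sum {suc n} f = cong (f zero ℚ.+_) (sumℚ≡sum (f ∘ suc))

sumℕ≡sum : ∀ {n} (f : Fin n → ℕ) → sumℕ f ≡ SemiringSum.sum ℕₚ.+-*-semiring f
sumℕ≡sum {zero}  f = refl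
sumℕ≡sum {suc n} f = cong (f zero ℕ.+_) (sumℕ≡sum (f ∘ suc))

sum-cong : ∀ {n} {f g : Fin n → ℤ} → (∀ i → f i ≡ g i) → sumℤ f ≡ sumℤ g
sum-cong {zero}  e = refl
sum-cong {suc n} e = cong₂ _+_ (e zero) (sum-cong (e ∘ suc))

sum-zero : ∀ {n} {f : Fin n → ℤ} → (∀ i → f i ≡ 0ℤ) → sumℤ f ≡ 0ℤ
sum-zero {zero}  e = refl
sum-zero {suc n} e = cong₂ _+_ (e zero) (sum-zero (e ∘ suc))

sum-+ : ∀ {n} (f g : Fin n → ℤ) → sumℤ (λ i → f i + g i) ≡ sumℤ f + sumℤ g
sum-+ f g = trans (sumℤ≡sum (λ i → f i + g i)) (trans (SemiringSum.∑-distrib-+ ℤₚ.+-*-semiring f g)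
  (sym (cong₂ _+_ (sumℤ≡sum f) (sumℤ≡sum g))))

sum-*ˡ : ∀ {n} x (f : Fin n → ℤ) → sumℤ (λ i → x * f i) ≡ x * sumℤ f
sum-*ˡ x f = trans (sumℤ≡sum (λ i → x * f i)) (trans (sym (SemiringSum.*-distribˡ-sum ℤₚ.+-*-semiring x f))
  (cong (x *_) (sym (sumℤ≡sum f))))

sum-*ʳ : ∀ {n} x (f : Fin n → ℤ) → sumℤ (λ i → f i * x) ≡ sumℤ f * x
sum-*ʳ x f = trans (sum-cong λ i → ℤₚ.*-comm (f i) x) (trans (sum-*ˡ x f) (ℤₚ.*-comm x (sumℤ f)))

sum-neg : ∀ {n} (f : Fin n → ℤ) → sumℤ (λ i → - f i) ≡ - sumℤ f
sum-neg {zero}  f = refl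
sum-neg {suc n} f = trans (cong (λ y → - f zero + y) (sum-neg (f ∘ suc)))
  (sym (ℤₚ.neg-distrib-+ (f zero) (sumℤ (f ∘ suc))))

sum-minus : ∀ {n} (f g : Fin n → ℤ) → sumℤ (λ i → f i - g i) ≡ sumℤ f - sumℤ g
sum-minus f g = trans (sum-+ f (λ i → - g i)) (cong (sumℤ f +_) (sum-neg g))

sum-swap : ∀ {m n} (f : Fin m → Fin n → ℤ) →
  sumℤ (λ i → sumℤ (λ j → f i j)) ≡ sumℤ (λ j → sumℤ (λ i → f i j))
sum-swap {m} {n} f = begin
  sumℤ (λ i → sumℤ (f i))      ≡⟨ sum-cong (λ i → sumℤ≡sum (f i)) ⟩
  sumℤ (λ i → S (f i))         ≡⟨ sumℤ≡sum (λ i → S (f i)) ⟩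
  S (λ i → S (f i))            ≡⟨ SemiringSum.∑-comm ℤₚ.+-*-semiring f ⟩
  S (λ j → S (λ i → f i j))    ≡⟨ sym (sumℤ≡sum (λ j → S (λ i → f i j))) ⟩
  sumℤ (λ j → S (λ i → f i j)) ≡⟨ sum-cong (λ j → sym (sumℤ≡sum (λ i → f i j))) ⟩
  sumℤ (λ j → sumℤ (λ i → f i j)) ∎
  where
  open ≡-Reasoning
  S : ∀ {k} → (Fin k → ℤ) → ℤ
  S = SemiringSum.sum ℤₚ.+-*-semiring

sum-only : ∀ {n} (j : Fin n) (f : Fin n → ℤ) → (∀ i → i ≢ j → f i ≡ 0ℤ) → sumℤ f ≡ f j
sum-only zero    f e = trans (cong (f zero +_) (sum-zero λ i → e (suc i) λ ())) (ℤₚ.+-identityʳ (f zero))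
sum-only (suc j) f e = trans (cong₂ _+_ (e zero λ ()) (sum-only j (f ∘ suc) λ i i≢j → e (suc i) λ { refl → i≢j refl }))
  (ℤₚ.+-identityˡ (f (suc j)))

idℤ-diag : ∀ {n} (i : Fin n) → idℤ i i ≡ 1ℤ
idℤ-diag i rewrite dec-true (i ≟ i) refl = refl

idℤ-off : ∀ {n} {i j : Fin n} → i ≢ j → idℤ i j ≡ 0ℤ
idℤ-off {i = i} {j} i≢j rewrite dec-false (i ≟ j) i≢j = refl

idℤ-sym : ∀ {n} (i j : Fin n) → idℤ i j ≡ idℤ j i
idℤ-sym i j with i ≟ j
... | yes refl = sym (idℤ-diag i)
... | no i≢j = sym (idℤ-off (i≢j ∘ sym))

sum-idˡ : ∀ {n} (j : Fin n) (f : Fin n → ℤ) → sumℤ (λ i → idℤ j i * f i) ≡ f j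
sum-idˡ j f = trans (sum-only j (λ i → idℤ j i * f i) λ i i≢j → cong (_* f i) (idℤ-off (i≢j ∘ sym)))
  (trans (cong (_* f j) (idℤ-diag j)) (ℤₚ.*-identityˡ (f j)))

sum-idʳ : ∀ {n} (j : Fin n) (f : Fin n → ℤ) → sumℤ (λ i → f i * idℤ i j) ≡ f j
sum-idʳ j f = trans (sum-cong λ i → trans (ℤₚ.*-comm (f i) (idℤ i j)) (cong (_* f i) (idℤ-sym i j))) (sum-idˡ j f)

-- Determinants

Row : ℕ → Set
Row n = Fin n → ℤ

infixr 5 _◂_
_◂_ : ∀ {A : Set} {n} → A → (Fin n → A) → Fin (suc n) → A
_◂_ = VF._∷_

det-cong : ∀ k (M N : Mat k k) → (∀ i j → M i j ≡ N i j) → det k M ≡ det k N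
det-cong zero    M N e = refl
det-cong (suc k) M N e = sum-cong
  {f = λ j → sign (toℕ j) * (M zero j * det k (λ r c → M (suc r) (punchIn j c)))}
  {g = λ j → sign (toℕ j) * (N zero j * det k (λ r c → N (suc r) (punchIn j c)))}
  λ j → cong (sign (toℕ j) *_) (cong₂ _*_ (e zero j) (det-cong k _ _ λ r c → e (suc r) (punchIn j c)))

private
  Extensional : ∀ {m n} → ((Fin m → Fin n) → ℤ) → Set
  Extensional D = ∀ {f g} → (∀ c → f c ≡ g c) → D f ≡ D g

  -- The Laplace expansion along two rows `a` and `b`. The minor of the other rows enters as an
  -- arbitrary function `D` of the remaining columns, so that the induction can restrict it to fewer
  -- columns.
  doubleSum : ∀ n (a b : Row (suc (suc n))) (D : (Fin n → Fin (suc (suc n))) → ℤ) → ℤ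
  doubleSum n a b D = sumℤ λ j → sumℤ λ k →
    sign (toℕ j) * (a j * (sign (toℕ k) * (b (punchIn j k) * D (λ c → punchIn j (punchIn k c)))))

  liftColumns : ∀ {n} → (Fin n → Fin (suc (suc n))) → Fin (suc n) → Fin (suc (suc (suc n)))
  liftColumns f zero    = zero
  liftColumns f (suc c) = suc (f c)

  edgeSum : ∀ n (a b : Row (suc (suc n))) (D : (Fin n → Fin (suc (suc n))) → ℤ) → ℤ
  edgeSum n a b D = sumℤ λ k → sign (toℕ k) * (a zero * (b (suc k) * D (λ c → suc (punchIn k c))))

  innerSum : ∀ n (a b : Row (suc (suc n))) (D : (Fin n → Fin (suc (suc n))) → ℤ) → ℤ
  innerSum n a b D = sumℤ λ j → sumℤ {n} λ k → sign (toℕ (suc j)) * (a (suc j) *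
    (sign (toℕ (suc k)) * (b (punchIn (suc j) (suc k)) * D (λ c → punchIn (suc j) (punchIn (suc k) c)))))

  -- `edgeSum` collects the terms in which the first row takes column 0. Where the second row takes
  -- it, the column of the first row has its index shifted by one, whence the minus sign. `innerSum`
  -- holds the remaining terms.
  doubleSum-split : ∀ n a b D → Extensional D → doubleSum n a b D ≡ edgeSum n a b D + (- edgeSum n b a D + innerSum n a b D)
  doubleSum-split n a b D ext = cong₂ _+_
    (sum-cong λ k → ring₁ (a zero) (sign (toℕ k)) (b (suc k)) (D (λ c → suc (punchIn k c))))
    (trans (sum-+ {suc n} (λ j → sign (toℕ (suc j)) * (a (suc j) * (1ℤ * (b zero * D (λ c → suc (punchIn j c))))))
                  (λ j → sumℤ {n} λ k → sign (toℕ (suc j)) * (a (suc j) *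
                     (sign (toℕ (suc k)) * (b (punchIn (suc j) (suc k)) * D (λ c → punchIn (suc j) (punchIn (suc k) c)))))))
       (cong (_+ innerSum n a b D) (trans (sum-cong {suc n} (λ j → ring₂ (sign (toℕ j)) (a (suc j)) (b zero) (D (λ c → suc (punchIn j c)))))
         (sum-neg {suc n} (λ k → sign (toℕ k) * (b zero * (a (suc k) * D (λ c → suc (punchIn k c)))))))))
    where
    ring₁ : ∀ a s b d → 1ℤ * (a * (s * (b * d))) ≡ s * (a * (b * d))
    ring₁ = solve-∀
    ring₂ : ∀ s a b d → - s * (a * (1ℤ * (b * d))) ≡ - (s * (b * (a * d)))
    ring₂ = solve-∀

  -- Swapping the rows exchanges the two edge sums, which have opposite signs. The inner sum is an
  -- expansion of the same kind with column 0 removed, so induction applies to it.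
  doubleSum-anti : ∀ n a b D → Extensional D → doubleSum n a b D ≡ - doubleSum n b a D
  innerSum-anti  : ∀ n a b D → Extensional D → innerSum n a b D ≡ - innerSum n b a D

  doubleSum-anti n a b D ext = trans (doubleSum-split n a b D ext)
    (trans (cong (λ z → edgeSum n a b D + (- edgeSum n b a D + z)) (innerSum-anti n a b D ext))
    (trans (ring (edgeSum n a b D) (edgeSum n b a D) (innerSum n b a D)) (cong -_ (sym (doubleSum-split n b a D ext)))))
    where
    ring : ∀ x y z → x + (- y + - z) ≡ - (y + (- x + z))
    ring = solve-∀

  innerSum-anti zero    a b D ext = refl
  innerSum-anti (suc n) a b D ext = trans (reduce a b) (trans (doubleSum-anti n (a ∘ suc) (b ∘ suc) (D ∘ liftColumns)
      (λ e → ext λ { zero → refl ; (suc c) → cong suc (e c) })) (cong -_ (sym (reduce b a))))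
    where
    ring : ∀ s a t b d → - s * (a * (- t * (b * d))) ≡ s * (a * (t * (b * d)))
    ring = solve-∀
    reduce : ∀ a b → innerSum (suc n) a b D ≡ doubleSum n (a ∘ suc) (b ∘ suc) (D ∘ liftColumns)
    reduce a b = sum-cong
      {f = λ j → sumℤ {suc n} λ k → sign (toℕ (suc j)) * (a (suc j) *
        (sign (toℕ (suc k)) * (b (punchIn (suc j) (suc k)) * D (λ c → punchIn (suc j) (punchIn (suc k) c)))))}
      {g = λ j → sumℤ {suc n} λ k → sign (toℕ j) * (a (suc j) *
        (sign (toℕ k) * (b (suc (punchIn j k)) * D (liftColumns (λ c → punchIn j (punchIn k c))))))}
      λ j → sum-cong {suc n} λ k → trans (ring (sign (toℕ j)) (a (suc j)) (sign (toℕ k)) (b (suc (punchIn j k)))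
        (D (λ c → punchIn (suc j) (punchIn (suc k) c))))
      (cong (λ d → sign (toℕ j) * (a (suc j) * (sign (toℕ k) * (b (suc (punchIn j k)) * d))))
        (ext {f = λ c → punchIn (suc j) (punchIn (suc k) c)} {g = liftColumns (λ c → punchIn j (punchIn k c))}
          λ { zero → refl ; (suc c) → refl }))

det-swap₀₁ : ∀ n (a b : Row (suc (suc n))) R → det _ (a ◂ b ◂ R) ≡ - det _ (b ◂ a ◂ R)
det-swap₀₁ n a b R = trans (unfold a b) (trans (doubleSum-anti n a b D
    (λ e → det-cong n _ _ λ r c → cong (R r) (e c))) (cong -_ (sym (unfold b a))))
  where
  D : (Fin n → Fin (suc (suc n))) → ℤ
  D f = det n (λ r c → R r (f c))
  unfold : ∀ a b → det _ (a ◂ b ◂ R) ≡ doubleSum n a b D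
  unfold a b = sum-cong λ j → sym (trans
    (sum-*ˡ (sign (toℕ j)) (λ k → a j * (sign (toℕ k) * (b (punchIn j k) * D (λ c → punchIn j (punchIn k c))))))
    (cong (sign (toℕ j) *_) (sum-*ˡ (a j) (λ k → sign (toℕ k) * (b (punchIn j k) * D (λ c → punchIn j (punchIn k c)))))))

zero-factor : ∀ s m {d} → d ≡ 0ℤ → s * (m * d) ≡ 0ℤ
zero-factor s m refl = trans (cong (s *_) (ℤₚ.*-zeroʳ m)) (ℤₚ.*-zeroʳ s)

minor : ∀ {k} → Mat (suc k) (suc k) → Fin (suc k) → Mat k k
minor M j r c = M (suc r) (punchIn j c)

det-minors-zero : ∀ k (M : Mat (suc k) (suc k)) → (∀ c → det k (minor M c) ≡ 0ℤ) → det _ M ≡ 0ℤ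
det-minors-zero k M e = sum-zero λ c → zero-factor (sign (toℕ c)) (M zero c) (e c)

-- Adjacent equal rows: swapping them shows that the determinant is its own negative. Otherwise swap
-- the first two rows; then each minor along the new first row again has a top row equal to a lower
-- one and vanishes by induction.
det-row₀ : ∀ k (M : Mat (suc k) (suc k)) j → (∀ c → M zero c ≡ M (suc j) c) → det _ M ≡ 0ℤ
det-row₀ (suc k) M zero e = self-neg (trans (det-cong _ M (M zero ◂ M zero ◂ R) λ { zero c → refl ; (suc zero) c → sym (e c) ; (suc (suc r)) c → refl })
  (trans (det-swap₀₁ k (M zero) (M zero) R) (cong -_ (det-cong _ (M zero ◂ M zero ◂ R) M λ { zero c → refl ; (suc zero) c → e c ; (suc (suc r)) c → refl }))))
  where
  R : Mat k (suc (suc k))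
  R r = M (suc (suc r))
  self-neg : ∀ {x} → x ≡ - x → x ≡ 0ℤ
  self-neg {pos zero} _ = refl
  self-neg {pos (suc n)} ()
  self-neg { -[1+ n ]} ()
det-row₀ (suc k) M (suc j) e = trans (det-cong _ M (M zero ◂ M (suc zero) ◂ R) λ { zero c → refl ; (suc zero) c → refl ; (suc (suc r)) c → refl })
  (trans (det-swap₀₁ k (M zero) (M (suc zero)) R)
    (cong -_ (det-minors-zero (suc k) (M (suc zero) ◂ M zero ◂ R)
      λ c → det-row₀ k (minor (M (suc zero) ◂ M zero ◂ R) c) j (λ c′ → e (punchIn c c′)))))
  where
  R : Mat k (suc (suc k))
  R r = M (suc (suc r))

det-row-linear : ∀ k (M : Mat k k) s (x y : Row k) t →
  det k (updateAt M s (λ _ j → x j + t * y j)) ≡ det k (updateAt M s (const x)) + t * det k (updateAt M s (const y))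
det-row-linear (suc k) M zero x y t = trans
  (sum-cong λ j → ring (sign (toℕ j)) (x j) t (y j) (det k (minor M j)))
  (trans (sum-+ (λ j → sign (toℕ j) * (x j * det k (minor M j))) (λ j → t * (sign (toℕ j) * (y j * det k (minor M j)))))
    (cong (λ z → sumℤ (λ j → sign (toℕ j) * (x j * det k (minor M j))) + z)
      (sum-*ˡ t (λ j → sign (toℕ j) * (y j * det k (minor M j))))))
  where
  ring : ∀ s x t y d → s * ((x + t * y) * d) ≡ s * (x * d) + t * (s * (y * d))
  ring = solve-∀
det-row-linear (suc k) M (suc s) x y t = trans (sum-cong λ j →
    trans (cong (λ d → sign (toℕ j) * (M zero j * d)) (linear j)) (ring (sign (toℕ j)) (M zero j) t (D x j) (D y j)))
  (trans (sum-+ (λ j → sign (toℕ j) * (M zero j * D x j)) (λ j → t * (sign (toℕ j) * (M zero j * D y j))))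
    (cong (λ z → sumℤ (λ j → sign (toℕ j) * (M zero j * D x j)) + z) (sum-*ˡ t (λ j → sign (toℕ j) * (M zero j * D y j)))))
  where
  D : Row (suc k) → Fin (suc k) → ℤ
  D x j = det k (minor (updateAt M (suc s) (const x)) j)
  ring : ∀ s m t a b → s * (m * (a + t * b)) ≡ s * (m * a) + t * (s * (m * b))
  ring = solve-∀
  select : ∀ {m n p} (N : Mat m n) s (f : Row n → Row n) (h : Fin p → Fin n) r c →
    updateAt N s f r (h c) ≡ updateAt (λ r c → N r (h c)) s (λ _ → f (N s) ∘ h) r c
  select {suc m} N zero    f h zero    c = refl
  select {suc m} N zero    f h (suc r) c = refl
  select {suc m} N (suc s) f h zero    c = refl
  select {suc m} N (suc s) f h (suc r) c = select (N ∘ suc) s f h r c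
  minor-update : ∀ j f → det k (minor (updateAt M (suc s) f) j) ≡
    det k (updateAt (minor M j) s (λ _ → f (M (suc s)) ∘ punchIn j))
  minor-update j f = det-cong k _ _ (select (M ∘ suc) s f (punchIn j))
  linear : ∀ j → det k (minor (updateAt M (suc s) (λ _ c → x c + t * y c)) j) ≡ D x j + t * D y j
  linear j = trans (minor-update j (λ _ c → x c + t * y c))
    (trans (det-row-linear k (minor M j) s (x ∘ punchIn j) (y ∘ punchIn j) t)
      (sym (cong₂ (λ a b → a + t * b) (minor-update j (const x)) (minor-update j (const y)))))

-- `F` stays abstract so that the induction can absorb the rows already treated into it. The
-- hypothesis `step` changes one row only, and the other rows follow one at a time.
add-multiples : ∀ {n} k (F : (Fin k → Row n) → ℤ) (a : Row n) →
  (∀ {R R′} → (∀ r c → R r c ≡ R′ r c) → F R ≡ F R′) →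
  (∀ R s t → F (updateAt R s (λ row c → row c + t * a c)) ≡ F R) →
  ∀ R (t : Fin k → ℤ) → F (λ r c → R r c + t r * a c) ≡ F R
add-multiples zero    F a ext step R t = ext λ ()
add-multiples (suc k) F a ext step R t = begin
  F (λ r c → R r c + t r * a c)             ≡⟨ ext (λ { zero c → refl ; (suc r) c → refl }) ⟩
  F (updateAt (R zero ◂ λ r c → R (suc r) c + t (suc r) * a c) zero (λ row c → row c + t zero * a c))
                                            ≡⟨ step _ zero (t zero) ⟩
  F (R zero ◂ λ r c → R (suc r) c + t (suc r) * a c)
    ≡⟨ add-multiples k (λ R′ → F (R zero ◂ R′)) a (λ e → ext λ { zero c → refl ; (suc r) c → e r c })
         (λ R′ s u → trans (ext λ { zero c → refl ; (suc r) c → refl }) (step (R zero ◂ R′) (suc s) u)) (R ∘ suc) (t ∘ suc) ⟩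
  F (R zero ◂ (R ∘ suc))                    ≡⟨ ext (λ { zero c → refl ; (suc r) c → refl }) ⟩
  F R ∎
  where open ≡-Reasoning

det-row-operations : ∀ k (M : Mat (suc k) (suc k)) (t : Fin k → ℤ) →
  det _ (M zero ◂ λ r c → M (suc r) c + t r * M zero c) ≡ det _ M
det-row-operations k M t = trans
  (add-multiples k (λ R → det _ (M zero ◂ R)) (M zero) (λ {R} {R′} e → det-cong _ (M zero ◂ R) (M zero ◂ R′) λ { zero c → refl ; (suc r) c → e r c }) step (M ∘ suc) t)
  (det-cong _ (M zero ◂ (M ∘ suc)) M λ { zero c → refl ; (suc r) c → refl })
  where
  at : ∀ {m n} (R : Fin m → Row n) s {f : Row n → Row n} c → updateAt R s f s c ≡ f (R s) c
  at {suc m} R zero    c = refl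
  at {suc m} R (suc s) c = at (R ∘ suc) s c
  unchanged : ∀ {m n} (R : Fin m → Row n) s r c → updateAt R s (const (R s)) r c ≡ R r c
  unchanged {suc m} R zero    zero    c = refl
  unchanged {suc m} R zero    (suc r) c = refl
  unchanged {suc m} R (suc s) zero    c = refl
  unchanged {suc m} R (suc s) (suc r) c = unchanged (R ∘ suc) s r c
  const-value : ∀ {m n} (R : Fin m → Row n) s (f : Row n → Row n) r c → updateAt R s f r c ≡ updateAt R s (const (f (R s))) r c
  const-value {suc m} R zero    f zero    c = refl
  const-value {suc m} R zero    f (suc r) c = refl
  const-value {suc m} R (suc s) f zero    c = refl
  const-value {suc m} R (suc s) f (suc r) c = const-value (R ∘ suc) s f r c
  step : ∀ R s u → det _ (M zero ◂ updateAt R s (λ row c → row c + u * M zero c)) ≡ det _ (M zero ◂ R)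
  step R s u = begin
    det _ (M zero ◂ updateAt R s (λ row c → row c + u * M zero c))
      ≡⟨ det-cong _ (M zero ◂ updateAt R s (λ row c → row c + u * M zero c)) (updateAt (M zero ◂ R) (suc s) (λ _ c → R s c + u * M zero c))
           (λ { zero c → refl ; (suc r) c → const-value R s (λ row c → row c + u * M zero c) r c }) ⟩
    det _ (updateAt (M zero ◂ R) (suc s) (λ _ c → R s c + u * M zero c))
      ≡⟨ det-row-linear _ (M zero ◂ R) (suc s) (R s) (M zero) u ⟩
    det _ (updateAt (M zero ◂ R) (suc s) (const (R s))) + u * det _ (updateAt (M zero ◂ R) (suc s) (const (M zero)))
      ≡⟨ cong₂ (λ a b → a + u * b) (det-cong _ (updateAt (M zero ◂ R) (suc s) (const (R s))) (M zero ◂ R) (λ { zero c → refl ; (suc r) c → unchanged R s r c }))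
           (det-row₀ k (updateAt (M zero ◂ R) (suc s) (const (M zero))) s λ c → sym (at R s c)) ⟩
    det _ (M zero ◂ R) + u * 0ℤ ≡⟨ cong (det _ (M zero ◂ R) +_) (ℤₚ.*-zeroʳ u) ⟩
    det _ (M zero ◂ R) + 0ℤ     ≡⟨ ℤₚ.+-identityʳ (det _ (M zero ◂ R)) ⟩
    det _ (M zero ◂ R) ∎
    where open ≡-Reasoning

det-zero-column : ∀ k (M : Mat (suc k) (suc k)) j → (∀ r → M r j ≡ 0ℤ) → det _ M ≡ 0ℤ
det-zero-column k M j e = sum-zero λ j′ → term k M j e j′ (j′ ≟ j)
  where
  term : ∀ k (M : Mat (suc k) (suc k)) j → (∀ r → M r j ≡ 0ℤ) → ∀ j′ → Dec (j′ ≡ j) →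
    sign (toℕ j′) * (M zero j′ * det k (minor M j′)) ≡ 0ℤ
  term k M j e j (yes refl) = trans (cong (λ z → sign (toℕ j) * (z * det k (minor M j))) (e zero)) (ℤₚ.*-zeroʳ (sign (toℕ j)))
  term zero M zero e zero (no j′≢j) = contradiction refl j′≢j
  term (suc k) M j e j′ (no j′≢j) = zero-factor (sign (toℕ j′)) (M zero j′)
    (det-zero-column k (minor M j′) (punchOut j′≢j) λ r → trans (cong (M (suc r)) (Finₚ.punchIn-punchOut j′≢j)) (e (suc r)))

-- The pivot `a j` will be 1 or -1, hence its own inverse, which explains the multiplier
-- `M r j * a j`. Column `j`, zero after clearing, is dropped.
eliminate : ∀ {m n} → Row (suc n) → Fin (suc n) → Mat m (suc n) → Mat m n
eliminate a j M r c = M r (punchIn j c) - M r j * a j * a (punchIn j c)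

-- Clearing column j with the pivot M 0 j = ±1 and expanding along row 0.
det-pivot : ∀ k (M : Mat (suc k) (suc k)) j → M zero j * M zero j ≡ 1ℤ →
  det _ M ≡ sign (toℕ j) * (M zero j * det k (eliminate (M zero) j (M ∘ suc)))
det-pivot k M j unit = begin
  det _ M                              ≡⟨ sym (det-row-operations k M t) ⟩
  det _ N                              ≡⟨ sum-only j (λ j′ → sign (toℕ j′) * (M zero j′ * det k (minor N j′))) (off k N cleared) ⟩
  sign (toℕ j) * (M zero j * det k (minor N j))
    ≡⟨ cong (λ d → sign (toℕ j) * (M zero j * d)) (det-cong k (minor N j) (eliminate (M zero) j (M ∘ suc)) λ r c →
         cong (M (suc r) (punchIn j c) +_) (sym (ℤₚ.neg-distribˡ-* (M (suc r) j * M zero j) (M zero (punchIn j c))))) ⟩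
  sign (toℕ j) * (M zero j * det k (eliminate (M zero) j (M ∘ suc))) ∎
  where
  open ≡-Reasoning
  t : Fin k → ℤ
  t r = - (M (suc r) j * M zero j)
  N : Mat (suc k) (suc k)
  N = M zero ◂ λ r c → M (suc r) c + t r * M zero c
  ring : ∀ x y → x + - (x * y) * y ≡ x * (1ℤ - y * y)
  ring = solve-∀
  cleared : ∀ r → N (suc r) j ≡ 0ℤ
  cleared r = trans (ring (M (suc r) j) (M zero j)) (trans (cong (λ u → M (suc r) j * (1ℤ - u)) unit) (ℤₚ.*-zeroʳ (M (suc r) j)))
  off : ∀ k (N : Mat (suc k) (suc k)) {j} → (∀ r → N (suc r) j ≡ 0ℤ) → ∀ j′ → j′ ≢ j →
    sign (toℕ j′) * (N zero j′ * det k (minor N j′)) ≡ 0ℤ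
  off zero N {zero} cleared zero j′≢j = contradiction refl j′≢j
  off (suc k) N cleared j′ j′≢j = zero-factor (sign (toℕ j′)) (N zero j′)
    (det-zero-column k (minor N j′) (punchOut j′≢j) λ r → trans (cong (N (suc r)) (Finₚ.punchIn-punchOut j′≢j)) (cleared r))

-- Relations modulo p

Sgn : ℤ → Set
Sgn z = (z ≡ pos 0) ⊎ (z ≡ pos 1) ⊎ (z ≡ -[1+ 0 ])

sgn-* : ∀ {x y} → Sgn x → Sgn y → Sgn (x * y)
sgn-* (inj₁ refl)        (inj₁ refl)        = inj₁ refl
sgn-* (inj₁ refl)        (inj₂ (inj₁ refl)) = inj₁ refl
sgn-* (inj₁ refl)        (inj₂ (inj₂ refl)) = inj₁ refl
sgn-* (inj₂ (inj₁ refl)) (inj₁ refl)        = inj₁ refl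
sgn-* (inj₂ (inj₁ refl)) (inj₂ (inj₁ refl)) = inj₂ (inj₁ refl)
sgn-* (inj₂ (inj₁ refl)) (inj₂ (inj₂ refl)) = inj₂ (inj₂ refl)
sgn-* (inj₂ (inj₂ refl)) (inj₁ refl)        = inj₁ refl
sgn-* (inj₂ (inj₂ refl)) (inj₂ (inj₁ refl)) = inj₂ (inj₂ refl)
sgn-* (inj₂ (inj₂ refl)) (inj₂ (inj₂ refl)) = inj₂ (inj₁ refl)

sgn-neg : ∀ {x} → Sgn x → Sgn (- x)
sgn-neg (inj₁ refl)        = inj₁ refl
sgn-neg (inj₂ (inj₁ refl)) = inj₂ (inj₂ refl)
sgn-neg (inj₂ (inj₂ refl)) = inj₂ (inj₁ refl)

sgn-sign : ∀ k → Sgn (sign k)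
sgn-sign zero    = inj₂ (inj₁ refl)
sgn-sign (suc k) = sgn-neg (sgn-sign k)

sgn-square : ∀ {x} → Sgn x → x ≢ 0ℤ → x * x ≡ 1ℤ
sgn-square (inj₁ refl)        x≢0 = contradiction refl x≢0
sgn-square (inj₂ (inj₁ refl)) x≢0 = refl
sgn-square (inj₂ (inj₂ refl)) x≢0 = refl

-- Unlike `eliminate`, this keeps the cleared column `j` as a zero column, so that the columns of a
-- network keep their indices under pivoting.
clear : ∀ {m n} → Row n → Fin n → Mat m n → Mat m n
clear a j M r c = M r c - M r j * a j * a c

entry : ∀ {g n} (A : Mat g n) → TotallyUnimodular A → ∀ i j → Sgn (A i j)
entry A tu i j = subst Sgn (ring (A i j)) (tu 1 (const i) (const j))
  where
  ring : ∀ x → 1ℤ * (x * 1ℤ) + 0ℤ ≡ x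
  ring = solve-∀

-- By `det-pivot`, a minor of the new matrix is up to sign the minor of `A` bordered by row `i` and
-- column `j`. The bordered selection may repeat row `i`, which `TotallyUnimodular` allows.
tu-eliminate : ∀ {g n} (A : Mat g (suc n)) i j → A i j * A i j ≡ 1ℤ →
  TotallyUnimodular A → TotallyUnimodular (eliminate (A i) j A)
tu-eliminate A i j unit tu k r c = subst Sgn
  (trans (cong (A i j *_) (det-pivot k M zero unit)) (trans (ring (A i j) D) (trans (cong (_* D) unit) (ℤₚ.*-identityˡ D))))
  (sgn-* (entry A tu i j) (tu (suc k) (i ◂ r) (j ◂ (punchIn j ∘ c))))
  where
  M : Mat (suc k) (suc k)
  M a b = A ((i ◂ r) a) ((j ◂ (punchIn j ∘ c)) b)
  D : ℤ
  D = det k (λ a b → eliminate (A i) j A (r a) (c b))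
  ring : ∀ x d → x * (1ℤ * (x * d)) ≡ x * x * d
  ring = solve-∀

infixl 7 _∙_
_∙_ : ∀ {g n} → Mat g n → Row n → Row g
(A ∙ c) r = sumℤ λ i → c i * A r i

∙-clear : ∀ {n} (c x y : Row n) k → sumℤ (λ j → c j * (x j - k * y j)) ≡ sumℤ (λ j → c j * x j) - k * sumℤ (λ j → c j * y j)
∙-clear c x y k = trans (sum-cong λ j → ring (c j) (x j) k (y j))
  (trans (sum-minus (λ j → c j * x j) (λ j → k * (c j * y j))) (cong (λ z → sumℤ (λ j → c j * x j) - z) (sum-*ˡ k (λ j → c j * y j))))
  where
  ring : ∀ c x k y → c * (x - k * y) ≡ c * x - k * (c * y)
  ring = solve-∀

∣-sum : ∀ {p n} (f : Fin n → ℤ) → (∀ i → p ∣ f i) → p ∣ sumℤ f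
∣-sum {n = zero}  f d = divides 0ℤ refl
∣-sum {n = suc n} f d = ∣m∣n⇒∣m+n (d zero) (∣-sum (f ∘ suc) (d ∘ suc))

-- The last clause says that lifting does not enlarge the support. `unit-entry` and `camion` both
-- draw their contradictions from it.
Lift : ∀ {g n} → Mat g n → ℤ → Row n → Set
Lift {g} {n} A p c = Σ (Row n) λ c′ → (∀ s → (A ∙ c′) s ≡ 0ℤ) × (∀ j → p ∣ c′ j - c j) × (∀ j → c j ≡ 0ℤ → c′ j ≡ 0ℤ)

-- Relations between columns that hold modulo p lift to relations over ℤ. This is the basis-free, GL-invariant
-- trace of total unimodularity that the classification uses.
Liftable : ∀ {g n} → Mat g n → Set
Liftable {g} {n} A = ∀ p (c : Row n) → (∀ s → p ∣ (A ∙ c) s) → Lift A p c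

tailCols : ∀ {g n} → Mat g (suc n) → Mat g n
tailCols A s j = A s (suc j)

∣-refl-diff : ∀ p x → p ∣ x - x
∣-refl-diff p x = divides 0ℤ (ℤₚ.+-inverseʳ x)

lift-skip : ∀ {g n} (A : Mat g (suc n)) p c x → (∀ s → x * A s zero ≡ 0ℤ) → p ∣ x - c zero →
  (c zero ≡ 0ℤ → x ≡ 0ℤ) → Lift (tailCols A) p (c ∘ suc) → Lift A p c
lift-skip A p c x xz dx sx (c′ , rel , cong-p , supp) = x ◂ c′ , (λ s → cong₂ _+_ (xz s) (rel s)) ,
  (λ { zero → dx ; (suc j) → cong-p j }) , (λ { zero → sx ; (suc j) → supp j })

module _ {g n} (A : Mat g (suc n)) (i : Fin g) (unit : A i zero * A i zero ≡ 1ℤ) (p : ℤ) (c : Row (suc n))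
  (d : ∀ s → p ∣ (A ∙ c) s) where
  private
    a : ℤ
    a = A i zero
    T₀ : Row g
    T₀ = tailCols A ∙ (c ∘ suc)

  eliminate-∣ : ∀ s → p ∣ (eliminate (A i) zero A ∙ (c ∘ suc)) s
  eliminate-∣ s = subst (p ∣_) (trans (combine s) (sym (∙-clear (c ∘ suc) (tailCols A s) (tailCols A i) (A s zero * a))))
    (∣m∣n⇒∣m+n (d s) (∣m⇒∣-m (∣n⇒∣m*n (A s zero * a) (d i))))
    where
    ring : ∀ c₀ x a t u → (c₀ * x + t) - x * a * (c₀ * a + u) ≡ c₀ * x * (1ℤ - a * a) + (t - x * a * u)
    ring = solve-∀
    ring₂ : ∀ x y → x * (1ℤ - 1ℤ) + y ≡ y
    ring₂ = solve-∀
    combine : ∀ s → (A ∙ c) s - A s zero * a * (A ∙ c) i ≡ T₀ s - A s zero * a * T₀ i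
    combine s = trans (ring (c zero) (A s zero) a (T₀ s) (T₀ i))
      (trans (cong (λ u → c zero * A s zero * (1ℤ - u) + (T₀ s - A s zero * a * T₀ i)) unit)
        (ring₂ (c zero * A s zero) (T₀ s - A s zero * a * T₀ i)))

  lift-pivot : c zero ≢ 0ℤ → Lift (eliminate (A i) zero A) p (c ∘ suc) → Lift A p c
  -- The coefficient of column 0 is forced by row `i`, where the pivot is its own inverse. It is
  -- congruent to `c zero` because `c` is a relation modulo `p` in row `i`.
  lift-pivot c₀≢0 (c″ , rel , cong-p , supp) = - (a * T″ i) ◂ c″ , vanish ,
    (λ { zero → subst (p ∣_) lift₀ (∣m∣n⇒∣m+n
           (∣n⇒∣m*n (- a) (∣-sum (λ j → (c″ j - c (suc j)) * A i (suc j)) λ j → ∣m⇒∣m*n (A i (suc j)) (cong-p j)))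
           (∣m⇒∣-m (∣n⇒∣m*n a (d i))))
       ; (suc j) → cong-p j }) ,
    (λ { zero → λ z → contradiction z c₀≢0 ; (suc j) → supp j })
    where
    T″ : Row g
    T″ = tailCols A ∙ c″
    ring : ∀ a t x u → - (a * t) * x + u ≡ u - x * a * t
    ring = solve-∀
    ring₁ : ∀ x y z → (x - y) * z ≡ x * z - y * z
    ring₁ = solve-∀
    ring₂ : ∀ a t u c → - a * (t - u) + - (a * (c * a + u)) ≡ - (a * t) - a * a * c
    ring₂ = solve-∀
    vanish : ∀ s → (A ∙ (- (a * T″ i) ◂ c″)) s ≡ 0ℤ
    vanish s = trans (ring a (T″ i) (A s zero) (T″ s))
      (trans (sym (∙-clear c″ (tailCols A s) (tailCols A i) (A s zero * a))) (rel s))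
    lift₀ : - a * sumℤ (λ j → (c″ j - c (suc j)) * A i (suc j)) + - (a * (A ∙ c) i) ≡ - (a * T″ i) - c zero
    lift₀ = trans (cong (λ z → - a * z + - (a * (A ∙ c) i))
        (trans (sum-cong λ j → ring₁ (c″ j) (c (suc j)) (A i (suc j))) (sum-minus (λ j → c″ j * A i (suc j)) (λ j → c (suc j) * A i (suc j)))))
      (trans (ring₂ a (T″ i) (T₀ i) (c zero)) (trans (cong (λ u → - (a * T″ i) - u * c zero) unit)
        (cong (λ z → - (a * T″ i) - z) (ℤₚ.*-identityˡ (c zero)))))

-- Gaussian elimination, column by column. Total unimodularity makes every nonzero pivot a unit and
-- survives the elimination, so one can solve for the coefficient of the pivot column over ℤ.
-- Columns with coefficient 0 are skipped, which preserves the support.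
tu⇒liftable : ∀ {g n} (A : Mat g n) → TotallyUnimodular A → Liftable A
tu⇒liftable {n = zero} A tu p c d = c , (λ s → refl) , (λ ()) , (λ ())
tu⇒liftable {g} {suc n} A tu p c d = go (c zero ℤ.≟ 0ℤ) (Finₚ.any? λ s → ¬? (A s zero ℤ.≟ 0ℤ))
  where
  rest : (∀ s → c zero * A s zero ≡ 0ℤ) → Lift (tailCols A) p (c ∘ suc)
  rest z = tu⇒liftable (tailCols A) (λ k r e → tu k r (suc ∘ e)) p (c ∘ suc)
    (λ s → subst (p ∣_) (trans (cong (_+ (tailCols A ∙ (c ∘ suc)) s) (z s)) (ℤₚ.+-identityˡ ((tailCols A ∙ (c ∘ suc)) s))) (d s))
  go : Dec (c zero ≡ 0ℤ) → Dec (∃ λ s → A s zero ≢ 0ℤ) → Lift A p c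
  go (yes c₀≡0) _ = lift-skip A p c 0ℤ (λ s → refl) (subst (λ z → p ∣ 0ℤ - z) (sym c₀≡0) (∣-refl-diff p 0ℤ)) (λ _ → refl)
    (rest λ s → cong (_* A s zero) c₀≡0)
  go (no c₀≢0) (no none) = lift-skip A p c (c zero) zero-col (∣-refl-diff p (c zero)) id (rest zero-col)
    where
    zero-col : ∀ s → c zero * A s zero ≡ 0ℤ
    zero-col s with A s zero ℤ.≟ 0ℤ
    ... | yes e = trans (cong (c zero *_) e) (ℤₚ.*-zeroʳ (c zero))
    ... | no ne = contradiction (s , ne) none
  go (no c₀≢0) (yes (i , Ai≢0)) = lift-pivot A i unit p c d c₀≢0
    (tu⇒liftable (eliminate (A i) zero A) (tu-eliminate A i zero unit tu) p (c ∘ suc) (eliminate-∣ A i unit p c d))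
    where
    unit : A i zero * A i zero ≡ 1ℤ
    unit = sgn-square (entry A tu i zero) Ai≢0

-- Graphs and network matrices

reach-trans : ∀ {V n} {ends : Ends V n} {S u v w} → Reach ends S u v → Reach ends S v w → Reach ends S u w
reach-trans p here        = p
reach-trans p (fwd e t q) = fwd e t (reach-trans p q)
reach-trans p (bwd e t q) = bwd e t (reach-trans p q)

reach-sym : ∀ {V n} {ends : Ends V n} {S u v} → Reach ends S u v → Reach ends S v u
reach-sym here        = here
reach-sym (fwd e t q) = reach-trans (bwd e t here) (reach-sym q)
reach-sym (bwd e t q) = reach-trans (fwd e t here) (reach-sym q)

reach-elim : ∀ {V n} {ends : Ends V n} {S u v} {X : Set} (f : Fin V → X) →
  (∀ e → S e ≡ true → f (proj₁ (ends e)) ≡ f (proj₂ (ends e))) → Reach ends S u v → f u ≡ f v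
reach-elim f h here        = refl
reach-elim f h (fwd e t q) = trans (reach-elim f h q) (h e t)
reach-elim f h (bwd e t q) = trans (reach-elim f h q) (sym (h e t))

reach-suc : ∀ {V n} {ends : Ends V (suc n)} {S u v} → Reach (ends ∘ suc) (S ∘ suc) u v → Reach ends S u v
reach-suc here        = here
reach-suc (fwd e t q) = fwd (suc e) t (reach-suc q)
reach-suc (bwd e t q) = bwd (suc e) t (reach-suc q)

merge : ∀ {V} (a b : Fin V) → Fin V → Fin V
merge a b x with x ≟ b
... | yes _ = a
... | no  _ = x

merge-to : ∀ {V} (a b : Fin V) → merge a b b ≡ a
merge-to a b with b ≟ b
... | yes _ = refl
... | no ne = contradiction refl ne

merge-from : ∀ {V} (a b : Fin V) → merge a b a ≡ a
merge-from a b with a ≟ b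
... | yes _ = refl
... | no _  = refl

merge-other : ∀ {V} {a b x : Fin V} → x ≢ b → merge a b x ≡ x
merge-other {b = b} {x} ne with x ≟ b
... | yes e = contradiction e ne
... | no _  = refl

record Components {V n} (ends : Ends V n) (S : Subset n) : Set where
  constructor components
  field
    comp    : Fin V → Fin V
    stable  : ∀ x → comp (comp x) ≡ comp x
    joined  : ∀ e → S e ≡ true → comp (proj₁ (ends e)) ≡ comp (proj₂ (ends e))
    reaches : ∀ {u v} → comp u ≡ comp v → Reach ends S u v

findComponents : ∀ {V n} (ends : Ends V n) (S : Subset n) → Components ends S
findComponents {n = zero}  ends S = components id (λ _ → refl) (λ ()) λ { refl → here }
findComponents {n = suc n} ends S with findComponents (ends ∘ suc) (S ∘ suc) | S zero in S₀
... | components f s j r | false = components f s (λ { zero t → contradiction (trans (sym S₀) t) λ () ; (suc e) → j e }) (reach-suc ∘ r)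
... | components f s j r | true  = components (merge a b ∘ f) stable′
    (λ { zero _ → trans (merge-from a b) (sym (merge-to a b)) ; (suc e) t → cong (merge a b) (j e t) })
    (λ {u} {v} → back u v)
  where
  a = f (proj₁ (ends zero))
  b = f (proj₂ (ends zero))
  stable′ : ∀ x → merge a b (f (merge a b (f x))) ≡ merge a b (f x)
  stable′ x with f x ≟ b
  ... | yes _ = trans (cong (merge a b) (s (proj₁ (ends zero)))) (merge-from a b)
  ... | no ne = trans (cong (merge a b) (s x)) (merge-other ne)
  back : ∀ u v → merge a b (f u) ≡ merge a b (f v) → Reach ends S u v
  back u v e with f u ≟ b | f v ≟ b
  ... | yes p | yes q = reach-suc (r (trans p (sym q)))
  ... | yes p | no _  = reach-trans (reach-suc (r p)) (reach-trans (bwd zero S₀ here) (reach-suc (r e)))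
  ... | no _  | yes q = reach-trans (reach-suc (r e)) (reach-trans (fwd zero S₀ here) (reach-suc (r (sym q))))
  ... | no _  | no _  = reach-suc (r e)

δ : ∀ {V} → (Fin V → ℤ) → Fin V × Fin V → ℤ
δ p (a , b) = p b - p a

δ-cong : ∀ {V} (p q : Fin V → ℤ) e → p (proj₁ e) ≡ q (proj₁ e) → p (proj₂ e) ≡ q (proj₂ e) → δ p e ≡ δ q e
δ-cong p q e e₁ e₂ = cong₂ _-_ e₂ e₁

δ-zero : ∀ {V} (p : Fin V → ℤ) e → p (proj₁ e) ≡ p (proj₂ e) → δ p e ≡ 0ℤ
δ-zero p (a , b) e = trans (cong (λ z → p b - z) e) (ℤₚ.+-inverseʳ (p b))

δ-zero⁻¹ : ∀ {V} (p : Fin V → ℤ) e → δ p e ≡ 0ℤ → p (proj₁ e) ≡ p (proj₂ e)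
δ-zero⁻¹ p (a , b) e = sym (ℤₚ.i-j≡0⇒i≡j (p b) (p a) e)

indicator : ∀ {V} → (Fin V → Fin V) → Fin V → Fin V → ℤ
indicator f v x = idℤ (f x) (f v)

indicator-sgn : ∀ {V} (f : Fin V → Fin V) v e → Sgn (δ (indicator f v) e)
indicator-sgn f v (a , b) with f a ≟ f v | f b ≟ f v
... | yes _ | yes _ = inj₁ refl
... | yes _ | no _  = inj₂ (inj₂ refl)
... | no _  | yes _ = inj₂ (inj₁ refl)
... | no _  | no _  = inj₁ refl

-- The columns κ form a forest and each row ρ i expresses the potential difference along ρ i by those along the
-- columns: a network matrix, after some columns (those not in act) have been cleared.
record Network {m n} (M : Mat m n) (act : Subset n) : Set where
  field
    {V}  : ℕ
    ρ    : Ends V m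
    κ    : Ends V n
    path : ∀ p i → δ p (ρ i) ≡ sumℤ λ j → δ p (κ j) * M i j
    idle : ∀ j → act j ≡ false → ∀ i → M i j ≡ 0ℤ
    dual : ∀ j → act j ≡ true → Σ (Fin V → ℤ) λ p → ∀ j′ → act j′ ≡ true → δ p (κ j′) ≡ idℤ j′ j

module _ {m n} {M : Mat m n} {act : Subset n} (N : Network M act) where
  open Network N

  -- Entries are potential differences, and every potential dual to column `j` computes them. This
  -- leaves the freedom to choose a convenient one.
  path-dual : ∀ j (p : Fin V → ℤ) → (∀ j′ → act j′ ≡ true → δ p (κ j′) ≡ idℤ j′ j) → ∀ i → δ p (ρ i) ≡ M i j
  path-dual j p d i = trans (path p i) (trans (sum-cong {f = λ j′ → δ p (κ j′) * M i j′} {g = λ j′ → idℤ j j′ * M i j′} term) (sum-idˡ j (M i)))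
    where
    term : ∀ j′ → δ p (κ j′) * M i j′ ≡ idℤ j j′ * M i j′
    term j′ with act j′ in a
    ... | true  = cong (_* M i j′) (trans (d j′ a) (idℤ-sym j′ j))
    ... | false = trans (cong (δ p (κ j′) *_) (idle j′ a i)) (trans (ℤₚ.*-zeroʳ (δ p (κ j′)))
      (sym (trans (cong (idℤ j j′ *_) (idle j′ a i)) (ℤₚ.*-zeroʳ (idℤ j j′)))))

  -- Without edge `j` the forest no longer joins the ends of that edge, since a dual potential is
  -- constant on the remaining components but not along `j`. Hence the indicator of the component of
  -- the head of `j` is also dual to `j`, and indicators only have differences 0, 1 and -1.
  network-entry : ∀ i j → Sgn (M i j)
  network-entry i j with act j in aj
  ... | false = inj₁ (idle j aj i)
  ... | true  = subst Sgn (path-dual j K K-dual i) (indicator-sgn f (proj₂ (κ j)) (ρ i))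
    where
    others : Subset n
    others j′ = act j′ ∧ not (does (j′ ≟ j))
    C : Components κ others
    C = findComponents κ others
    f = Components.comp C
    K = indicator f (proj₂ (κ j))
    p = proj₁ (dual j aj)
    separated : f (proj₁ (κ j)) ≢ f (proj₂ (κ j))
    separated e = contradiction (trans (sym (trans (proj₂ (dual j aj) j aj) (idℤ-diag j))) (δ-zero p (κ j) (reach-elim p level (Components.reaches C e)))) λ ()
      where
      level : ∀ j′ → others j′ ≡ true → p (proj₁ (κ j′)) ≡ p (proj₂ (κ j′))
      level j′ t with act j′ in aj′ | j′ ≟ j
      ... | true | no ne = δ-zero⁻¹ p (κ j′) (trans (proj₂ (dual j aj) j′ aj′) (idℤ-off ne))
    K-dual : ∀ j′ → act j′ ≡ true → δ K (κ j′) ≡ idℤ j′ j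
    K-dual j′ aj′ with j′ ≟ j
    ... | yes refl = cong₂ _-_ (idℤ-diag (f (proj₂ (κ j)))) (idℤ-off separated)
    ... | no ne    = δ-zero K (κ j′) (cong (λ x → idℤ x (f (proj₂ (κ j)))) (Components.joined C j′ (trans (cong₂ (λ x y → x ∧ not y) aj′ (dec-false (j′ ≟ j) ne)) refl)))

without : ∀ {n} → Subset n → Fin n → Subset n
without act j₀ j = act j ∧ not (does (j ≟ j₀))

without-true : ∀ {n} (act : Subset n) j₀ j → without act j₀ j ≡ true → act j ≡ true × j ≢ j₀
without-true act j₀ j t with act j | j ≟ j₀
... | true | no ne = refl , ne

-- Clearing column j₀ with row i₀ contracts the edge ρ i₀.
network-pivot : ∀ {m n} {M : Mat m n} {act : Subset n} → Network M act → ∀ i₀ j₀ →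
  M i₀ j₀ * M i₀ j₀ ≡ 1ℤ → Network (clear (M i₀) j₀ M) (without act j₀)
network-pivot {m} {n} {M} {act} N i₀ j₀ unit = record
  { ρ = both ∘ ρ ; κ = both ∘ κ ; path = path′ ; idle = idle′ ; dual = dual′ }
  where
  open Network N
  a b : Fin V
  a = proj₁ (ρ i₀)
  b = proj₂ (ρ i₀)
  both : Fin V × Fin V → Fin V × Fin V
  both (x , y) = merge a b x , merge a b y
  u = M i₀ j₀
  path′ : ∀ p i → δ p (both (ρ i)) ≡ sumℤ λ j → δ p (both (κ j)) * clear (M i₀) j₀ M i j
  path′ p i = sym (trans (∙-clear (λ j → δ q (κ j)) (M i) (M i₀) (M i j₀ * u))
    (trans (cong₂ (λ x y → x - M i j₀ * u * y) (sym (path q i)) (trans (sym (path q i₀)) contracted))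
      (trans (cong (λ z → δ q (ρ i) - z) (ℤₚ.*-zeroʳ (M i j₀ * u))) (ℤₚ.+-identityʳ (δ q (ρ i))))))
    where
    q : Fin V → ℤ
    q = p ∘ merge a b
    contracted : δ q (ρ i₀) ≡ 0ℤ
    contracted = δ-zero q (ρ i₀) (cong p (trans (merge-from a b) (sym (merge-to a b))))
  idle′ : ∀ j → without act j₀ j ≡ false → ∀ i → clear (M i₀) j₀ M i j ≡ 0ℤ
  idle′ j off i with act j in aj | j ≟ j₀
  ... | false | _        = trans (cong₂ (λ x y → x - M i j₀ * u * y) (idle j aj i) (idle j aj i₀)) (cong (λ z → 0ℤ - z) (ℤₚ.*-zeroʳ (M i j₀ * u)))
  ... | true  | yes refl = trans (ring (M i j) u) (trans (cong (λ z → M i j * (1ℤ - z)) unit) (ℤₚ.*-zeroʳ (M i j)))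
    where
    ring : ∀ x u → x - x * u * u ≡ x * (1ℤ - u * u)
    ring = solve-∀
  j₀-active : act j₀ ≡ true
  j₀-active with act j₀ in aj
  ... | true = refl
  ... | false = contradiction (trans (sym unit) (cong₂ _*_ (idle j₀ aj i₀) (idle j₀ aj i₀))) λ ()
  dual′ : ∀ j → without act j₀ j ≡ true → Σ (Fin V → ℤ) λ p → ∀ j′ → without act j₀ j′ ≡ true → δ p (both (κ j′)) ≡ idℤ j′ j
  dual′ j on with without-true act j₀ j on
  ... | aj , j≢j₀ = p , λ j′ on′ → trans (δ-cong (p ∘ merge a b) p (κ j′) (merged (proj₁ (κ j′))) (merged (proj₂ (κ j′)))) (value j′ (without-true act j₀ j′ on′))
    where
    -- With this multiple of the potential dual to `j₀` subtracted, the difference along `ρ i₀` is M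
    -- i₀ j · (1 - u²) = 0, so the potential descends to the contracted graph.
    k = u * M i₀ j
    pⱼ = proj₁ (dual j aj)
    p₀ = proj₁ (dual j₀ j₀-active)
    p : Fin V → ℤ
    p x = pⱼ x - k * p₀ x
    ring : ∀ x y k z w → (x - k * y) - (z - k * w) ≡ (x - z) - k * (y - w)
    ring = solve-∀
    δp : ∀ e → δ p e ≡ δ pⱼ e - k * δ p₀ e
    δp (x , y) = ring (pⱼ y) (p₀ y) k (pⱼ x) (p₀ x)
    ring′ : ∀ u x → x - u * x * u ≡ x * (1ℤ - u * u)
    ring′ = solve-∀
    flat : p a ≡ p b
    flat = δ-zero⁻¹ p (ρ i₀) (trans (δp (ρ i₀)) (trans (cong₂ (λ x y → x - k * y)
        (path-dual N j pⱼ (proj₂ (dual j aj)) i₀) (path-dual N j₀ p₀ (proj₂ (dual j₀ j₀-active)) i₀))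
      (trans (ring′ u (M i₀ j)) (trans (cong (λ z → M i₀ j * (1ℤ - z)) unit) (ℤₚ.*-zeroʳ (M i₀ j))))))
    merged : ∀ x → p (merge a b x) ≡ p x
    merged x with x ≟ b
    ... | yes refl = flat
    ... | no _     = refl
    value : ∀ j′ → act j′ ≡ true × j′ ≢ j₀ → δ p (κ j′) ≡ idℤ j′ j
    value j′ (aj′ , ne) = trans (δp (κ j′)) (trans (cong₂ (λ x y → x - k * y) (proj₂ (dual j aj) j′ aj′)
        (trans (proj₂ (dual j₀ j₀-active) j′ aj′) (idℤ-off ne)))
      (trans (cong (λ z → idℤ j′ j - z) (ℤₚ.*-zeroʳ k)) (ℤₚ.+-identityʳ (idℤ j′ j))))

-- Expanding a minor at a unit entry of its first row leaves a smaller minor of the pivoted matrix,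
-- which is again a network with the same row and column indices.
network-tu : ∀ {m n} (M : Mat m n) (act : Subset n) → Network M act → TotallyUnimodular M
network-tu M act N zero    r c = inj₂ (inj₁ refl)
network-tu {m} {n} M act N (suc k) r c = go (Finₚ.any? λ j → ¬? (M (r zero) (c j) ℤ.≟ 0ℤ))
  where
  M′ : Mat (suc k) (suc k)
  M′ x y = M (r x) (c y)
  go : Dec (∃ λ j → M (r zero) (c j) ≢ 0ℤ) → Sgn (det (suc k) M′)
  go (no none) = inj₁ (sum-zero λ j → trans (cong (λ z → sign (toℕ j) * (z * det k (minor M′ j))) (zero-row j)) (ℤₚ.*-zeroʳ (sign (toℕ j))))
    where
    zero-row : ∀ j → M (r zero) (c j) ≡ 0ℤ
    zero-row j with M (r zero) (c j) ℤ.≟ 0ℤ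
    ... | yes e = e
    ... | no ne = contradiction (j , ne) none
  go (yes (j , ne)) = subst Sgn (sym (det-pivot k M′ j unit)) (sgn-* (sgn-sign (toℕ j)) (sgn-* (network-entry N (r zero) (c j))
    (network-tu (clear (M (r zero)) (c j) M) (without act (c j)) (network-pivot N (r zero) (c j) unit) k (r ∘ suc) (c ∘ punchIn j))))
    where
    unit : M′ zero j * M′ zero j ≡ 1ℤ
    unit = sgn-square (network-entry N (r zero) (c j)) ne

-- As the edges `κ` form a forest, every vector `c` consists of the differences of some potential
-- along them, and row `i` of a relation says that this potential is constant along `ρ i`. So the
-- relations between the columns are the coboundaries of the graph that arises from the forest by
-- contracting all `ρ i`, and the column matroid is its bond matroid.
network-cographic : ∀ {m n} (M : Mat m n) → Network M (const true) → Cographic M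
network-cographic {m} {n} M N = V , ends , λ S → indep⇒coindep S , coindep⇒indep S
  where
  open Network N
  C : Components ρ (const true)
  C = findComponents ρ (const true)
  q = Components.comp C
  ends : Ends V n
  ends e = q (proj₁ (κ e)) , q (proj₂ (κ e))
  indep⇒coindep : ∀ S → Indep M S → CoIndep ends S
  indep⇒coindep S ind e = Components.reaches D (idℤ-eq (δ-zero⁻¹ K (κ e) (ind (λ j → δ K (κ j)) supp kernel e)))
    where
    D : Components ends (not ∘ S)
    D = findComponents ends (not ∘ S)
    -- The indicator of the component containing the head of `e` when the edges in `S` are removed.
    -- Its differences form a relation supported in `S`, so independence makes them vanish, in
    -- particular along `e`.
    K : Fin V → ℤ
    K x = idℤ (Components.comp D (q x)) (Components.comp D (q (proj₂ (κ e))))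
    idℤ-eq : K (proj₁ (κ e)) ≡ K (proj₂ (κ e)) → Components.comp D (q (proj₁ (κ e))) ≡ Components.comp D (q (proj₂ (κ e)))
    idℤ-eq h with Components.comp D (q (proj₁ (κ e))) ≟ Components.comp D (q (proj₂ (κ e)))
    ... | yes eq = eq
    ... | no ne = contradiction (trans h (idℤ-diag (Components.comp D (q (proj₂ (κ e)))))) λ ()
    supp : SupportedIn S (λ j → δ K (κ j))
    supp j Sj = δ-zero K (κ j) (cong (λ x → idℤ x (Components.comp D (q (proj₂ (κ e))))) (Components.joined D j (cong not Sj)))
    kernel : ∀ i → sumℤ (λ j → δ K (κ j) * M i j) ≡ 0ℤ
    kernel i = trans (sym (path K i)) (δ-zero K (ρ i) (cong (λ x → idℤ (Components.comp D x) (Components.comp D (q (proj₂ (κ e))))) (Components.joined C i refl)))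
  coindep⇒indep : ∀ S → CoIndep ends S → Indep M S
  coindep⇒indep S co c supp kernel e = trans (sym (δp e)) (δ-zero p (κ e) (trans (sym (p-q (proj₁ (κ e))))
      (trans (reach-elim p level (co e)) (p-q (proj₂ (κ e))))))
    where
    pot : Fin n → Fin V → ℤ
    pot j = proj₁ (dual j refl)
    p : Fin V → ℤ
    p x = sumℤ λ j → c j * pot j x
    ring : ∀ c x y → c * x - c * y ≡ c * (x - y)
    ring = solve-∀
    δp : ∀ e → δ p (κ e) ≡ c e
    δp e = trans (sym (sum-minus (λ j → c j * pot j (proj₂ (κ e))) (λ j → c j * pot j (proj₁ (κ e)))))
      (trans (sum-cong λ j → trans (ring (c j) (pot j (proj₂ (κ e))) (pot j (proj₁ (κ e)))) (cong (c j *_) (trans (proj₂ (dual j refl) e refl) (idℤ-sym e j))))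
        (sum-idʳ e c))
    δρ : ∀ i → δ p (ρ i) ≡ 0ℤ
    δρ i = trans (path p i) (trans (sum-cong {f = λ j → δ p (κ j) * M i j} {g = λ j → c j * M i j} λ j → cong (_* M i j) (δp j)) (kernel i))
    p-q : ∀ x → p (q x) ≡ p x
    p-q x = reach-elim p (λ i _ → δ-zero⁻¹ p (ρ i) (δρ i)) (Components.reaches C (Components.stable C x))
    level : ∀ j → not (S j) ≡ true → p (proj₁ (ends j)) ≡ p (proj₂ (ends j))
    level j nS = trans (p-q (proj₁ (κ j))) (trans (δ-zero⁻¹ p (κ j) (trans (δp j) (supp j (Boolₚ.not-injective nS)))) (sym (p-q (proj₂ (κ j)))))

-- Embeddings

col : ∀ {g n} → Mat g n → Fin n → Row g
col A i r = A r i

∙-cong : ∀ {g n} (A : Mat g n) {c d : Row n} → (∀ i → c i ≡ d i) → ∀ r → (A ∙ c) r ≡ (A ∙ d) r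
∙-cong A e r = sum-cong λ i → cong (_* A r i) (e i)

∙-zero : ∀ {g n} (A : Mat g n) {c : Row n} → (∀ i → c i ≡ 0ℤ) → ∀ r → (A ∙ c) r ≡ 0ℤ
∙-zero A e r = sum-zero λ i → cong (_* A r i) (e i)

∙-assoc : ∀ {g m n} (X : Mat g m) (A : Mat m n) c r → (X ∙ (A ∙ c)) r ≡ sumℤ λ i → c i * (X ∙ col A i) r
∙-assoc X A c r = begin
  sumℤ (λ k → sumℤ (λ i → c i * A k i) * X r k)     ≡⟨ sum-cong (λ k → sym (sum-*ʳ (X r k) (λ i → c i * A k i))) ⟩
  sumℤ (λ k → sumℤ (λ i → c i * A k i * X r k))     ≡⟨ sum-swap (λ k i → c i * A k i * X r k) ⟩
  sumℤ (λ i → sumℤ (λ k → c i * A k i * X r k))     ≡⟨ sum-cong (λ i → sum-cong λ k → ℤₚ.*-assoc (c i) (A k i) (X r k)) ⟩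
  sumℤ (λ i → sumℤ (λ k → c i * (A k i * X r k)))   ≡⟨ sum-cong (λ i → sum-*ˡ (c i) (λ k → A k i * X r k)) ⟩
  sumℤ (λ i → c i * (X ∙ col A i) r)                ∎
  where open ≡-Reasoning

unit-cancel : ∀ ε → ε * ε ≡ 1ℤ → ∀ x → ε * (ε * x) ≡ x
unit-cancel ε u x = trans (sym (ℤₚ.*-assoc ε ε x)) (trans (cong (_* x) u) (ℤₚ.*-identityˡ x))

-- `X` and `Y` have to be inverse to each other only on the columns involved, and up to sign. This
-- covers deletions and equivalences alike, and also submatroids of smaller rank, on whose
-- complement no invertible extension is asked for.
record Embedding {g m n} (A : Mat g m) (B : Mat g n) : Set where
  field
    f    : Fin m → Fin n
    inj  : ∀ {i j} → f i ≡ f j → i ≡ j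
    ε    : Fin m → ℤ
    unit : ∀ i → ε i * ε i ≡ 1ℤ
    X Y  : Mat g g
    to   : ∀ i r → (X ∙ col A i) r ≡ ε i * B r (f i)
    from : ∀ i r → (Y ∙ col B (f i)) r ≡ ε i * A r i

  push : Row m → Row n
  push c j = sumℤ λ i → ε i * c i * idℤ (f i) j

  pull : Row n → Row m
  pull d i = ε i * d (f i)

  push-at : ∀ c i → push c (f i) ≡ ε i * c i
  push-at c i = trans (sum-only i (λ k → ε k * c k * idℤ (f k) (f i)) λ k k≢i →
      trans (cong (ε k * c k *_) (idℤ-off (k≢i ∘ inj))) (ℤₚ.*-zeroʳ (ε k * c k)))
    (trans (cong (ε i * c i *_) (idℤ-diag (f i))) (ℤₚ.*-identityʳ (ε i * c i)))

  push-zero : ∀ c j → (∀ i → f i ≡ j → c i ≡ 0ℤ) → push c j ≡ 0ℤ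
  push-zero c j h = sum-zero λ i → term i (f i ≟ j)
    where
    term : ∀ i → Dec (f i ≡ j) → ε i * c i * idℤ (f i) j ≡ 0ℤ
    term i (yes e) = trans (cong (λ z → ε i * z * idℤ (f i) j) (h i e)) (cong (_* idℤ (f i) j) (ℤₚ.*-zeroʳ (ε i)))
    term i (no ne) = trans (cong (ε i * c i *_) (idℤ-off ne)) (ℤₚ.*-zeroʳ (ε i * c i))

  inImage : ∀ j → Dec (∃ λ i → f i ≡ j)
  inImage j = Finₚ.any? λ i → f i ≟ j

  push-pull : ∀ d → (∀ j → ¬ (∃ λ i → f i ≡ j) → d j ≡ 0ℤ) → ∀ j → push (pull d) j ≡ d j
  push-pull d off j with inImage j
  ... | yes (i , refl) = trans (push-at (pull d) i) (unit-cancel (ε i) (unit i) (d (f i)))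
  ... | no ne          = trans (push-zero (pull d) j λ i e → contradiction (i , e) ne) (sym (off j ne))

  push-∙ : ∀ c s → (B ∙ push c) s ≡ sumℤ λ i → ε i * c i * B s (f i)
  push-∙ c s = begin
    sumℤ (λ j → push c j * B s j)
      ≡⟨ sum-cong (λ j → sym (sum-*ʳ (B s j) (λ i → ε i * c i * idℤ (f i) j))) ⟩
    sumℤ (λ j → sumℤ λ i → ε i * c i * idℤ (f i) j * B s j)
      ≡⟨ sum-swap (λ j i → ε i * c i * idℤ (f i) j * B s j) ⟩
    sumℤ (λ i → sumℤ λ j → ε i * c i * idℤ (f i) j * B s j)
      ≡⟨ sum-cong (λ i → trans (sum-cong λ j → ℤₚ.*-assoc (ε i * c i) (idℤ (f i) j) (B s j))
           (trans (sum-*ˡ (ε i * c i) (λ j → idℤ (f i) j * B s j)) (cong (ε i * c i *_) (sum-idˡ (f i) (B s))))) ⟩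
    sumℤ (λ i → ε i * c i * B s (f i)) ∎
    where open ≡-Reasoning

  X-push : ∀ c r → (X ∙ (A ∙ c)) r ≡ (B ∙ push c) r
  X-push c r = trans (∙-assoc X A c r) (trans (sum-cong λ i → trans (cong (c i *_) (to i r)) (ring (c i) (ε i) (B r (f i)))) (sym (push-∙ c r)))
    where
    ring : ∀ x y z → x * (y * z) ≡ y * x * z
    ring = solve-∀

  Y-push : ∀ c r → (Y ∙ (B ∙ push c)) r ≡ (A ∙ c) r
  Y-push c r = trans (∙-cong Y (push-∙ c) r) (trans (∙-assoc Y (λ s i → B s (f i)) (λ i → ε i * c i) r)
    (sum-cong λ i → trans (cong (ε i * c i *_) (from i r)) (trans (ring (ε i) (c i) (A r i)) (cong (c i *_) (unit-cancel (ε i) (unit i) (A r i))))))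
    where
    ring : ∀ x y z → x * y * (x * z) ≡ y * (x * (x * z))
    ring = solve-∀

  push-kernel : ∀ c → (∀ r → (A ∙ c) r ≡ 0ℤ) → ∀ r → (B ∙ push c) r ≡ 0ℤ
  push-kernel c h r = trans (sym (X-push c r)) (∙-zero X h r)

  push-kernel⁻¹ : ∀ c → (∀ r → (B ∙ push c) r ≡ 0ℤ) → ∀ r → (A ∙ c) r ≡ 0ℤ
  push-kernel⁻¹ c h r = trans (sym (Y-push c r)) (∙-zero Y h r)

  pull-kernel : ∀ d → (∀ j → ¬ (∃ λ i → f i ≡ j) → d j ≡ 0ℤ) → (∀ r → (B ∙ d) r ≡ 0ℤ) → ∀ r → (A ∙ pull d) r ≡ 0ℤ
  pull-kernel d off h = push-kernel⁻¹ (pull d) λ r → trans (∙-cong B (push-pull d off) r) (h r)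

  image : Subset m → Subset n
  image S j = does (Finₚ.any? λ i → (f i ≟ j) ×-dec (S i Boolₚ.≟ true))

  image-true : ∀ S j → image S j ≡ true → ∃ λ i → f i ≡ j × S i ≡ true
  image-true S j h with Finₚ.any? (λ i → (f i ≟ j) ×-dec (S i Boolₚ.≟ true))
  ... | yes p = p

  image-at : ∀ S i → image S (f i) ≡ S i
  image-at S i with S i in Si | image S (f i) in h
  ... | true  | true  = refl
  ... | false | false = refl
  ... | true  | false = contradiction (trans (sym h) (dec-true (Finₚ.any? λ k → (f k ≟ f i) ×-dec (S k Boolₚ.≟ true)) (i , refl , Si))) λ ()
  ... | false | true  with image-true S (f i) h
  ...   | k , e , Sk = contradiction (trans (sym Si) (trans (cong S (sym (inj e))) Sk)) λ ()

  image-off : ∀ S j → ¬ (∃ λ i → f i ≡ j) → image S j ≡ false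
  image-off S j ne with image S j in h
  ... | false = refl
  ... | true with image-true S j h
  ...   | i , e , _ = contradiction (i , e) ne

  image-indep : ∀ S → Indep A S → Indep B (image S)
  image-indep S ind d supp kernel j with inImage j
  ... | no ne          = supp j (image-off S j ne)
  ... | yes (i , refl) = trans (sym (unit-cancel (ε i) (unit i) (d (f i)))) (trans (cong (ε i *_)
      (ind (pull d) (λ k Sk → trans (cong (ε k *_) (supp (f k) (trans (image-at S k) Sk))) (ℤₚ.*-zeroʳ (ε k)))
        (pull-kernel d (λ j ne → supp j (image-off S j ne)) kernel) i))
    (ℤₚ.*-zeroʳ (ε i)))

  image-indep⁻¹ : ∀ S → Indep B (image S) → Indep A S
  image-indep⁻¹ S ind c supp kernel i = trans (sym (unit-cancel (ε i) (unit i) (c i))) (trans (cong (ε i *_)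
      (trans (sym (push-at c i)) (ind (push c) supp′ (push-kernel c kernel) (f i)))) (ℤₚ.*-zeroʳ (ε i)))
    where
    supp′ : SupportedIn (image S) (push c)
    supp′ j h = push-zero c j λ k e → supp k (trans (sym (image-at S k)) (trans (cong (image S) e) h))


-- The pushed relation vanishes off the image of `f`. Its lift does too, because lifting keeps
-- zeros, so the lift can be pulled back without loss.
embedding-liftable : ∀ {g m n} {A : Mat g m} {B : Mat g n} → Embedding A B → Liftable B → Liftable A
embedding-liftable {A = A} {B} E lift p c d = finish (lift p (Embedding.push E c) λ s →
    subst (p ∣_) (Embedding.X-push E c s) (∣-sum (λ k → (A ∙ c) k * Embedding.X E s k) λ k → ∣m⇒∣m*n (Embedding.X E s k) (d k)))
  where
  finish : Lift B p (Embedding.push E c) → Lift A p c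
  finish (c′ , rel , cong-p , supp) = Embedding.pull E c′ ,
    Embedding.pull-kernel E c′ (λ j ne → supp j (Embedding.push-zero E c j λ i e → contradiction (i , e) ne)) rel ,
    (λ i → subst (p ∣_) (shift i) (∣n⇒∣m*n (Embedding.ε E i) (cong-p (Embedding.f E i)))) ,
    (λ i z → trans (cong (Embedding.ε E i *_) (supp (Embedding.f E i) (trans (Embedding.push-at E c i) (trans (cong (Embedding.ε E i *_) z) (ℤₚ.*-zeroʳ (Embedding.ε E i)))))) (ℤₚ.*-zeroʳ (Embedding.ε E i)))
    where
    ring : ∀ e x y → e * (x - e * y) ≡ e * x - e * (e * y)
    ring = solve-∀
    shift : ∀ i → Embedding.ε E i * (c′ (Embedding.f E i) - Embedding.push E c (Embedding.f E i)) ≡ Embedding.pull E c′ i - c i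
    shift i = trans (cong (λ z → Embedding.ε E i * (c′ (Embedding.f E i) - z)) (Embedding.push-at E c i)) (trans (ring (Embedding.ε E i) (c′ (Embedding.f E i)) (c i))
      (cong (λ z → Embedding.pull E c′ i - z) (unit-cancel (Embedding.ε E i) (Embedding.unit E i) (c i))))

reach-mono : ∀ {V n} {ends : Ends V n} {S T u v} → (∀ e → S e ≡ true → T e ≡ true) → Reach ends S u v → Reach ends T u v
reach-mono h here        = here
reach-mono h (fwd e t q) = fwd e (h e t) (reach-mono h q)
reach-mono h (bwd e t q) = bwd e (h e t) (reach-mono h q)

-- Deletion in M*(G) is contraction in G.
embedding-cographic : ∀ {g m n} {A : Mat g m} {B : Mat g n} → Embedding A B → Cographic B → Cographic A
embedding-cographic {m = m} {n} {A} {B} E (V , ends , iso) = V , ends′ , λ S →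
    (λ ind → descend S (proj₁ (iso (Embedding.image E S)) (Embedding.image-indep E S ind))) ,
    (λ co → Embedding.image-indep⁻¹ E S (proj₂ (iso (Embedding.image E S)) (ascend S co)))
  where
  outside : Subset n
  outside j = not (does (Embedding.inImage E j))
  outside-true : ∀ j → ¬ (∃ λ i → Embedding.f E i ≡ j) → outside j ≡ true
  outside-true j ne = cong not (dec-false (Embedding.inImage E j) ne)
  C : Components ends outside
  C = findComponents ends outside
  q : Fin V → Fin V
  q = Components.comp C
  ends′ : Ends V m
  ends′ i = q (proj₁ (ends (Embedding.f E i))) , q (proj₂ (ends (Embedding.f E i)))
  off-image : ∀ S j → outside j ≡ true → not (Embedding.image E S j) ≡ true
  off-image S j t with Embedding.inImage E j
  ... | no ne = cong not (Embedding.image-off E S j ne)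
  down-edge : ∀ S e → not (Embedding.image E S e) ≡ true → Reach ends′ (not ∘ S) (q (proj₁ (ends e))) (q (proj₂ (ends e)))
  down-edge S e t with Embedding.inImage E e
  ... | yes (i , refl) = fwd i (trans (cong not (sym (Embedding.image-at E S i))) t) here
  ... | no ne          = subst (Reach ends′ (not ∘ S) _) (Components.joined C e (outside-true e ne)) here
  down : ∀ S {u v} → Reach ends (not ∘ Embedding.image E S) u v → Reach ends′ (not ∘ S) (q u) (q v)
  down S here        = here
  down S (fwd e t p) = reach-trans (down S p) (down-edge S e t)
  down S (bwd e t p) = reach-trans (down S p) (reach-sym (down-edge S e t))
  near : ∀ S x → Reach ends (not ∘ Embedding.image E S) (q x) x
  near S x = reach-mono (off-image S) (Components.reaches C (Components.stable C x))
  up-edge : ∀ S i → not (S i) ≡ true → Reach ends (not ∘ Embedding.image E S) (q (proj₁ (ends (Embedding.f E i)))) (q (proj₂ (ends (Embedding.f E i))))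
  up-edge S i t = reach-trans (fwd (Embedding.f E i) (trans (cong not (Embedding.image-at E S i)) t) (near S (proj₁ (ends (Embedding.f E i)))))
    (reach-sym (near S (proj₂ (ends (Embedding.f E i)))))
  up : ∀ S {u v} → Reach ends′ (not ∘ S) u v → Reach ends (not ∘ Embedding.image E S) u v
  up S here        = here
  up S (fwd i t p) = reach-trans (up S p) (up-edge S i t)
  up S (bwd i t p) = reach-trans (up S p) (reach-sym (up-edge S i t))
  descend : ∀ S → CoIndep ends (Embedding.image E S) → CoIndep ends′ S
  descend S co i = down S (co (Embedding.f E i))
  ascend : ∀ S → CoIndep ends′ S → CoIndep ends (Embedding.image E S)
  ascend S co e with Embedding.inImage E e
  ... | yes (i , refl) = reach-trans (reach-sym (near S (proj₁ (ends e)))) (reach-trans (up S (co i)) (near S (proj₂ (ends e))))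
  ... | no ne          = fwd e (cong not (Embedding.image-off E S e ne)) here

-- The form of simplicity that certificates contradict directly: a zero column or an explicit
-- multiple `η` is exhibited, with no mention of subsets.
Reduced : ∀ {g n} → Mat g n → Set
Reduced {g} {n} A = (∀ i → ¬ (∀ r → A r i ≡ 0ℤ)) × (∀ i j η → i ≢ j → ¬ (∀ r → A r i ≡ η * A r j))

simple⇒reduced : ∀ {g n} (A : Mat g n) → Simple A → Reduced A
simple⇒reduced A (single , double) =
  (λ i z → contradiction (trans (sym (idℤ-diag i)) (single i (λ k → idℤ k i)
     (λ k h → idℤ-off (no-eq k i h)) (λ r → trans (sum-cong λ k → cong (_* A r k) (idℤ-sym k i)) (trans (sum-idˡ i (A r)) (z r))) i)) λ ()) ,
  (λ i j η i≢j par → contradiction (trans (sym (one i j η i≢j)) (double i j i≢j (λ k → idℤ k i - η * idℤ k j) (supp i j η) (kernel i j η par) i)) λ ())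
  where
  no-eq : ∀ {n} (k i : Fin n) → does (k ≟ i) ≡ false → k ≢ i
  no-eq k i h with k ≟ i
  ... | no ne = ne
  one : ∀ {n} (i j : Fin n) η → i ≢ j → idℤ i i - η * idℤ i j ≡ 1ℤ
  one i j η ne = trans (cong₂ (λ x y → x - η * y) (idℤ-diag i) (idℤ-off ne)) (cong (λ z → 1ℤ - z) (ℤₚ.*-zeroʳ η))
  supp : ∀ {n} (i j : Fin n) η → SupportedIn (pair i j) (λ k → idℤ k i - η * idℤ k j)
  supp i j η k h with k ≟ i | k ≟ j
  ... | no _ | no _ = cong (λ z → 0ℤ - z) (ℤₚ.*-zeroʳ η)
  ring : ∀ x y η a → (x - η * y) * a ≡ x * a - η * (y * a)
  ring = solve-∀
  kernel : ∀ i j η → (∀ r → A r i ≡ η * A r j) → ∀ r → sumℤ (λ k → (idℤ k i - η * idℤ k j) * A r k) ≡ 0ℤ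
  kernel i j η par r = trans (sum-cong λ k → trans (ring (idℤ k i) (idℤ k j) η (A r k))
      (cong₂ (λ x y → x * A r k - η * (y * A r k)) (idℤ-sym k i) (idℤ-sym k j)))
    (trans (sum-minus (λ k → idℤ i k * A r k) (λ k → η * (idℤ j k * A r k)))
      (trans (cong₂ _-_ (sum-idˡ i (A r)) (trans (sum-*ˡ η (λ k → idℤ j k * A r k)) (cong (η *_) (sum-idˡ j (A r)))))
        (ℤₚ.i≡j⇒i-j≡0 {A r i} {η * A r j} (par r))))

embedding-reduced : ∀ {g m n} {A : Mat g m} {B : Mat g n} → Embedding A B → Reduced B → Reduced A
embedding-reduced {A = A} {B} E (nz , np) =
  (λ i z → nz (Embedding.f E i) λ r → trans (value i r) (trans (cong (Embedding.ε E i *_) (∙-zero (Embedding.X E) z r)) (ℤₚ.*-zeroʳ (Embedding.ε E i)))) ,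
  (λ i j η i≢j par → np (Embedding.f E i) (Embedding.f E j) (Embedding.ε E i * η * Embedding.ε E j) (i≢j ∘ Embedding.inj E) λ r →
    trans (value i r) (trans (cong (Embedding.ε E i *_) (trans (scaled i j η par r) (cong (η *_) (Embedding.to E j r)))) (ring (Embedding.ε E i) η (Embedding.ε E j) (B r (Embedding.f E j)))))
  where
  value : ∀ i r → B r (Embedding.f E i) ≡ Embedding.ε E i * (Embedding.X E ∙ col A i) r
  value i r = trans (sym (unit-cancel (Embedding.ε E i) (Embedding.unit E i) (B r (Embedding.f E i)))) (cong (Embedding.ε E i *_) (sym (Embedding.to E i r)))
  ring : ∀ a b c d → a * (b * (c * d)) ≡ a * b * c * d
  ring = solve-∀
  scaled : ∀ i j η → (∀ r → A r i ≡ η * A r j) → ∀ r → (Embedding.X E ∙ col A i) r ≡ η * (Embedding.X E ∙ col A j) r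
  scaled i j η par r = trans (sum-cong λ k → trans (cong (_* Embedding.X E r k) (par k)) (ℤₚ.*-assoc η (A k j) (Embedding.X E r k))) (sum-*ˡ η (λ k → A k j * Embedding.X E r k))

-- Non-cographic matroids

sumℕ-cong : ∀ {n} {f g : Fin n → ℕ} → (∀ i → f i ≡ g i) → sumℕ f ≡ sumℕ g
sumℕ-cong {zero}  e = refl
sumℕ-cong {suc n} e = cong₂ ℕ._+_ (e zero) (sumℕ-cong (e ∘ suc))

sumℕ-mono : ∀ {n} {f g : Fin n → ℕ} → (∀ i → f i ℕ.≤ g i) → sumℕ f ℕ.≤ sumℕ g
sumℕ-mono {zero}  e = z≤n
sumℕ-mono {suc n} e = ℕₚ.+-mono-≤ (e zero) (sumℕ-mono (e ∘ suc))

sumℕ-zero : ∀ n → sumℕ {n} (const 0) ≡ 0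
sumℕ-zero zero    = refl
sumℕ-zero (suc n) = sumℕ-zero n

sumℕ-+ : ∀ {n} (f g : Fin n → ℕ) → sumℕ (λ i → f i ℕ.+ g i) ≡ sumℕ f ℕ.+ sumℕ g
sumℕ-+ f g = trans (sumℕ≡sum (λ i → f i ℕ.+ g i)) (trans (SemiringSum.∑-distrib-+ ℕₚ.+-*-semiring f g)
  (sym (cong₂ ℕ._+_ (sumℕ≡sum f) (sumℕ≡sum g))))

sumℕ-*ˡ : ∀ {n} x (f : Fin n → ℕ) → sumℕ (λ i → x ℕ.* f i) ≡ x ℕ.* sumℕ f
sumℕ-*ˡ x f = trans (sumℕ≡sum (λ i → x ℕ.* f i)) (trans (sym (SemiringSum.*-distribˡ-sum ℕₚ.+-*-semiring x f))
  (cong (x ℕ.*_) (sym (sumℕ≡sum f))))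

sumℕ-swap : ∀ {m n} (f : Fin m → Fin n → ℕ) →
  sumℕ (λ i → sumℕ (λ j → f i j)) ≡ sumℕ (λ j → sumℕ (λ i → f i j))
sumℕ-swap f = begin
  sumℕ (λ i → sumℕ (f i))      ≡⟨ sumℕ-cong (λ i → sumℕ≡sum (f i)) ⟩
  sumℕ (λ i → S (f i))         ≡⟨ sumℕ≡sum (λ i → S (f i)) ⟩
  S (λ i → S (f i))            ≡⟨ SemiringSum.∑-comm ℕₚ.+-*-semiring f ⟩
  S (λ j → S (λ i → f i j))    ≡⟨ sym (sumℕ≡sum (λ j → S (λ i → f i j))) ⟩
  sumℕ (λ j → S (λ i → f i j)) ≡⟨ sumℕ-cong (λ j → sym (sumℕ≡sum (λ i → f i j))) ⟩
  sumℕ (λ j → sumℕ (λ i → f i j)) ∎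
  where
  open ≡-Reasoning
  S : ∀ {k} → (Fin k → ℕ) → ℕ
  S = SemiringSum.sum ℕₚ.+-*-semiring

weigh : Bool → ℕ → ℕ
weigh b w = if b then w else 0

bit : Bool → ℕ
bit b = weigh b 1

sumℕ-single : ∀ {n} (j : Fin n) → sumℕ (λ i → bit (does (j ≟ i))) ≡ 1
sumℕ-single {suc n} zero    = cong suc (sumℕ-zero n)
sumℕ-single {suc n} (suc j) = sumℕ-single j

size-without : ∀ {n} (U : Subset n) u → U u ≡ true → size U ≡ suc (size (without U u))
size-without {suc n} U zero h rewrite h = cong suc (sumℕ-cong λ i → cong bit (sym (Boolₚ.∧-identityʳ (U (suc i)))))
size-without {suc n} U (suc u) h = trans (cong (bit (U zero) ℕ.+_) (size-without (U ∘ suc) u h))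
  (trans (ℕₚ.+-suc (bit (U zero)) (size (without (U ∘ suc) u)))
    (cong (λ b → suc (bit b ℕ.+ size (without (U ∘ suc) u))) (sym (Boolₚ.∧-identityʳ (U zero)))))

-- A forest with m edges touches at least m + 1 vertices; being a forest is witnessed by a cut K i through each edge
-- that no other edge crosses.
forest-size : ∀ m {V} (U : Subset V) (e : Ends V m) (K : Fin m → Fin V → Bool) x₀ → U x₀ ≡ true →
  (∀ i → U (proj₁ (e i)) ≡ true × U (proj₂ (e i)) ≡ true) →
  (∀ i j → i ≢ j → K i (proj₁ (e j)) ≡ K i (proj₂ (e j))) → (∀ i → K i (proj₁ (e i)) ≢ K i (proj₂ (e i))) →
  suc m ℕ.≤ size U
forest-size zero    U e K x₀ Ux₀ ends same diff = subst (1 ℕ.≤_) (sym (size-without U x₀ Ux₀)) (s≤s z≤n)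
forest-size (suc m) {V} U e K x₀ Ux₀ ends same diff = subst (suc (suc m) ℕ.≤_) (sym (size-without U u (proj₁ (ends zero))))
  (s≤s (forest-size m (without U u) e′ (K ∘ suc) v (kept v (proj₂ (ends zero)) v≢u) ends′ same′ diff′))
  where
  u v : Fin V
  u = proj₁ (e zero)
  v = proj₂ (e zero)
  v≢u : v ≢ u
  v≢u h = diff zero (cong (K zero) (sym h))
  kept : ∀ x → U x ≡ true → x ≢ u → without U u x ≡ true
  kept x Ux ne = cong₂ (λ p q → p ∧ not q) Ux (dec-false (x ≟ u) ne)
  e′ : Ends V m
  e′ i = merge v u (proj₁ (e (suc i))) , merge v u (proj₂ (e (suc i)))
  kept-merge : ∀ x → U x ≡ true → without U u (merge v u x) ≡ true
  kept-merge x Ux with x ≟ u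
  ... | yes _ = kept v (proj₂ (ends zero)) v≢u
  ... | no ne = kept x Ux ne
  K-merge : ∀ i x → K (suc i) (merge v u x) ≡ K (suc i) x
  K-merge i x with x ≟ u
  ... | yes refl = sym (same (suc i) zero λ ())
  ... | no _     = refl
  ends′ : ∀ i → without U u (proj₁ (e′ i)) ≡ true × without U u (proj₂ (e′ i)) ≡ true
  ends′ i = kept-merge (proj₁ (e (suc i))) (proj₁ (ends (suc i))) , kept-merge (proj₂ (e (suc i))) (proj₂ (ends (suc i)))
  same′ : ∀ i j → i ≢ j → K (suc i) (proj₁ (e′ j)) ≡ K (suc i) (proj₂ (e′ j))
  same′ i j ne = trans (K-merge i (proj₁ (e (suc j)))) (trans (same (suc i) (suc j) (ne ∘ Finₚ.suc-injective)) (sym (K-merge i (proj₂ (e (suc j))))))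
  diff′ : ∀ i → K (suc i) (proj₁ (e′ i)) ≢ K (suc i) (proj₂ (e′ i))
  diff′ i h = diff (suc i) (trans (sym (K-merge i (proj₁ (e (suc i))))) (trans h (K-merge i (proj₂ (e (suc i))))))

insert : ∀ {n} → Subset n → Fin n → Subset n
insert S e j = S j ∨ does (j ≟ e)

weight : ∀ {n} → (Fin n → ℕ) → Subset n → ℕ
weight w S = sumℕ λ e → weigh (S e) (w e)

-- In M*(G) every nonempty vertex star is dependent, the stars cover each edge at most twice, and the complement of a
-- basis is a spanning forest of G. So if dependent sets are heavy then G has too few vertices for that forest.
record Obstruction {g n} (A : Mat g n) : Set where
  field
    {m}      : ℕ
    b        : Fin (suc m) → Fin n
    b-inj    : ∀ i j → i ≢ j → b i ≢ b j
    B        : Subset n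
    B-b      : ∀ i → B (b i) ≡ false
    basis    : Indep A B
    dep      : ∀ i → ¬ Indep A (insert B (b i))
    w        : Fin n → ℕ
    t        : ℕ
    heavy    : ∀ S e → S e ≡ true → ¬ Indep A S → t ℕ.≤ weight w S
    few      : sumℕ w ℕ.+ sumℕ w ℕ.< t ℕ.* suc (suc m)

obstruction : ∀ {g n} {A : Mat g n} → Obstruction A → ¬ Cographic A
obstruction {g} {n} {A} O (V , ends , iso) = ℕₚ.<⇒≱ few (ℕₚ.≤-trans (ℕₚ.*-monoʳ-≤ t large) small)
  where
  open Obstruction O
  -- With `xor` a loop belongs to no star, so a star is the edge cut around `x`; this makes every
  -- nonempty star dependent.
  star : Fin V → Subset n
  star x e = does (proj₁ (ends e) ≟ x) Data.Bool.xor does (proj₂ (ends e) ≟ x)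
  isTouched : ∀ x → Dec (∃ λ e → star x e ≡ true)
  isTouched x = Finₚ.any? λ e → star x e Boolₚ.≟ true
  touched : Subset V
  touched x = does (isTouched x)
  xor-same : ∀ x → (x Data.Bool.xor x) ≡ true → ⊥
  xor-same true ()
  xor-same false ()
  xor-false : ∀ x y → not (x Data.Bool.xor y) ≡ true → x ≡ y
  xor-false true  true  _ = refl
  xor-false false false _ = refl
  star-dependent : ∀ x e → star x e ≡ true → ¬ Indep A (star x)
  star-dependent x e s ind = xor-same (does (proj₂ (ends e) ≟ x)) (trans (cong (Data.Bool._xor does (proj₂ (ends e) ≟ x)) (sym level)) s)
    where
    level : does (proj₁ (ends e) ≟ x) ≡ does (proj₂ (ends e) ≟ x)
    level = reach-elim (λ y → does (y ≟ x)) (λ j h → xor-false (does (proj₁ (ends j) ≟ x)) (does (proj₂ (ends j) ≟ x)) h) (proj₁ (iso (star x)) ind e)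
  star-heavy : ∀ x → t ℕ.* bit (touched x) ℕ.≤ weight w (star x)
  star-heavy x with isTouched x
  ... | yes (e , s) = subst (ℕ._≤ weight w (star x)) (sym (ℕₚ.*-identityʳ t)) (heavy (star x) e s (star-dependent x e s))
  ... | no _        = subst (ℕ._≤ weight w (star x)) (sym (ℕₚ.*-zeroʳ t)) z≤n
  star-bound : ∀ p q k → weigh (p Data.Bool.xor q) k ℕ.≤ k ℕ.* (bit p ℕ.+ bit q)
  star-bound false false k = z≤n
  star-bound false true  k = ℕₚ.≤-reflexive (sym (ℕₚ.*-identityʳ k))
  star-bound true  false k = ℕₚ.≤-reflexive (sym (ℕₚ.*-identityʳ k))
  star-bound true  true  k = z≤n
  covered : ∀ e → sumℕ (λ x → weigh (star x e) (w e)) ℕ.≤ w e ℕ.+ w e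
  covered e = begin
    sumℕ (λ x → weigh (star x e) (w e))
      ≤⟨ sumℕ-mono (λ x → star-bound (does (proj₁ (ends e) ≟ x)) (does (proj₂ (ends e) ≟ x)) (w e)) ⟩
    sumℕ (λ x → w e ℕ.* (bit (does (proj₁ (ends e) ≟ x)) ℕ.+ bit (does (proj₂ (ends e) ≟ x))))
      ≡⟨ sumℕ-*ˡ (w e) (λ x → bit (does (proj₁ (ends e) ≟ x)) ℕ.+ bit (does (proj₂ (ends e) ≟ x))) ⟩
    w e ℕ.* sumℕ (λ x → bit (does (proj₁ (ends e) ≟ x)) ℕ.+ bit (does (proj₂ (ends e) ≟ x)))
      ≡⟨ cong (w e ℕ.*_) (trans (sumℕ-+ (λ x → bit (does (proj₁ (ends e) ≟ x))) (λ x → bit (does (proj₂ (ends e) ≟ x))))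
           (cong₂ ℕ._+_ (sumℕ-single (proj₁ (ends e))) (sumℕ-single (proj₂ (ends e))))) ⟩
    w e ℕ.* 2  ≡⟨ trans (ℕₚ.*-comm (w e) 2) (cong (w e ℕ.+_) (ℕₚ.+-identityʳ (w e))) ⟩
    w e ℕ.+ w e ∎
    where open ℕₚ.≤-Reasoning
  small : t ℕ.* size touched ℕ.≤ sumℕ w ℕ.+ sumℕ w
  small = begin
    t ℕ.* size touched                                   ≡⟨ sym (sumℕ-*ˡ t (λ x → bit (touched x))) ⟩
    sumℕ (λ x → t ℕ.* bit (touched x))                   ≤⟨ sumℕ-mono star-heavy ⟩
    sumℕ (λ x → sumℕ λ e → weigh (star x e) (w e))       ≡⟨ sumℕ-swap (λ x e → weigh (star x e) (w e)) ⟩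
    sumℕ (λ e → sumℕ λ x → weigh (star x e) (w e))       ≤⟨ sumℕ-mono covered ⟩
    sumℕ (λ e → w e ℕ.+ w e)                             ≡⟨ sumℕ-+ w w ⟩
    sumℕ w ℕ.+ sumℕ w                                    ∎
    where open ℕₚ.≤-Reasoning
  rest : Fin (suc m) → Subset n
  rest i = not ∘ insert B (b i)
  C : ∀ i → Components ends (rest i)
  C i = findComponents ends (rest i)
  c : Fin (suc m) → Fin V → Fin V
  c i = Components.comp (C i)
  u v : Fin (suc m) → Fin V
  u i = proj₁ (ends (b i))
  v i = proj₂ (ends (b i))
  in-rest : ∀ i j → B j ≡ false → j ≢ b i → rest i j ≡ true
  in-rest i j Bj ne = cong₂ (λ p q → not (p ∨ q)) Bj (dec-false (j ≟ b i) ne)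
  -- Otherwise the edges outside `B`, with `b i` among them, could be rerouted in the complement of
  -- `B` and `b i` together; that set would then be independent, against `dep`.
  separated : ∀ i → c i (u i) ≢ c i (v i)
  separated i h = dep i (proj₂ (iso (insert B (b i))) λ e → reroute (proj₁ (iso B) basis e))
    where
    edge : ∀ j → not (B j) ≡ true → Reach ends (rest i) (proj₁ (ends j)) (proj₂ (ends j))
    edge j nB with j ≟ b i
    ... | yes refl = Components.reaches (C i) h
    ... | no ne    = fwd j (in-rest i j (Boolₚ.not-injective nB) ne) here
    reroute : ∀ {x y} → Reach ends (not ∘ B) x y → Reach ends (rest i) x y
    reroute here        = here
    reroute (fwd j s p) = reach-trans (reroute p) (edge j s)
    reroute (bwd j s p) = reach-trans (reroute p) (reach-sym (edge j s))
  K : Fin (suc m) → Fin V → Bool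
  K i x = does (c i x ≟ c i (u i))
  does-true : ∀ {x y : Fin V} → does (x ≟ y) ≡ true → x ≡ y
  does-true {x} {y} h with x ≟ y
  ... | yes e = e
  touch₁ : ∀ i → touched (u i) ≡ true
  touch₁ i = dec-true (isTouched (u i)) (b i , cong₂ Data.Bool._xor_ (dec-true (u i ≟ u i) refl)
    (dec-false (v i ≟ u i) λ h → separated i (cong (c i) (sym h))))
  touch₂ : ∀ i → touched (v i) ≡ true
  touch₂ i = dec-true (isTouched (v i)) (b i , cong₂ Data.Bool._xor_ (dec-false (u i ≟ v i) λ h → separated i (cong (c i) h))
    (dec-true (v i ≟ v i) refl))
  -- There are `suc m` forest edges `b i`, hence at least `suc (suc m)` touched vertices. The cut
  -- through `b i` is the component of one of its ends when `b i` is removed.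
  large : suc (suc m) ℕ.≤ size touched
  large = forest-size (suc m) touched (λ i → u i , v i) K (u zero) (touch₁ zero) (λ i → touch₁ i , touch₂ i)
    (λ i j ne → cong (λ x → does (x ≟ c i (u i))) (Components.joined (C i) (b j) (in-rest i (b j) (B-b j) (b-inj j i (ne ∘ sym)))))
    (λ i h → separated i (sym (does-true (trans (sym h) (dec-true (c i (u i) ≟ c i (u i)) refl)))))

-- Cones and orbits

toℚᵘ-toℚ : ∀ z → ℚ.toℚᵘ (toℚ z) ℚᵘ.≃ ℚᵘ.mkℚᵘ z 0
toℚᵘ-toℚ z = ℚₚ.toℚᵘ-fromℚᵘ (ℚᵘ.mkℚᵘ z 0)

toℚ-+ : ∀ x y → toℚ (x + y) ≡ toℚ x ℚ.+ toℚ y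
toℚ-+ x y = ℚₚ.toℚᵘ-injective (ℚᵘₚ.≃-trans (toℚᵘ-toℚ (x + y)) (ℚᵘₚ.≃-sym (ℚᵘₚ.≃-trans (ℚₚ.toℚᵘ-homo-+ (toℚ x) (toℚ y))
  (ℚᵘₚ.≃-trans (ℚᵘₚ.+-cong (toℚᵘ-toℚ x) (toℚᵘ-toℚ y)) (ℚᵘ.*≡* (ring x y))))))
  where
  ring : ∀ x y → (x * 1ℤ + y * 1ℤ) * 1ℤ ≡ (x + y) * 1ℤ
  ring = solve-∀

toℚ-* : ∀ x y → toℚ (x * y) ≡ toℚ x ℚ.* toℚ y
toℚ-* x y = ℚₚ.toℚᵘ-injective (ℚᵘₚ.≃-trans (toℚᵘ-toℚ (x * y)) (ℚᵘₚ.≃-sym (ℚᵘₚ.≃-trans (ℚₚ.toℚᵘ-homo-* (toℚ x) (toℚ y))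
  (ℚᵘₚ.≃-trans (ℚᵘₚ.*-cong (toℚᵘ-toℚ x) (toℚᵘ-toℚ y)) (ℚᵘ.*≡* refl)))))

toℚ-injective : ∀ {x y} → toℚ x ≡ toℚ y → x ≡ y
toℚ-injective {x} {y} e with ℚₚ.fromℚᵘ-injective {ℚᵘ.mkℚᵘ x 0} {ℚᵘ.mkℚᵘ y 0} e
... | ℚᵘ.*≡* h = trans (sym (ℤₚ.*-identityʳ x)) (trans h (ℤₚ.*-identityʳ y))

toℚ-pos : ∀ {z} → 0ℤ ℤ.< z → 0ℚ ℚ.< toℚ z
toℚ-pos {z} h = ℚₚ.toℚᵘ-cancel-< (ℚᵘₚ.<-respʳ-≃ (ℚᵘₚ.≃-sym (toℚᵘ-toℚ z)) (ℚᵘ.*<* (subst (0ℤ ℤ.<_) (sym (ℤₚ.*-identityʳ z)) h)))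

toℚ-pos⁻¹ : ∀ {z} → 0ℚ ℚ.< toℚ z → 0ℤ ℤ.< z
toℚ-pos⁻¹ {z} h with ℚᵘₚ.<-respʳ-≃ (toℚᵘ-toℚ z) (ℚₚ.toℚᵘ-mono-< h)
... | ℚᵘ.*<* k = subst (0ℤ ℤ.<_) (ℤₚ.*-identityʳ z) k

sumℚ-cong : ∀ {n} {f g : Fin n → ℚ} → (∀ i → f i ≡ g i) → sumℚ f ≡ sumℚ g
sumℚ-cong {zero}  e = refl
sumℚ-cong {suc n} e = cong₂ ℚ._+_ (e zero) (sumℚ-cong (e ∘ suc))

private
  semiringᵠ = CommutativeRing.semiring ℚₚ.+-*-commutativeRing

sumℚ-*ˡ : ∀ {n} x (f : Fin n → ℚ) → sumℚ (λ i → x ℚ.* f i) ≡ x ℚ.* sumℚ f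
sumℚ-*ˡ x f = trans (sumℚ≡sum (λ i → x ℚ.* f i)) (trans (sym (SemiringSum.*-distribˡ-sum semiringᵠ x f)) (cong (x ℚ.*_) (sym (sumℚ≡sum f))))

sumℚ-swap : ∀ {m n} (f : Fin m → Fin n → ℚ) →
  sumℚ (λ i → sumℚ (λ j → f i j)) ≡ sumℚ (λ j → sumℚ (λ i → f i j))
sumℚ-swap f = begin
  sumℚ (λ i → sumℚ (f i))      ≡⟨ sumℚ-cong (λ i → sumℚ≡sum (f i)) ⟩
  sumℚ (λ i → S (f i))         ≡⟨ sumℚ≡sum (λ i → S (f i)) ⟩
  S (λ i → S (f i))            ≡⟨ SemiringSum.∑-comm semiringᵠ f ⟩
  S (λ j → S (λ i → f i j))    ≡⟨ sym (sumℚ≡sum (λ j → S (λ i → f i j))) ⟩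
  sumℚ (λ j → S (λ i → f i j)) ≡⟨ sumℚ-cong (λ j → sym (sumℚ≡sum (λ i → f i j))) ⟩
  sumℚ (λ j → sumℚ (λ i → f i j)) ∎
  where
  open ≡-Reasoning
  S : ∀ {k} → (Fin k → ℚ) → ℚ
  S = SemiringSum.sum semiringᵠ

sumℚ-perm : ∀ {m n} (f : Fin n → ℚ) (π : Perm.Permutation m n) → sumℚ f ≡ sumℚ (λ i → f (π Perm.⟨$⟩ʳ i))
sumℚ-perm f π = trans (sumℚ≡sum f) (trans (SemiringSum.sum-permute semiringᵠ f π) (sym (sumℚ≡sum (λ i → f (π Perm.⟨$⟩ʳ i)))))

toℚ-sum : ∀ {n} (f : Fin n → ℤ) → toℚ (sumℤ f) ≡ sumℚ (λ i → toℚ (f i))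
toℚ-sum {zero}  f = refl
toℚ-sum {suc n} f = trans (toℚ-+ (f zero) (sumℤ (f ∘ suc))) (cong (toℚ (f zero) ℚ.+_) (toℚ-sum (f ∘ suc)))

dot : ∀ {n} → Row n → Row n → ℤ
dot x y = sumℤ λ i → x i * y i

bilin : ∀ {g} → Row g → Row g → SymQ g → ℚ
bilin x y Q = sumℚ λ a → sumℚ λ b → toℚ (x a) ℚ.* (Q a b ℚ.* toℚ (y b))

bilin-cong : ∀ {g} (x y : Row g) {P Q : SymQ g} → (∀ a b → P a b ≡ Q a b) → bilin x y P ≡ bilin x y Q
bilin-cong x y e = sumℚ-cong λ a → sumℚ-cong λ b → cong (λ z → toℚ (x a) ℚ.* (z ℚ.* toℚ (y b))) (e a b)

-- Rank-one functionals are evaluated on v vᵀ as the product (x · v)(y · v), so cones are probed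
-- with dot products only.
bilin-cone : ∀ {g n} (x y : Row g) (A : Mat g n) (c : Fin n → ℚ) →
  bilin x y (λ a b → sumℚ λ i → c i ℚ.* toℚ (A a i * A b i)) ≡ sumℚ (λ i → c i ℚ.* toℚ (dot x (col A i) * dot y (col A i)))
bilin-cone {g} x y A c = begin
  sumℚ (λ a → sumℚ λ b → toℚ (x a) ℚ.* (sumℚ (λ i → c i ℚ.* toℚ (A a i * A b i)) ℚ.* toℚ (y b)))
    ≡⟨ sumℚ-cong (λ a → sumℚ-cong (inside a)) ⟩
  sumℚ (λ a → sumℚ λ b → sumℚ λ i → c i ℚ.* toℚ (x a * A a i * (y b * A b i)))
    ≡⟨ sumℚ-cong (λ a → sumℚ-swap (λ b i → c i ℚ.* toℚ (x a * A a i * (y b * A b i)))) ⟩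
  sumℚ (λ a → sumℚ λ i → sumℚ λ b → c i ℚ.* toℚ (x a * A a i * (y b * A b i)))
    ≡⟨ sumℚ-swap (λ a i → sumℚ λ b → c i ℚ.* toℚ (x a * A a i * (y b * A b i))) ⟩
  sumℚ (λ i → sumℚ λ a → sumℚ λ b → c i ℚ.* toℚ (x a * A a i * (y b * A b i)))
    ≡⟨ sumℚ-cong outside ⟩
  sumℚ (λ i → c i ℚ.* toℚ (dot x (col A i) * dot y (col A i))) ∎
  where
  open ≡-Reasoning
  ring : ∀ x a b y → x * (a * b) * y ≡ x * a * (y * b)
  ring = solve-∀
  move : ∀ u c p v → toℚ u ℚ.* (c ℚ.* toℚ p ℚ.* toℚ v) ≡ c ℚ.* toℚ (u * p * v)
  move u c p v = begin
    toℚ u ℚ.* (c ℚ.* toℚ p ℚ.* toℚ v)   ≡⟨ cong (toℚ u ℚ.*_) (ℚₚ.*-assoc c (toℚ p) (toℚ v)) ⟩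
    toℚ u ℚ.* (c ℚ.* (toℚ p ℚ.* toℚ v)) ≡⟨ sym (ℚₚ.*-assoc (toℚ u) c _) ⟩
    toℚ u ℚ.* c ℚ.* (toℚ p ℚ.* toℚ v)   ≡⟨ cong (ℚ._* (toℚ p ℚ.* toℚ v)) (ℚₚ.*-comm (toℚ u) c) ⟩
    c ℚ.* toℚ u ℚ.* (toℚ p ℚ.* toℚ v)   ≡⟨ ℚₚ.*-assoc c (toℚ u) _ ⟩
    c ℚ.* (toℚ u ℚ.* (toℚ p ℚ.* toℚ v)) ≡⟨ cong (c ℚ.*_) (sym (ℚₚ.*-assoc (toℚ u) (toℚ p) (toℚ v))) ⟩
    c ℚ.* (toℚ u ℚ.* toℚ p ℚ.* toℚ v)   ≡⟨ cong (λ z → c ℚ.* (z ℚ.* toℚ v)) (sym (toℚ-* u p)) ⟩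
    c ℚ.* (toℚ (u * p) ℚ.* toℚ v)       ≡⟨ cong (c ℚ.*_) (sym (toℚ-* (u * p) v)) ⟩
    c ℚ.* toℚ (u * p * v) ∎
  sum-*ʳℚ : ∀ {n} (f : Fin n → ℚ) x → sumℚ f ℚ.* x ≡ sumℚ (λ i → f i ℚ.* x)
  sum-*ʳℚ f x = trans (ℚₚ.*-comm (sumℚ f) x) (trans (sym (sumℚ-*ˡ x f)) (sumℚ-cong λ i → ℚₚ.*-comm x (f i)))
  inside : ∀ a b → toℚ (x a) ℚ.* (sumℚ (λ i → c i ℚ.* toℚ (A a i * A b i)) ℚ.* toℚ (y b)) ≡ sumℚ (λ i → c i ℚ.* toℚ (x a * A a i * (y b * A b i)))
  inside a b = trans (cong (toℚ (x a) ℚ.*_) (sum-*ʳℚ (λ i → c i ℚ.* toℚ (A a i * A b i)) (toℚ (y b))))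
    (trans (sym (sumℚ-*ˡ (toℚ (x a)) (λ i → c i ℚ.* toℚ (A a i * A b i) ℚ.* toℚ (y b))))
      (sumℚ-cong λ i → trans (move (x a) (c i) (A a i * A b i) (y b)) (cong (λ z → c i ℚ.* toℚ z) (ring (x a) (A a i) (A b i) (y b)))))
  outside : ∀ i → sumℚ (λ a → sumℚ λ b → c i ℚ.* toℚ (x a * A a i * (y b * A b i))) ≡ c i ℚ.* toℚ (dot x (col A i) * dot y (col A i))
  outside i = begin
    sumℚ (λ a → sumℚ λ b → c i ℚ.* toℚ (x a * A a i * (y b * A b i)))
      ≡⟨ sumℚ-cong (λ a → trans (sumℚ-*ˡ (c i) (λ b → toℚ (x a * A a i * (y b * A b i)))) (cong (c i ℚ.*_)
           (trans (sym (toℚ-sum (λ b → x a * A a i * (y b * A b i)))) (cong toℚ (sum-*ˡ (x a * A a i) (λ b → y b * A b i)))))) ⟩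
    sumℚ (λ a → c i ℚ.* toℚ (x a * A a i * dot y (col A i)))
      ≡⟨ trans (sumℚ-*ˡ (c i) (λ a → toℚ (x a * A a i * dot y (col A i)))) (cong (c i ℚ.*_)
           (trans (sym (toℚ-sum (λ a → x a * A a i * dot y (col A i)))) (cong toℚ (sum-*ʳ (dot y (col A i)) (λ a → x a * A a i))))) ⟩
    c i ℚ.* toℚ (dot x (col A i) * dot y (col A i)) ∎

-- The matrix XᵀA. Its cone is the image of the cone of `A` under `act X`.
pullback : ∀ {g n} → Mat g g → Mat g n → Mat g n
pullback X A r i = dot (col X r) (col A i)

act-cone : ∀ {g n} (X : Mat g g) (A : Mat g n) (c : Fin n → ℚ) {Q : SymQ g} →
  (∀ r s → Q r s ≡ sumℚ (λ i → c i ℚ.* toℚ (A r i * A s i))) →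
  ∀ r s → act X Q r s ≡ sumℚ (λ i → c i ℚ.* toℚ (pullback X A r i * pullback X A s i))
act-cone X A c e r s = trans (bilin-cong (col X r) (col X s) e) (bilin-cone (col X r) (col X s) A c)

inCone-cong : ∀ {g n} (A : Mat g n) {P Q : SymQ g} → (∀ r s → P r s ≡ Q r s) → InCone A P → InCone A Q
inCone-cong A e (c , pos-c , h) = c , pos-c , λ r s → trans (sym (e r s)) (h r s)

sameOrbit⇒cones : ∀ {g n m} (A : Mat g n) (B : Mat g m) ((X , _) : SameOrbit A B) →
  (∀ P → InCone (pullback X A) P → InCone B P) × (∀ P → InCone B P → InCone (pullback X A) P)
sameOrbit⇒cones {g} {n} A B (X , _ , there , back) = forth , λ P h → backward P (back P h)
  where
  form : (Fin n → ℚ) → SymQ g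
  form c r s = sumℚ λ i → c i ℚ.* toℚ (A r i * A s i)
  forth : ∀ P → InCone (pullback X A) P → InCone B P
  forth P (c , pos-c , h) = inCone-cong B (λ r s → trans (act-cone X A c (λ r s → refl) r s) (sym (h r s)))
    (there (form c) (c , pos-c , λ r s → refl))
  backward : ∀ P → Σ (SymQ g) (λ Q → InCone A Q × (∀ r s → act X Q r s ≡ P r s)) → InCone (pullback X A) P
  backward P (Q , (c , pos-c , h) , e) = c , pos-c , λ r s → trans (sym (e r s)) (act-cone X A c h r s)

record Equivalence {g m n} (A : Mat g m) (B : Mat g n) : Set where
  field
    π    : Perm.Permutation m n
    ε    : Fin m → ℤ
    unit : ∀ i → ε i * ε i ≡ 1ℤ
    X Y  : Mat g g
    XY   : ∀ c r → (X ∙ (Y ∙ c)) r ≡ c r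
    YX   : ∀ c r → (Y ∙ (X ∙ c)) r ≡ c r
    to   : ∀ i r → (X ∙ col A i) r ≡ ε i * B r (π Perm.⟨$⟩ʳ i)

-- `act` moves columns by the transpose, so the witness is Xᵀ. The signs disappear because only the
-- products v vᵀ enter the cone.
equivalence⇒sameOrbit : ∀ {g m n} {A : Mat g m} {B : Mat g n} → Equivalence A B → SameOrbit A B
equivalence⇒sameOrbit {g} {m} {n} {A} {B} E = Xᵀ , (Yᵀ , inverse YX , inverse XY) , there , back
  where
  open Equivalence E
  Xᵀ Yᵀ : Mat g g
  Xᵀ r s = X s r
  Yᵀ r s = Y s r
  inverse : ∀ {P Q : Mat g g} → (∀ c r → (P ∙ (Q ∙ c)) r ≡ c r) → ∀ r s → sumℤ (λ k → Q k r * P s k) ≡ idℤ r s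
  inverse {P} {Q} h r s = trans (∙-cong P (λ k → sym (sum-idˡ r (Q k))) s) (h (idℤ r) s)
  outer : ∀ i r s → pullback Xᵀ A r i * pullback Xᵀ A s i ≡ B r (π Perm.⟨$⟩ʳ i) * B s (π Perm.⟨$⟩ʳ i)
  outer i r s = trans (cong₂ _*_ (value r) (value s)) (trans (ring (ε i) (B r (π Perm.⟨$⟩ʳ i)) (B s (π Perm.⟨$⟩ʳ i)))
      (trans (cong (_* (B r (π Perm.⟨$⟩ʳ i) * B s (π Perm.⟨$⟩ʳ i))) (unit i)) (ℤₚ.*-identityˡ (B r (π Perm.⟨$⟩ʳ i) * B s (π Perm.⟨$⟩ʳ i)))))
    where
    ring : ∀ e x y → e * x * (e * y) ≡ e * e * (x * y)
    ring = solve-∀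
    value : ∀ r → pullback Xᵀ A r i ≡ ε i * B r (π Perm.⟨$⟩ʳ i)
    value r = trans (sum-cong λ k → ℤₚ.*-comm (X r k) (A k i)) (to i r)
  there : ∀ Q → InCone A Q → InCone B (act Xᵀ Q)
  there Q (c , pos-c , h) = (λ j → c (π Perm.⟨$⟩ˡ j)) , (λ j → pos-c (π Perm.⟨$⟩ˡ j)) , λ r s →
    trans (act-cone Xᵀ A c h r s) (trans (sumℚ-cong λ i → cong₂ (λ x y → c x ℚ.* toℚ y) (sym (Perm.inverseˡ π)) (outer i r s))
      (sym (sumℚ-perm (λ j → c (π Perm.⟨$⟩ˡ j) ℚ.* toℚ (B r j * B s j)) π)))
  back : ∀ P → InCone B P → Σ (SymQ g) λ Q → InCone A Q × (∀ r s → act Xᵀ Q r s ≡ P r s)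
  back P (c , pos-c , h) = (λ r s → sumℚ λ i → c (π Perm.⟨$⟩ʳ i) ℚ.* toℚ (A r i * A s i)) ,
    ((λ i → c (π Perm.⟨$⟩ʳ i)) , (λ i → pos-c (π Perm.⟨$⟩ʳ i)) , λ r s → refl) , λ r s →
    trans (act-cone Xᵀ A (λ i → c (π Perm.⟨$⟩ʳ i)) (λ r s → refl) r s)
      (trans (sumℚ-cong λ i → cong (λ y → c (π Perm.⟨$⟩ʳ i) ℚ.* toℚ y) (outer i r s))
        (trans (sym (sumℚ-perm (λ j → c j ℚ.* toℚ (B r j * B s j)) π)) (sym (h r s))))

-- Extreme rays

dot-bilin : ∀ {g} (x y c d : Row g) → dot x c * dot y d ≡ sumℤ λ r → sumℤ λ s → x r * y s * (c r * d s)
dot-bilin x y c d = trans (sym (sum-*ʳ (dot y d) (λ r → x r * c r))) (sum-cong λ r →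
  trans (sym (sum-*ˡ (x r * c r) (λ s → y s * d s))) (sum-cong λ s → ring (x r) (c r) (y s) (d s)))
  where
  ring : ∀ x c y d → x * c * (y * d) ≡ x * y * (c * d)
  ring = solve-∀

dot-expand : ∀ {g m} (x y u : Row g) (W : Mat g m) (c : Row m) →
  (∀ r s → u r * u s ≡ sumℤ λ j → c j * (W r j * W s j)) →
  dot x u * dot y u ≡ sumℤ λ j → c j * (dot x (col W j) * dot y (col W j))
dot-expand x y u W c h = begin
  dot x u * dot y u                                             ≡⟨ dot-bilin x y u u ⟩
  sumℤ (λ r → sumℤ λ s → x r * y s * (u r * u s))               ≡⟨ sum-cong (λ r → sum-cong λ s → step r s) ⟩
  sumℤ (λ r → sumℤ λ s → sumℤ λ j → c j * (x r * y s * (W r j * W s j)))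
    ≡⟨ sum-cong (λ r → sum-swap (λ s j → c j * (x r * y s * (W r j * W s j)))) ⟩
  sumℤ (λ r → sumℤ λ j → sumℤ λ s → c j * (x r * y s * (W r j * W s j)))
    ≡⟨ sum-swap (λ r j → sumℤ λ s → c j * (x r * y s * (W r j * W s j))) ⟩
  sumℤ (λ j → sumℤ λ r → sumℤ λ s → c j * (x r * y s * (W r j * W s j)))
    ≡⟨ sum-cong (λ j → trans (sum-cong λ r → sum-*ˡ (c j) (λ s → x r * y s * (W r j * W s j)))
         (trans (sum-*ˡ (c j) (λ r → sumℤ λ s → x r * y s * (W r j * W s j))) (cong (c j *_) (sym (dot-bilin x y (col W j) (col W j)))))) ⟩
  sumℤ (λ j → c j * (dot x (col W j) * dot y (col W j))) ∎
  where
  open ≡-Reasoning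
  ring : ∀ a c b → a * (c * b) ≡ c * (a * b)
  ring = solve-∀
  step : ∀ r s → x r * y s * (u r * u s) ≡ sumℤ (λ j → c j * (x r * y s * (W r j * W s j)))
  step r s = trans (cong (x r * y s *_) (h r s)) (trans (sym (sum-*ˡ (x r * y s) (λ j → c j * (W r j * W s j))))
    (sum-cong λ j → ring (x r * y s) (c j) (W r j * W s j)))

-- rank-one functionals dual to the forms v vᵀ
record Dual {g n} (A : Mat g n) : Set where
  field
    x y  : Fin n → Row g
    dual : ∀ i j → dot (x j) (col A i) * dot (y j) (col A i) ≡ idℤ i j

-- By duality this is the only possible coefficient of w wᵀ, for w column `j` of `W`, in an
-- expansion of u uᵀ, for u column `i` of `U`.
coef : ∀ {g n m} (U : Mat g n) {W : Mat g m} → Dual W → Fin n → Fin m → ℤ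
coef U D i j = dot (Dual.x D j) (col U i) * dot (Dual.y D j) (col U i)

outer-independent : ∀ {g n} {A : Mat g n} → Dual A → OuterIndep A (const true)
outer-independent {A = A} D c _ h j = begin
  c j                                     ≡⟨ sym (sum-idʳ j c) ⟩
  sumℤ (λ i → c i * idℤ i j)              ≡⟨ sum-cong (λ i → cong (c i *_) (trans (sym (Dual.dual D i j)) (dot-bilin (Dual.x D j) (Dual.y D j) (col A i) (col A i)))) ⟩
  sumℤ (λ i → c i * sumℤ (λ r → sumℤ (λ s → Dual.x D j r * Dual.y D j s * (A r i * A s i))))
    ≡⟨ sum-cong (λ i → trans (sym (sum-*ˡ (c i) (λ r → sumℤ (λ s → Dual.x D j r * Dual.y D j s * (A r i * A s i)))))
         (sum-cong λ r → trans (sym (sum-*ˡ (c i) (λ s → Dual.x D j r * Dual.y D j s * (A r i * A s i))))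
           (sum-cong λ s → ring (c i) (Dual.x D j r * Dual.y D j s) (A r i * A s i)))) ⟩
  sumℤ (λ i → sumℤ λ r → sumℤ λ s → Dual.x D j r * Dual.y D j s * (c i * (A r i * A s i)))
    ≡⟨ sum-swap (λ i r → sumℤ λ s → Dual.x D j r * Dual.y D j s * (c i * (A r i * A s i))) ⟩
  sumℤ (λ r → sumℤ λ i → sumℤ λ s → Dual.x D j r * Dual.y D j s * (c i * (A r i * A s i)))
    ≡⟨ sum-zero (λ r → trans (sum-swap (λ i s → Dual.x D j r * Dual.y D j s * (c i * (A r i * A s i))))
         (sum-zero λ s → trans (sum-*ˡ (Dual.x D j r * Dual.y D j s) (λ i → c i * (A r i * A s i)))
           (trans (cong (Dual.x D j r * Dual.y D j s *_) (h r s)) (ℤₚ.*-zeroʳ (Dual.x D j r * Dual.y D j s))))) ⟩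
  0ℤ ∎
  where
  open ≡-Reasoning
  ring : ∀ c a b → c * (a * b) ≡ a * (c * b)
  ring = solve-∀

size-full : ∀ n → size {n} (const true) ≡ n
size-full zero    = refl
size-full (suc n) = cong suc (size-full n)

size-≤ : ∀ {n} (S : Subset n) → size S ℕ.≤ n
size-≤ {zero}  S = z≤n
size-≤ {suc n} S with S zero
... | true  = s≤s (size-≤ (S ∘ suc))
... | false = ℕₚ.m≤n⇒m≤1+n (size-≤ (S ∘ suc))

dual⇒dim : ∀ {g n} {A : Mat g n} → Dual A → IsDim A n
dual⇒dim {n = n} D = (const true , size-full n , outer-independent D) , λ S _ → size-≤ S

dot-∙ : ∀ {g n} (x : Row g) (A : Mat g n) c → dot x (A ∙ c) ≡ sumℤ λ i → c i * dot x (col A i)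
dot-∙ x A c = trans (sum-cong λ r → trans (ℤₚ.*-comm (x r) ((A ∙ c) r)) refl)
  (trans (∙-assoc (λ _ → x) A c (zero {0})) (sum-cong λ i → cong (c i *_) (sum-cong λ r → ℤₚ.*-comm (A r i) (x r))))

-- Pairing a relation with a row vector `z` that is zero on the other elements of its support leaves
-- a single term.
isolate : ∀ {g n} (A : Mat g n) (z : Row g) i (c : Row n) → (∀ r → (A ∙ c) r ≡ 0ℤ) → dot z (col A i) ≢ 0ℤ →
  (∀ k → k ≢ i → c k * dot z (col A k) ≡ 0ℤ) → c i ≡ 0ℤ
isolate A z i c h ne others = [ id , (λ e → contradiction e ne) ]′ (ℤₚ.i*j≡0⇒i≡0∨j≡0 (c i)
  (trans (sym (sum-only i (λ k → c k * dot z (col A k)) others))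
    (trans (sym (dot-∙ z A c)) (sum-zero λ r → trans (cong (z r *_) (h r)) (ℤₚ.*-zeroʳ (z r))))))

-- The products of the functionals with their own column are nonzero, and for every other column `j`
-- one of x, y is orthogonal to it. Pairing a relation between columns `i` and `j` with that one
-- isolates the coefficient of `i`.
dual⇒simple : ∀ {g n} {A : Mat g n} → Dual A → Simple A
dual⇒simple {g} {n} {A} D = (λ i c supp h k → single i c supp h k) , λ i j i≢j c supp h k → double i j i≢j c supp h k
  where
  nonzero : ∀ i → dot (Dual.x D i) (col A i) ≢ 0ℤ × dot (Dual.y D i) (col A i) ≢ 0ℤ
  nonzero i = (λ e → contradiction (trans (sym (trans (Dual.dual D i i) (idℤ-diag i))) (cong (_* dot (Dual.y D i) (col A i)) e)) λ ()) ,
              (λ e → contradiction (trans (sym (trans (Dual.dual D i i) (idℤ-diag i))) (trans (cong (dot (Dual.x D i) (col A i) *_) e) (ℤₚ.*-zeroʳ (dot (Dual.x D i) (col A i))))) λ ())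
  outside : ∀ {S : Subset n} (c : Row n) (z : Row g) → SupportedIn S c → ∀ k → S k ≡ false → c k * dot z (col A k) ≡ 0ℤ
  outside c z supp k e = cong (_* dot z (col A k)) (supp k e)
  single : ∀ i → Indep A (singleton i)
  single i c supp h k with k ≟ i
  ... | yes refl = isolate A (Dual.x D k) k c h (proj₁ (nonzero k)) λ l ne → outside c (Dual.x D k) supp l (dec-false (l ≟ k) ne)
  ... | no ne    = supp k (dec-false (k ≟ i) ne)
  half : ∀ i j → i ≢ j → ∀ c → SupportedIn (pair i j) c → (∀ r → (A ∙ c) r ≡ 0ℤ) → c i ≡ 0ℤ
  half i j i≢j c supp h with ℤₚ.i*j≡0⇒i≡0∨j≡0 (dot (Dual.x D i) (col A j)) (trans (Dual.dual D j i) (idℤ-off (i≢j ∘ sym)))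
  ... | inj₁ e = isolate A (Dual.x D i) i c h (proj₁ (nonzero i)) others
    where
    others : ∀ k → k ≢ i → c k * dot (Dual.x D i) (col A k) ≡ 0ℤ
    others k ne with k ≟ j
    ... | yes refl = trans (cong (c k *_) e) (ℤₚ.*-zeroʳ (c k))
    ... | no ne′   = outside c (Dual.x D i) supp k (cong₂ _∨_ (dec-false (k ≟ i) ne) (dec-false (k ≟ j) ne′))
  ... | inj₂ e = isolate A (Dual.y D i) i c h (proj₂ (nonzero i)) others
    where
    others : ∀ k → k ≢ i → c k * dot (Dual.y D i) (col A k) ≡ 0ℤ
    others k ne with k ≟ j
    ... | yes refl = trans (cong (c k *_) e) (ℤₚ.*-zeroʳ (c k))
    ... | no ne′   = outside c (Dual.y D i) supp k (cong₂ _∨_ (dec-false (k ≟ i) ne) (dec-false (k ≟ j) ne′))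
  double : ∀ i j → i ≢ j → Indep A (pair i j)
  double i j i≢j c supp h k = go (k ≟ i) (k ≟ j)
    where
    go : Dec (k ≡ i) → Dec (k ≡ j) → c k ≡ 0ℤ
    go (yes refl) _          = half k j i≢j c supp h
    go (no _)     (yes refl) = half k i (i≢j ∘ sym) c (λ l e → supp l (trans (Boolₚ.∨-comm (does (l ≟ i)) (does (l ≟ k))) e)) h
    go (no ne)    (no ne′)   = supp k (cong₂ _∨_ (dec-false (k ≟ i) ne) (dec-false (k ≟ j) ne′))

cancel-+ : ∀ t x y → t + x ≡ t + y → x ≡ y
cancel-+ t x y e = trans (sym (ring t x)) (trans (cong (- t +_) e) (ring t y))
  where
  ring : ∀ t x → - t + (t + x) ≡ x
  ring = solve-∀

sumℚ-only : ∀ {n} (j : Fin n) (c : Fin n → ℚ) → sumℚ (λ i → c i ℚ.* toℚ (idℤ i j)) ≡ c j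
sumℚ-only {suc n} zero c = trans (cong₂ ℚ._+_ (ℚₚ.*-identityʳ (c zero)) (zeros (c ∘ suc))) (ℚₚ.+-identityʳ (c zero))
  where
  zeros : ∀ {n} (c : Fin n → ℚ) → sumℚ (λ i → c i ℚ.* 0ℚ) ≡ 0ℚ
  zeros {zero}  c = refl
  zeros {suc n} c = trans (cong₂ ℚ._+_ (ℚₚ.*-zeroʳ (c zero)) (zeros (c ∘ suc))) refl
sumℚ-only {suc n} (suc j) c = trans (cong₂ ℚ._+_ (ℚₚ.*-zeroʳ (c zero)) (sumℚ-only j (c ∘ suc))) (ℚₚ.+-identityˡ (c (suc j)))

-- The functionals dual to W show that the coefficients with which the cone of W contains the u uᵀ are integers.
module _ {g n m} (U : Mat g n) (W : Mat g m) (D : Dual W) (sub : ∀ P → InCone U P → InCone W P) where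
  private
    S : Row n → Fin m → ℤ
    S l j = sumℤ λ i → l i * coef U D i j

  cone-step : ∀ (l : Row n) → (∀ i → 0ℤ ℤ.< l i) → (∀ j → 0ℤ ℤ.< S l j) ×
    (∀ r s → sumℤ (λ i → l i * (U r i * U s i)) ≡ sumℤ (λ j → S l j * (W r j * W s j)))
  cone-step l pos-l = go (sub Q ((λ i → toℚ (l i)) , (λ i → toℚ-pos (pos-l i)) , λ r s → refl))
    where
    Q : SymQ g
    Q r s = sumℚ λ i → toℚ (l i) ℚ.* toℚ (U r i * U s i)
    integral : ∀ {k} (l f : Row k) → sumℚ (λ i → toℚ (l i) ℚ.* toℚ (f i)) ≡ toℚ (sumℤ λ i → l i * f i)
    integral l f = trans (sumℚ-cong λ i → sym (toℚ-* (l i) (f i))) (sym (toℚ-sum (λ i → l i * f i)))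
    go : InCone W Q → _
    go (μ , pos-μ , h) = (λ j → toℚ-pos⁻¹ (subst (0ℚ ℚ.<_) (μ-S j) (pos-μ j))) , λ r s →
        toℚ-injective (trans (sym (integral l (λ i → U r i * U s i))) (trans (h r s)
          (trans (sumℚ-cong λ j → cong (ℚ._* toℚ (W r j * W s j)) (μ-S j)) (integral (S l) (λ j → W r j * W s j)))))
      where
      μ-S : ∀ j → μ j ≡ toℚ (S l j)
      μ-S j = trans (sym (sumℚ-only j μ)) (trans (sumℚ-cong λ i → cong (λ z → μ i ℚ.* toℚ z) (sym (Dual.dual D i j)))
        (trans (sym (bilin-cone (Dual.x D j) (Dual.y D j) W μ)) (trans (bilin-cong (Dual.x D j) (Dual.y D j) (λ r s → sym (h r s)))
          (trans (bilin-cone (Dual.x D j) (Dual.y D j) U (λ i → toℚ (l i))) (integral l (λ i → coef U D i j))))))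

  private
    -- The cones are open and need not contain their rays. A ray is therefore reached through
    -- interior points: the sum of all rays, plus `t` times the ray `i`.
    bump : ℕ → Fin n → Row n
    bump t i k = 1ℤ + pos t * idℤ i k
    bump-pos : ∀ t i k → 0ℤ ℤ.< bump t i k
    bump-pos t i k with i ≟ k
    ... | yes _ = subst (0ℤ ℤ.<_) (cong (1ℤ +_) (sym (ℤₚ.*-identityʳ (pos t)))) (ℤ.+<+ (s≤s z≤n))
    ... | no _  = subst (0ℤ ℤ.<_) (cong (1ℤ +_) (sym (ℤₚ.*-zeroʳ (pos t)))) (ℤ.+<+ (s≤s z≤n))
    bump-sum : ∀ t i (f : Row n) → sumℤ (λ k → bump t i k * f k) ≡ sumℤ (λ k → 1ℤ * f k) + pos t * f i
    bump-sum t i f = trans (sum-cong λ k → ring (pos t) (idℤ i k) (f k)) (trans (sum-+ (λ k → 1ℤ * f k) (λ k → pos t * (idℤ i k * f k)))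
      (cong (λ z → sumℤ (λ k → 1ℤ * f k) + z) (trans (sum-*ˡ (pos t) (λ k → idℤ i k * f k)) (cong (pos t *_) (sum-idˡ i f)))))
      where
      ring : ∀ t d f → (1ℤ + t * d) * f ≡ 1ℤ * f + t * (d * f)
      ring = solve-∀
    ones : ∀ (i : Fin n) → 0ℤ ℤ.< 1ℤ
    ones i = ℤ.+<+ (s≤s z≤n)
    natural : ∀ z s → 0ℤ ℤ.< s → (∀ t → 0ℤ ℤ.< s + pos t * z) → Σ ℕ λ c → z ≡ pos c
    natural (pos c) s _ _ = c , refl
    natural -[1+ c ] (pos zero) (ℤ.+<+ ()) h
    -- Taking t equal to the summand itself makes the sum nonpositive as soon as z is at most -1.
    natural -[1+ c ] (pos (suc s)) _ h = ⊥-elim (nonpositive (suc s ℕ.* c) (subst (0ℤ ℤ.<_) (trans (ring (pos (suc s)) (pos c)) (cong -_ (sym (ℤₚ.pos-* (suc s) c)))) (h (suc s))))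
      where
      ring : ∀ s c → s + s * - (1ℤ + c) ≡ - (s * c)
      ring = solve-∀
      nonpositive : ∀ k → ¬ (0ℤ ℤ.< - pos k)
      nonpositive zero    (ℤ.+<+ ())
      nonpositive (suc k) ()

  coef-natural : ∀ i j → Σ ℕ λ c → coef U D i j ≡ pos c
  coef-natural i j = natural (coef U D i j) (S (const 1ℤ) j) (proj₁ (cone-step (const 1ℤ) ones) j) λ t →
    subst (0ℤ ℤ.<_) (bump-sum t i (λ k → coef U D k j)) (proj₁ (cone-step (bump t i) (bump-pos t i)) j)

  -- The ray is the difference of the interior points for t = 1 and t = 0, and the expansion in
  -- terms of `W` is additive.
  coef-outer : ∀ i r s → U r i * U s i ≡ sumℤ λ j → coef U D i j * (W r j * W s j)
  coef-outer i r s = cancel-+ T (U r i * U s i) (sumℤ λ j → coef U D i j * (W r j * W s j)) (begin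
    T + U r i * U s i        ≡⟨ cong (T +_) (sym (ℤₚ.*-identityˡ (U r i * U s i))) ⟩
    T + 1ℤ * (U r i * U s i) ≡⟨ sym (bump-sum 1 i (λ k → U r k * U s k)) ⟩
    sumℤ (λ k → bump 1 i k * (U r k * U s k)) ≡⟨ proj₂ (cone-step (bump 1 i) (bump-pos 1 i)) r s ⟩
    sumℤ (λ j → S (bump 1 i) j * (W r j * W s j))
      ≡⟨ sum-cong (λ j → trans (cong (_* (W r j * W s j)) (trans (bump-sum 1 i (λ k → coef U D k j)) (cong (S (const 1ℤ) j +_) (ℤₚ.*-identityˡ (coef U D i j)))))
           (ℤₚ.*-distribʳ-+ (W r j * W s j) (S (const 1ℤ) j) (coef U D i j))) ⟩
    sumℤ (λ j → S (const 1ℤ) j * (W r j * W s j) + coef U D i j * (W r j * W s j))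
      ≡⟨ sum-+ (λ j → S (const 1ℤ) j * (W r j * W s j)) (λ j → coef U D i j * (W r j * W s j)) ⟩
    sumℤ (λ j → S (const 1ℤ) j * (W r j * W s j)) + sumℤ (λ j → coef U D i j * (W r j * W s j))
      ≡⟨ cong (_+ sumℤ (λ j → coef U D i j * (W r j * W s j))) (sym (proj₂ (cone-step (const 1ℤ) ones) r s)) ⟩
    T + sumℤ (λ j → coef U D i j * (W r j * W s j)) ∎)
    where
    open ≡-Reasoning
    T : ℤ
    T = sumℤ λ k → 1ℤ * (U r k * U s k)

sumℕ≡1 : ∀ {n} (f : Fin n → ℕ) → sumℕ f ≡ 1 → ∃ λ j → f j ≡ 1
sumℕ≡1 {suc n} f h with f zero in e
... | 0 = let (j , k) = sumℕ≡1 (f ∘ suc) h in suc j , k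
... | 1 = zero , e

sumℕ≡0 : ∀ {n} (f : Fin n → ℕ) → sumℕ f ≡ 0 → ∀ j → f j ≡ 0
sumℕ≡0 f h zero    = ℕₚ.m+n≡0⇒m≡0 (f zero) h
sumℕ≡0 f h (suc j) = sumℕ≡0 (f ∘ suc) (ℕₚ.m+n≡0⇒n≡0 (f zero) h) j

pos-sum : ∀ {n} (f : Fin n → ℕ) → sumℤ (λ i → pos (f i)) ≡ pos (sumℕ f)
pos-sum {zero}  f = refl
pos-sum {suc n} f = cong (pos (f zero) +_) (pos-sum (f ∘ suc))

-- Equal simplicial cones have the same extreme rays: the two matrices of coefficients are inverse to each other and
-- nonnegative, hence permutation matrices.
module _ {g n m} (U : Mat g n) (W : Mat g m) (DU : Dual U) (DW : Dual W)
  (sub : ∀ P → InCone U P → InCone W P) (sup : ∀ P → InCone W P → InCone U P) where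

  same-ray : ∀ i → ∃ λ j → ∀ r s → W r j * W s j ≡ U r i * U s i
  same-ray i = pick (sumℕ≡1 (λ j → c i j ℕ.* d j i) (ℤₚ.+-injective (trans (inverse i) (idℤ-diag i))))
    where
    open ≡-Reasoning
    c : Fin n → Fin m → ℕ
    c i j = proj₁ (coef-natural U W DW sub i j)
    d : Fin m → Fin n → ℕ
    d j k = proj₁ (coef-natural W U DU sup j k)
    c≡ : ∀ i j → coef U DW i j ≡ pos (c i j)
    c≡ i j = proj₂ (coef-natural U W DW sub i j)
    d≡ : ∀ j k → coef W DU j k ≡ pos (d j k)
    d≡ j k = proj₂ (coef-natural W U DU sup j k)
    inverse : ∀ k → pos (sumℕ λ j → c i j ℕ.* d j k) ≡ idℤ i k
    inverse k = trans (sym (pos-sum (λ j → c i j ℕ.* d j k))) (trans (sum-cong λ j → trans (ℤₚ.pos-* (c i j) (d j k)) (sym (cong₂ _*_ (c≡ i j) (d≡ j k))))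
      (trans (sym (dot-expand (Dual.x DU k) (Dual.y DU k) (col U i) W (coef U DW i) (coef-outer U W DW sub i))) (Dual.dual DU i k)))
    off : ∀ k → k ≢ i → sumℕ (λ j → c i j ℕ.* d j k) ≡ 0
    off k ne = ℤₚ.+-injective (trans (inverse k) (idℤ-off (ne ∘ sym)))
    other : ∀ (a b b′ : ℕ) → a ℕ.* b ≡ 1 → a ℕ.* b′ ≡ 0 → b′ ≡ 0
    other a b b′ ab ab′ = [ (λ e → contradiction (trans (sym ab) (cong (ℕ._* b) e)) λ ()) , id ]′ (ℕₚ.m*n≡0⇒m≡0∨n≡0 a ab′)
    -- Row `i` of the product of the two natural matrices is a unit vector, so `c i j * d j i` is 1
    -- for some `j`. The nonzero `c i j` then forces the rest of row `j` of `d` to vanish, and the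
    -- ray `j` of `W` is the ray `i` of `U`.
    pick : (∃ λ j → c i j ℕ.* d j i ≡ 1) → ∃ λ j → ∀ r s → W r j * W s j ≡ U r i * U s i
    pick (j , cd≡1) = j , λ r s → begin
      W r j * W s j                                    ≡⟨ coef-outer W U DU sup j r s ⟩
      sumℤ (λ k → coef W DU j k * (U r k * U s k))
        ≡⟨ sum-only i (λ k → coef W DU j k * (U r k * U s k)) (λ k ne → cong (_* (U r k * U s k)) (trans (d≡ j k) (cong pos
             (other (c i j) (d j i) (d j k) cd≡1 (sumℕ≡0 (λ j → c i j ℕ.* d j k) (off k ne) j))))) ⟩
      coef W DU j i * (U r i * U s i)                  ≡⟨ cong (_* (U r i * U s i)) (trans (d≡ j i) (cong pos (ℕₚ.m*n≡1⇒n≡1 (c i j) (d j i) cd≡1))) ⟩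
      1ℤ * (U r i * U s i)                             ≡⟨ ℤₚ.*-identityˡ (U r i * U s i) ⟩
      U r i * U s i ∎

ray-injective : ∀ {g n} {A : Mat g n} → Dual A → ∀ i j → (∀ r s → A r i * A s i ≡ A r j * A s j) → i ≡ j
ray-injective {A = A} D i j e with i ≟ j
... | yes i≡j = i≡j
... | no i≢j = contradiction (trans (sym (idℤ-diag j)) (trans (sym (Dual.dual D j j)) (trans (dot-bilin (Dual.x D j) (Dual.y D j) (col A j) (col A j))
  (trans (sum-cong λ r → sum-cong λ s → cong (Dual.x D j r * Dual.y D j s *_) (sym (e r s)))
  (trans (sym (dot-bilin (Dual.x D j) (Dual.y D j) (col A i) (col A i))) (trans (Dual.dual D i j) (idℤ-off i≢j))))))) λ ()

same-rays : ∀ {g n m} (U : Mat g n) (W : Mat g m) → Dual U → Dual W →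
  (∀ P → InCone U P → InCone W P) → (∀ P → InCone W P → InCone U P) →
  Σ (Perm.Permutation n m) λ π → ∀ i r s → W r (π Perm.⟨$⟩ʳ i) * W s (π Perm.⟨$⟩ʳ i) ≡ U r i * U s i
same-rays U W DU DW sub sup = Perm.permutation f f′
    (λ j → ray-injective DW (f (f′ j)) j λ r s → trans (proj₂ (same-ray U W DU DW sub sup (f′ j)) r s) (proj₂ (same-ray W U DW DU sup sub j) r s))
    (λ i → ray-injective DU (f′ (f i)) i λ r s → trans (proj₂ (same-ray W U DW DU sup sub (f i)) r s) (proj₂ (same-ray U W DU DW sub sup i) r s)) ,
  λ i → proj₂ (same-ray U W DU DW sub sup i)
  where
  f  = λ i → proj₁ (same-ray U W DU DW sub sup i)
  f′ = λ j → proj₁ (same-ray W U DW DU sup sub j)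

-- A binary invariant

parity : ℤ → ℕ
parity x = ℤ.∣ x ∣ ℕ.% 2

parity-even : ∀ k → parity (k * pos 2) ≡ 0
parity-even k = trans (cong (ℕ._% 2) (ℤₚ.abs-* k (pos 2))) (ℕ/.m*n%n≡0 ℤ.∣ k ∣ 2)

parity-odd : ∀ k → parity (1ℤ + k * pos 2) ≡ 1
parity-odd (pos n) = trans (cong (λ z → parity (1ℤ + z)) (sym (ℤₚ.pos-* n 2))) (ℕ/.[m+kn]%n≡m%n 1 n 2)
parity-odd -[1+ n ] = trans (cong (ℕ._% 2) (trans (cong ℤ.∣_∣ (trans (ring (pos n)) (cong (λ z → - (1ℤ + z)) (sym (ℤₚ.pos-* n 2)))))
  (ℤₚ.∣-i∣≡∣i∣ (pos (1 ℕ.+ n ℕ.* 2))))) (ℕ/.[m+kn]%n≡m%n 1 n 2)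
  where
  ring : ∀ n → 1ℤ + - (1ℤ + n) * pos 2 ≡ - (1ℤ + n * pos 2)
  ring = solve-∀

halve : ∀ x → Σ ℤ λ k → x ≡ pos (parity x) + k * pos 2
halve x with x ℤ/.% pos 2 | ℤ/.n%d<d x (pos 2) | ℤ/.a≡a%n+[a/n]*n x (pos 2)
... | 0 | _ | e = x ℤ/./ pos 2 , trans e (cong (λ p → pos p + (x ℤ/./ pos 2) * pos 2) (sym (trans (cong parity (trans e (ℤₚ.+-identityˡ ((x ℤ/./ pos 2) * pos 2)))) (parity-even (x ℤ/./ pos 2)))))
... | 1 | _ | e = x ℤ/./ pos 2 , trans e (cong (λ p → pos p + (x ℤ/./ pos 2) * pos 2) (sym (trans (cong parity e) (parity-odd (x ℤ/./ pos 2)))))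
... | suc (suc _) | s≤s (s≤s ()) | _

parity-bit : ∀ x → parity x ≡ 0 ⊎ parity x ≡ 1
parity-bit x with parity x | ℕ/.m%n<n ℤ.∣ x ∣ 2
... | 0 | _ = inj₁ refl
... | 1 | _ = inj₂ refl
... | suc (suc _) | s≤s (s≤s ())

infix 4 _≡₂_
_≡₂_ : ℤ → ℤ → Set
x ≡₂ y = pos 2 ∣ x - y

parity-cong : ∀ {x y} → x ≡₂ y → parity x ≡ parity y
parity-cong {x} {y} (divides q e) = go (halve x) (halve y) (parity-bit x) (parity-bit y)
  where
  ring : ∀ a k b l → (a + k * pos 2) - (b + l * pos 2) ≡ (a - b) + (k - l) * pos 2
  ring = solve-∀
  odd≢even : ∀ a b k l → x ≡ pos a + k * pos 2 → y ≡ pos b + l * pos 2 → parity (pos a - pos b) ≡ 1 → parity (pos a - pos b) ≡ 0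
  odd≢even a b k l ex ey odd = trans (cong parity (step (trans (sym (trans (cong₂ _-_ ex ey) (ring (pos a) k (pos b) l))) e))) (parity-even (q - (k - l)))
    where
    ring₂ : ∀ d q k l → d ≡ (d + (k - l) * pos 2) - (k - l) * pos 2
    ring₂ = solve-∀
    ring₃ : ∀ q k l → q * pos 2 - (k - l) * pos 2 ≡ (q - (k - l)) * pos 2
    ring₃ = solve-∀
    step : (pos a - pos b) + (k - l) * pos 2 ≡ q * pos 2 → pos a - pos b ≡ (q - (k - l)) * pos 2
    step h = trans (ring₂ (pos a - pos b) q k l) (trans (cong (λ z → z - (k - l) * pos 2) h) (ring₃ q k l))
  go : Σ ℤ (λ k → x ≡ pos (parity x) + k * pos 2) → Σ ℤ (λ l → y ≡ pos (parity y) + l * pos 2) →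
    parity x ≡ 0 ⊎ parity x ≡ 1 → parity y ≡ 0 ⊎ parity y ≡ 1 → parity x ≡ parity y
  go _ _ (inj₁ p) (inj₁ p′) = trans p (sym p′)
  go _ _ (inj₂ p) (inj₂ p′) = trans p (sym p′)
  go (k , ex) (l , ey) (inj₁ p) (inj₂ p′) = contradiction (odd≢even 0 1 k l (trans ex (cong (λ z → pos z + k * pos 2) p)) (trans ey (cong (λ z → pos z + l * pos 2) p′)) refl) λ ()
  go (k , ex) (l , ey) (inj₂ p) (inj₁ p′) = contradiction (odd≢even 1 0 k l (trans ex (cong (λ z → pos z + k * pos 2) p)) (trans ey (cong (λ z → pos z + l * pos 2) p′)) refl) λ ()

parity-square : ∀ {x y} → x * x ≡ y * y → parity x ≡ parity y
parity-square {x} {y} e = cong (ℕ._% 2) (root ℤ.∣ x ∣ ℤ.∣ y ∣ (trans (sym (ℤₚ.abs-* x x)) (trans (cong ℤ.∣_∣ e) (ℤₚ.abs-* y y))))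
  where
  root : ∀ m n → m ℕ.* m ≡ n ℕ.* n → m ≡ n
  root m n h with ℕₚ.<-cmp m n
  ... | Relation.Binary.tri< m<n _ _ = contradiction h (ℕₚ.<⇒≢ (ℕₚ.*-mono-< m<n m<n))
  ... | Relation.Binary.tri≈ _ m≡n _ = m≡n
  ... | Relation.Binary.tri> _ _ n<m = contradiction (sym h) (ℕₚ.<⇒≢ (ℕₚ.*-mono-< n<m n<m))

∙-≡₂ : ∀ {g n} (A : Mat g n) {c d : Row n} → (∀ i → c i ≡₂ d i) → ∀ r → (A ∙ c) r ≡₂ (A ∙ d) r
∙-≡₂ A {c} {d} e r = subst (pos 2 ∣_) (trans (sum-cong λ i → ring (c i) (d i) (A r i)) (sum-minus (λ i → c i * A r i) (λ i → d i * A r i)))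
  (∣-sum (λ i → (c i - d i) * A r i) λ i → ∣m⇒∣m*n (A r i) (e i))
  where
  ring : ∀ c d a → (c - d) * a ≡ c * a - d * a
  ring = solve-∀

dot-≡₂ : ∀ {g} (c d u : Row g) → (∀ r → c r ≡₂ d r) → dot c u ≡₂ dot d u
dot-≡₂ c d u e = ∙-≡₂ (λ (_ : Fin 1) → u) {c} {d} e zero

-- The parities of the vectors (z · vᵢ)ᵢ, for z ∈ 𝔽₂^g, form the binary code generated by the rows of A. Its weights,
-- refined by coordinate, give an invariant.
module _ {g n} (A : Mat g n) where
  codeWeight : Row g → ℕ
  codeWeight z = sumℕ λ i → parity (dot z (col A i))

-- The exponents 4 here and 2 in the invariant are chosen so that the representatives get different values.
fourth : ℕ → ℕ
fourth k = k ℕ.^ 4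

bitsOf : ∀ g → Fin (2 ℕ.^ g) → Row g
bitsOf g k r = pos (toℕ (Data.Fin.finToFun {2} {g} k r))

local : ∀ {g n} → Mat g n → Fin n → ℕ
local {g} A i = sumℕ λ k → fourth (codeWeight A (bitsOf g k)) ℕ.* parity (dot (bitsOf g k) (col A i))

invariant : ∀ {g n} → Mat g n → ℕ
invariant A = sumℕ λ i → local A i ℕ.^ 2

toBits : ∀ {g} → Row g → Fin (2 ℕ.^ g)
toBits z = Data.Fin.funToFin λ r → ℤ.∣ z r ∣ ℕ/.mod 2

bitsOf-toBits : ∀ {g} (z : Row g) r → bitsOf g (toBits z) r ≡ pos (parity (z r))
bitsOf-toBits z r = cong pos (trans (cong toℕ (Finₚ.finToFun-funToFin (λ r → ℤ.∣ z r ∣ ℕ/.mod 2) r)) (Finₚ.toℕ-fromℕ< (ℕ/.m%n<n ℤ.∣ z r ∣ 2)))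

bitsOf-≡₂ : ∀ {g} (z : Row g) r → z r ≡₂ bitsOf g (toBits z) r
bitsOf-≡₂ z r = divides (proj₁ (halve (z r))) (trans (cong (λ p → z r - p) (bitsOf-toBits z r))
  (trans (cong (λ w → w - pos (parity (z r))) (proj₂ (halve (z r)))) (ring (pos (parity (z r))) (proj₁ (halve (z r))))))
  where
  ring : ∀ p k → (p + k * pos 2) - p ≡ k * pos 2
  ring = solve-∀

funToFin-cong : ∀ {m n} {f h : Fin m → Fin n} → (∀ i → f i ≡ h i) → Data.Fin.funToFin f ≡ Data.Fin.funToFin h
funToFin-cong {zero}  e = refl
funToFin-cong {suc m} e = cong₂ Data.Fin.combine (e zero) (funToFin-cong (e ∘ suc))

toBits-bitsOf : ∀ {g} (z : Row g) k → (∀ r → z r ≡₂ bitsOf g k r) → toBits z ≡ k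
toBits-bitsOf {g} z k e = trans (funToFin-cong λ r → Finₚ.toℕ-injective (trans (Finₚ.toℕ-fromℕ< (ℕ/.m%n<n ℤ.∣ z r ∣ 2))
    (trans (parity-cong {z r} {bitsOf g k r} (e r)) (small (Data.Fin.finToFun {2} {g} k r))))) (Finₚ.funToFin-finToFin {g} {2} k)
  where
  small : (b : Fin 2) → toℕ b ℕ.% 2 ≡ toℕ b
  small zero       = refl
  small (suc zero) = refl

sumℕ-perm : ∀ {m n} (f : Fin n → ℕ) (π : Perm.Permutation m n) → sumℕ f ≡ sumℕ (λ i → f (π Perm.⟨$⟩ʳ i))
sumℕ-perm f π = trans (sumℕ≡sum f) (trans (SemiringSum.sum-permute ℕₚ.+-*-semiring f π) (sym (sumℕ≡sum (λ i → f (π Perm.⟨$⟩ʳ i)))))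

≡₂-trans : ∀ x y z → x ≡₂ y → y ≡₂ z → x ≡₂ z
≡₂-trans x y z p q = subst (pos 2 ∣_) (ring x y z) (∣m∣n⇒∣m+n p q)
  where
  ring : ∀ x y z → (x - y) + (y - z) ≡ x - z
  ring = solve-∀

mulℤ-∙ : ∀ {g} (X Y : Mat g g) → (∀ r s → mulℤ X Y r s ≡ idℤ r s) → ∀ z r → (X ∙ (Y ∙ z)) r ≡ z r
mulℤ-∙ X Y h z r = trans (∙-assoc X Y z r) (trans (sum-cong λ k → cong (z k *_) (trans (sum-cong λ l → ℤₚ.*-comm (Y l k) (X r l)) (trans (h r k) (idℤ-sym r k)))) (sum-idʳ r z))

module _ {g n m} (A : Mat g n) (B : Mat g m) (X Y : Mat g g)
  (XY : ∀ r s → mulℤ X Y r s ≡ idℤ r s) (YX : ∀ r s → mulℤ Y X r s ≡ idℤ r s)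
  (π : Perm.Permutation n m) (rays : ∀ i r s → B r (π Perm.⟨$⟩ʳ i) * B s (π Perm.⟨$⟩ʳ i) ≡ pullback X A r i * pullback X A s i) where
  private
    p : Fin n → Fin m
    p = π Perm.⟨$⟩ʳ_
    -- The action of a matrix on 𝔽₂^g, computed through representatives with entries 0 and 1. For an
    -- invertible matrix it is a permutation.
    turn : Mat g g → Fin (2 ℕ.^ g) → Fin (2 ℕ.^ g)
    turn Z k = toBits (Z ∙ bitsOf g k)
    turn-inverse : ∀ (Z Z′ : Mat g g) → (∀ r s → mulℤ Z Z′ r s ≡ idℤ r s) → ∀ k → turn Z (turn Z′ k) ≡ k
    turn-inverse Z Z′ h k = toBits-bitsOf (Z ∙ bitsOf g (turn Z′ k)) k λ r → ≡₂-trans ((Z ∙ bitsOf g (turn Z′ k)) r) ((Z ∙ (Z′ ∙ bitsOf g k)) r) (bitsOf g k r)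
      (swap₂ ((Z ∙ (Z′ ∙ bitsOf g k)) r) ((Z ∙ bitsOf g (turn Z′ k)) r) (∙-≡₂ Z {Z′ ∙ bitsOf g k} {bitsOf g (turn Z′ k)} (bitsOf-≡₂ (Z′ ∙ bitsOf g k)) r))
      (subst (λ w → w ≡₂ bitsOf g k r) (sym (mulℤ-∙ Z Z′ h (bitsOf g k) r)) (divides 0ℤ (ℤₚ.+-inverseʳ (bitsOf g k r))))
      where
      swap₂ : ∀ x y → x ≡₂ y → y ≡₂ x
      swap₂ x y d = subst (pos 2 ∣_) (ring x y) (∣m⇒∣-m d)
        where
        ring : ∀ x y → - (x - y) ≡ y - x
        ring = solve-∀
    τ : Perm.Permutation (2 ℕ.^ g) (2 ℕ.^ g)
    τ = Perm.permutation (turn X) (turn Y) (turn-inverse X Y XY) (turn-inverse Y X YX)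
    dot-pullback : ∀ z i → dot z (col (pullback X A) i) ≡ dot (X ∙ z) (col A i)
    dot-pullback z i = begin
      sumℤ (λ r → z r * sumℤ (λ a → X a r * A a i))   ≡⟨ sum-cong (λ r → sym (sum-*ˡ (z r) (λ a → X a r * A a i))) ⟩
      sumℤ (λ r → sumℤ (λ a → z r * (X a r * A a i))) ≡⟨ sum-swap (λ r a → z r * (X a r * A a i)) ⟩
      sumℤ (λ a → sumℤ (λ r → z r * (X a r * A a i))) ≡⟨ sum-cong (λ a → trans (sum-cong λ r → sym (ℤₚ.*-assoc (z r) (X a r) (A a i))) (sum-*ʳ (A a i) (λ r → z r * X a r))) ⟩
      sumℤ (λ a → (X ∙ z) a * A a i) ∎
      where open ≡-Reasoning
    parity-B : ∀ z i → parity (dot z (col B (p i))) ≡ parity (dot (X ∙ z) (col A i))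
    parity-B z i = trans (parity-square {dot z (col B (p i))} {dot z (col (pullback X A) i)}
        (trans (dot-bilin z z (col B (p i)) (col B (p i)))
          (trans (sum-cong λ r → sum-cong λ s → cong (z r * z s *_) (rays i r s)) (sym (dot-bilin z z (col (pullback X A) i) (col (pullback X A) i))))))
      (cong parity (dot-pullback z i))
    parity-τ : ∀ k i → parity (dot (bitsOf g k) (col B (p i))) ≡ parity (dot (bitsOf g (turn X k)) (col A i))
    parity-τ k i = trans (parity-B (bitsOf g k) i) (parity-cong {dot (X ∙ bitsOf g k) (col A i)} {dot (bitsOf g (turn X k)) (col A i)}
      (dot-≡₂ (X ∙ bitsOf g k) (bitsOf g (turn X k)) (col A i) (bitsOf-≡₂ (X ∙ bitsOf g k))))
    weight-τ : ∀ k → codeWeight B (bitsOf g k) ≡ codeWeight A (bitsOf g (turn X k))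
    weight-τ k = trans (sumℕ-perm (λ j → parity (dot (bitsOf g k) (col B j))) π) (sumℕ-cong (parity-τ k))
    local-π : ∀ i → local B (p i) ≡ local A i
    local-π i = trans (sumℕ-cong λ k → cong₂ ℕ._*_ (cong fourth (weight-τ k)) (parity-τ k i))
      (sym (sumℕ-perm (λ k → fourth (codeWeight A (bitsOf g k)) ℕ.* parity (dot (bitsOf g k) (col A i))) τ))

  -- A ray determines its column up to sign, which parity does not see. The outer sums then
  -- correspond under the permutation `π` of the columns, and the sums over 𝔽₂^g under the
  -- permutation induced by `X`.
  invariant-≡ : invariant B ≡ invariant A
  invariant-≡ = trans (sumℕ-perm (λ j → local B j ℕ.^ 2) π) (sumℕ-cong λ i → cong (ℕ._^ 2) (local-π i))

pullback-dual : ∀ {g n} (X Y : Mat g g) (A : Mat g n) → (∀ r s → mulℤ X Y r s ≡ idℤ r s) → Dual A → Dual (pullback X A)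
pullback-dual {g} X Y A XY D = record { x = λ j → Y ∙ Dual.x D j ; y = λ j → Y ∙ Dual.y D j
  ; dual = λ i j → trans (cong₂ _*_ (move (Dual.x D j) i) (move (Dual.y D j) i)) (Dual.dual D i j) }
  where
  move : ∀ z i → dot (Y ∙ z) (col (pullback X A) i) ≡ dot z (col A i)
  move z i = begin
    sumℤ (λ r → (Y ∙ z) r * sumℤ (λ a → X a r * A a i))   ≡⟨ sum-cong (λ r → sym (sum-*ˡ ((Y ∙ z) r) (λ a → X a r * A a i))) ⟩
    sumℤ (λ r → sumℤ (λ a → (Y ∙ z) r * (X a r * A a i))) ≡⟨ sum-swap (λ r a → (Y ∙ z) r * (X a r * A a i)) ⟩
    sumℤ (λ a → sumℤ (λ r → (Y ∙ z) r * (X a r * A a i))) ≡⟨ sum-cong (λ a → trans (sum-cong λ r → sym (ℤₚ.*-assoc ((Y ∙ z) r) (X a r) (A a i))) (sum-*ʳ (A a i) (λ r → (Y ∙ z) r * X a r))) ⟩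
    sumℤ (λ a → (X ∙ (Y ∙ z)) a * A a i)                  ≡⟨ sum-cong (λ a → cong (_* A a i) (mulℤ-∙ X Y XY z a)) ⟩
    sumℤ (λ a → z a * A a i) ∎
    where open ≡-Reasoning

sameOrbit⇒invariant : ∀ {g n m} {A : Mat g n} {B : Mat g m} → Dual A → Dual B → SameOrbit A B → invariant B ≡ invariant A
sameOrbit⇒invariant {A = A} {B} DA DB S@(X , (Y , XY , YX) , _) = finish (sameOrbit⇒cones A B S)
  where
  finish : (∀ P → InCone (pullback X A) P → InCone B P) × (∀ P → InCone B P → InCone (pullback X A) P) → invariant B ≡ invariant A
  finish (sub , sup) = let (π , rays) = same-rays (pullback X A) B (pullback-dual X Y A XY DA) DB sub sup
    in invariant-≡ A B X Y XY YX π rays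

-- Normal forms under GL_g(ℤ)

record GL (g : ℕ) : Set where
  constructor gl
  field
    X Y : Mat g g
    XY  : ∀ c r → (X ∙ (Y ∙ c)) r ≡ c r
    YX  : ∀ c r → (Y ∙ (X ∙ c)) r ≡ c r

id∙ : ∀ {g} (c : Row g) r → (idℤ ∙ c) r ≡ c r
id∙ c r = trans (sum-cong λ i → cong (c i *_) (idℤ-sym r i)) (sum-idʳ r c)

gl-id : ∀ {g} → GL g
gl-id = gl idℤ idℤ (λ c r → trans (id∙ (idℤ ∙ c) r) (id∙ c r)) (λ c r → trans (id∙ (idℤ ∙ c) r) (id∙ c r))

infixr 9 _⊙_
_⊙_ : ∀ {g} → Mat g g → Mat g g → Mat g g
(X ⊙ X′) r i = (X ∙ col X′ i) r

⊙-∙ : ∀ {g} (X X′ : Mat g g) c r → ((X ⊙ X′) ∙ c) r ≡ (X ∙ (X′ ∙ c)) r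
⊙-∙ X X′ c r = sym (∙-assoc X X′ c r)

gl-∘ : ∀ {g} → GL g → GL g → GL g
gl-∘ (gl X Y XY YX) (gl X′ Y′ XY′ YX′) = gl (X ⊙ X′) (Y′ ⊙ Y) (cancel X Y X′ Y′ XY XY′) (cancel Y′ X′ Y X YX′ YX)
  where
  cancel : ∀ {g} (X Y X′ Y′ : Mat g g) → (∀ c r → (X ∙ (Y ∙ c)) r ≡ c r) → (∀ c r → (X′ ∙ (Y′ ∙ c)) r ≡ c r) →
    ∀ c r → ((X ⊙ X′) ∙ ((Y′ ⊙ Y) ∙ c)) r ≡ c r
  cancel X Y X′ Y′ h h′ c r = trans (⊙-∙ X X′ ((Y′ ⊙ Y) ∙ c) r)
    (trans (∙-cong X (λ s → trans (∙-cong X′ (⊙-∙ Y′ Y c) s) (h′ (Y ∙ c) s)) r) (h c r))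

one⊕ : ∀ {g} → Mat g g → Mat (suc g) (suc g)
one⊕ X zero    zero    = 1ℤ
one⊕ X zero    (suc j) = 0ℤ
one⊕ X (suc i) zero    = 0ℤ
one⊕ X (suc i) (suc j) = X i j

one⊕-zero : ∀ {g} (X : Mat g g) c → (one⊕ X ∙ c) zero ≡ c zero
one⊕-zero X c = trans (cong₂ _+_ (ℤₚ.*-identityʳ (c zero)) (sum-zero λ i → ℤₚ.*-zeroʳ (c (suc i)))) (ℤₚ.+-identityʳ (c zero))

one⊕-suc : ∀ {g} (X : Mat g g) c r → (one⊕ X ∙ c) (suc r) ≡ (X ∙ (c ∘ suc)) r
one⊕-suc X c r = trans (cong (_+ (X ∙ (c ∘ suc)) r) (ℤₚ.*-zeroʳ (c zero))) (ℤₚ.+-identityˡ ((X ∙ (c ∘ suc)) r))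

gl-one⊕ : ∀ {g} → GL g → GL (suc g)
gl-one⊕ (gl X Y XY YX) = gl (one⊕ X) (one⊕ Y) (cancel X Y XY) (cancel Y X YX)
  where
  cancel : ∀ {g} (X Y : Mat g g) → (∀ c r → (X ∙ (Y ∙ c)) r ≡ c r) → ∀ c r → (one⊕ X ∙ (one⊕ Y ∙ c)) r ≡ c r
  cancel X Y h c zero    = trans (one⊕-zero X (one⊕ Y ∙ c)) (one⊕-zero Y c)
  cancel X Y h c (suc r) = trans (one⊕-suc X (one⊕ Y ∙ c) r) (trans (∙-cong X (one⊕-suc Y c) r) (h (c ∘ suc) r))

block : ∀ {g} → ℤ → ℤ → ℤ → ℤ → Mat (suc (suc g)) (suc (suc g))
block a b c d zero          zero          = a
block a b c d zero          (suc zero)    = b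
block a b c d (suc zero)    zero          = c
block a b c d (suc zero)    (suc zero)    = d
block a b c d zero          (suc (suc j)) = 0ℤ
block a b c d (suc zero)    (suc (suc j)) = 0ℤ
block a b c d (suc (suc i)) zero          = 0ℤ
block a b c d (suc (suc i)) (suc zero)    = 0ℤ
block a b c d (suc (suc i)) (suc (suc j)) = idℤ i j

block∙ : ∀ {g} a b c d (x : Row (suc (suc g))) →
  (block a b c d ∙ x) zero ≡ x zero * a + x (suc zero) * b ×
  (block a b c d ∙ x) (suc zero) ≡ x zero * c + x (suc zero) * d ×
  (∀ i → (block a b c d ∙ x) (suc (suc i)) ≡ x (suc (suc i)))
block∙ a b c d x = row a b , row c d , λ i →
    trans (cong₂ _+_ (ℤₚ.*-zeroʳ (x zero)) (cong₂ _+_ (ℤₚ.*-zeroʳ (x (suc zero))) (id∙ (λ k → x (suc (suc k))) i)))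
      (trans (ℤₚ.+-identityˡ (0ℤ + x (suc (suc i)))) (ℤₚ.+-identityˡ (x (suc (suc i)))))
  where
  row : ∀ a b → x zero * a + (x (suc zero) * b + sumℤ (λ i → x (suc (suc i)) * 0ℤ)) ≡ x zero * a + x (suc zero) * b
  row a b = cong (x zero * a +_) (trans (cong (x (suc zero) * b +_) (sum-zero λ i → ℤₚ.*-zeroʳ (x (suc (suc i))))) (ℤₚ.+-identityʳ (x (suc zero) * b)))

-- The step (x, y) ↦ (y, x - q y) of the Euclidean algorithm on the first two coordinates.
euclid-step : ∀ {g} → ℤ → GL (suc (suc g))
euclid-step {g} q = gl (block 0ℤ 1ℤ 1ℤ (- q)) (block q 1ℤ 1ℤ 0ℤ) there back
  where
  E = block {g} 0ℤ 1ℤ 1ℤ (- q)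
  F = block {g} q 1ℤ 1ℤ 0ℤ
  ring₁ : ∀ q x y → (x * q + y * 1ℤ) * 0ℤ + (x * 1ℤ + y * 0ℤ) * 1ℤ ≡ x
  ring₁ = solve-∀
  ring₂ : ∀ q x y → (x * q + y * 1ℤ) * 1ℤ + (x * 1ℤ + y * 0ℤ) * - q ≡ y
  ring₂ = solve-∀
  ring₃ : ∀ q x y → (x * 0ℤ + y * 1ℤ) * q + (x * 1ℤ + y * - q) * 1ℤ ≡ x
  ring₃ = solve-∀
  ring₄ : ∀ q x y → (x * 0ℤ + y * 1ℤ) * 1ℤ + (x * 1ℤ + y * - q) * 0ℤ ≡ y
  ring₄ = solve-∀
  there : ∀ c r → (E ∙ (F ∙ c)) r ≡ c r
  there c r with block∙ 0ℤ 1ℤ 1ℤ (- q) (F ∙ c) | block∙ q 1ℤ 1ℤ 0ℤ c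
  there c zero          | e , _ , _ | f₀ , f₁ , _ = trans e (trans (cong₂ (λ x y → x * 0ℤ + y * 1ℤ) f₀ f₁) (ring₁ q (c zero) (c (suc zero))))
  there c (suc zero)    | _ , e , _ | f₀ , f₁ , _ = trans e (trans (cong₂ (λ x y → x * 1ℤ + y * - q) f₀ f₁) (ring₂ q (c zero) (c (suc zero))))
  there c (suc (suc r)) | _ , _ , e | _ , _ , f   = trans (e r) (f r)
  back : ∀ c r → (F ∙ (E ∙ c)) r ≡ c r
  back c r with block∙ q 1ℤ 1ℤ 0ℤ (E ∙ c) | block∙ 0ℤ 1ℤ 1ℤ (- q) c
  back c zero          | e , _ , _ | f₀ , f₁ , _ = trans e (trans (cong₂ (λ x y → x * q + y * 1ℤ) f₀ f₁) (ring₃ q (c zero) (c (suc zero))))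
  back c (suc zero)    | _ , e , _ | f₀ , f₁ , _ = trans e (trans (cong₂ (λ x y → x * 1ℤ + y * 0ℤ) f₀ f₁) (ring₄ q (c zero) (c (suc zero))))
  back c (suc (suc r)) | _ , _ , e | _ , _ , f   = trans (e r) (f r)

Clears : ∀ {g} → Row (suc g) → Set
Clears {g} v = Σ (GL (suc g)) λ G → ∀ s → (GL.X G ∙ v) (suc s) ≡ 0ℤ

euclid : ∀ {g} (v : Row (suc (suc g))) → (∀ s → v (suc (suc s)) ≡ 0ℤ) → Acc ℕ._<_ ℤ.∣ v (suc zero) ∣ → Clears v
euclid {g} v z (acc rs) = go (v (suc zero) ℤ.≟ 0ℤ)
  where
  go : Dec (v (suc zero) ≡ 0ℤ) → Clears v
  go (yes e) = gl-id , λ { zero → trans (id∙ v (suc zero)) e ; (suc s) → trans (id∙ v (suc (suc s))) (z s) }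
  go (no ne) = compose (euclid w (λ s → trans (proj₂ (proj₂ step) s) (z s)) (rs (subst (ℕ._< ℤ.∣ b ∣) (sym (cong ℤ.∣_∣ remainder)) (ℤ/.n%d<d a b))))
    where
    a b q : ℤ
    a = v zero
    b = v (suc zero)
    instance
      b≢0 : ℤ.NonZero b
      b≢0 = ℤ.≢-nonZero ne
    q = a ℤ/./ b
    step = block∙ {g} 0ℤ 1ℤ 1ℤ (- q) v
    w : Row (suc (suc g))
    w = GL.X (euclid-step {g} q) ∙ v
    ring : ∀ r q b → (r + q * b) * 1ℤ + b * - q ≡ r
    ring = solve-∀
    remainder : w (suc zero) ≡ pos (a ℤ/.% b)
    remainder = trans (proj₁ (proj₂ step)) (trans (cong (λ x → x * 1ℤ + b * - q) (ℤ/.a≡a%n+[a/n]*n a b)) (ring (pos (a ℤ/.% b)) q b))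
    compose : Clears w → Clears v
    compose (G , h) = gl-∘ G (euclid-step q) , λ s → trans (⊙-∙ (GL.X G) (GL.X (euclid-step {g} q)) v (suc s)) (h s)

-- The tail is cleared first; what remains are the two top entries, whose greatest common divisor
-- `euclid` computes.
clears : ∀ {g} (v : Row (suc g)) → Clears v
clears {zero}  v = gl-id , λ ()
clears {suc g} v = finish (clears (v ∘ suc))
  where
  finish : Clears (v ∘ suc) → Clears v
  finish (G , h) = compose (euclid w (λ s → trans (one⊕-suc (GL.X G) v (suc s)) (h s)) (<-wellFounded ℤ.∣ w (suc zero) ∣))
    where
    w : Row (suc (suc g))
    w = one⊕ (GL.X G) ∙ v
    compose : Clears w → Clears v
    compose (H , k) = gl-∘ H (gl-one⊕ G) , λ s → trans (⊙-∙ (GL.X H) (one⊕ (GL.X G)) v (suc s)) (k s)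

-- The columns already present live in the first `r` coordinates, which must stay fixed. On the
-- other coordinates any unimodular change is free.
record Reduction {g} (r : ℕ) (v : Row g) : Set where
  field
    G      : GL g
    fixes  : ∀ u → (∀ s → r ℕ.≤ toℕ s → u s ≡ 0ℤ) → ∀ s → (GL.X G ∙ u) s ≡ u s
    -- The inequality is strict: entry `r` itself may survive, and whether it does decides between a
    -- coloop and a column in the span.
    cleared : ∀ s → r ℕ.< toℕ s → (GL.X G ∙ v) s ≡ 0ℤ

reduction : ∀ {g} r (v : Row g) → Reduction r v
reduction {zero} r v = record { G = gl-id ; fixes = λ _ _ () ; cleared = λ () }
reduction {suc g} zero v = record
  { G = proj₁ (clears v)
  ; fixes = λ u z s → trans (∙-zero (GL.X (proj₁ (clears v))) (λ i → z i z≤n) s) (sym (z s z≤n))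
  ; cleared = λ { (suc s) _ → proj₂ (clears v) s } }
reduction {suc g} (suc r) v = record
  { G = gl-one⊕ G
  ; fixes = λ { u z zero → one⊕-zero (GL.X G) u ; u z (suc s) → trans (one⊕-suc (GL.X G) u s) (fixes (u ∘ suc) (λ t h → z (suc t) (s≤s h)) s) }
  ; cleared = λ { (suc s) (s≤s h) → trans (one⊕-suc (GL.X G) v s) (cleared s h) } }
  where open Reduction (reduction r (v ∘ suc))

infixr 5 _∷ᶜ_
_∷ᶜ_ : ∀ {g n} → Row g → Mat g n → Mat g (suc n)
(v ∷ᶜ R) r zero    = v r
(v ∷ᶜ R) r (suc j) = R r j

equivalence-trans : ∀ {g l m n} {A : Mat g l} {B : Mat g m} {C : Mat g n} → Equivalence A B → Equivalence B C → Equivalence A C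
equivalence-trans {A = A} {B} {C} E F = record
  { π = E.π Perm.∘ₚ F.π ; ε = λ i → E.ε i * F.ε (E.π Perm.⟨$⟩ʳ i)
  ; unit = λ i → trans (ring (E.ε i) (F.ε (E.π Perm.⟨$⟩ʳ i))) (cong₂ _*_ (E.unit i) (F.unit (E.π Perm.⟨$⟩ʳ i)))
  ; X = GL.X G ; Y = GL.Y G ; XY = GL.XY G ; YX = GL.YX G
  ; to = λ i r → trans (⊙-∙ F.X E.X (col A i) r) (trans (∙-cong F.X (E.to i) r) (trans (scale (E.ε i) (col B (E.π Perm.⟨$⟩ʳ i)) r)
      (trans (cong (E.ε i *_) (F.to (E.π Perm.⟨$⟩ʳ i) r)) (sym (ℤₚ.*-assoc (E.ε i) (F.ε (E.π Perm.⟨$⟩ʳ i)) (C r (F.π Perm.⟨$⟩ʳ (E.π Perm.⟨$⟩ʳ i)))))))) }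
  where
  module E = Equivalence E
  module F = Equivalence F
  G = gl-∘ (gl F.X F.Y F.XY F.YX) (gl E.X E.Y E.XY E.YX)
  ring : ∀ a b → a * b * (a * b) ≡ a * a * (b * b)
  ring = solve-∀
  scale : ∀ e (c : Row _) r → (F.X ∙ (λ s → e * c s)) r ≡ e * (F.X ∙ c) r
  scale e c r = trans (sum-cong λ k → ℤₚ.*-assoc e (c k) (F.X r k)) (sum-*ˡ e (λ k → c k * F.X r k))

equivalence-from : ∀ {g m n} {A : Mat g m} {B : Mat g n} (E : Equivalence A B) → let open Equivalence E in
  ∀ i r → (Y ∙ col B (π Perm.⟨$⟩ʳ i)) r ≡ ε i * A r i
equivalence-from {A = A} {B} E i r = begin
  (Y ∙ col B (π Perm.⟨$⟩ʳ i)) r                   ≡⟨ ∙-cong Y (λ s → trans (sym (unit-cancel (ε i) (unit i) (B s (π Perm.⟨$⟩ʳ i)))) (cong (ε i *_) (sym (to i s)))) r ⟩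
  (Y ∙ (λ s → ε i * (X ∙ col A i) s)) r           ≡⟨ sum-cong (λ k → ℤₚ.*-assoc (ε i) ((X ∙ col A i) k) (Y r k)) ⟩
  sumℤ (λ k → ε i * ((X ∙ col A i) k * Y r k))    ≡⟨ sum-*ˡ (ε i) (λ k → (X ∙ col A i) k * Y r k) ⟩
  ε i * (Y ∙ (X ∙ col A i)) r                     ≡⟨ cong (ε i *_) (YX (col A i) r) ⟩
  ε i * A r i ∎
  where
  open Equivalence E
  open ≡-Reasoning

equivalence⇒embedding : ∀ {g m n} {A : Mat g m} {B : Mat g n} → Equivalence A B → Embedding A B
equivalence⇒embedding E = record { f = π Perm.⟨$⟩ʳ_ ; inj = λ {i} {j} e → trans (sym (Perm.inverseˡ π)) (trans (cong (π Perm.⟨$⟩ˡ_) e) (Perm.inverseˡ π))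
  ; ε = ε ; unit = unit ; X = X ; Y = Y ; to = to ; from = equivalence-from E }
  where open Equivalence E

equivalence-sym : ∀ {g m n} {A : Mat g m} {B : Mat g n} → Equivalence A B → Equivalence B A
equivalence-sym {A = A} {B} E = record { π = Perm.flip π ; ε = λ j → ε (π Perm.⟨$⟩ˡ j) ; unit = λ j → unit (π Perm.⟨$⟩ˡ j)
  ; X = Y ; Y = X ; XY = YX ; YX = XY
  ; to = λ j r → subst (λ k → (Y ∙ col B k) r ≡ ε (π Perm.⟨$⟩ˡ j) * A r (π Perm.⟨$⟩ˡ j)) (Perm.inverseʳ π) (equivalence-from E (π Perm.⟨$⟩ˡ j) r) }
  where open Equivalence E

equivalence-cons : ∀ {g m n} {A : Mat g m} {B : Mat g n} (E : Equivalence A B) v w η → η * η ≡ 1ℤ →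
  (∀ r → (Equivalence.X E ∙ v) r ≡ η * w r) → Equivalence (v ∷ᶜ A) (w ∷ᶜ B)
equivalence-cons E v w η u h = record { π = Perm.lift₀ π ; ε = η ◂ ε ; unit = λ { zero → u ; (suc i) → unit i }
  ; X = X ; Y = Y ; XY = XY ; YX = YX ; to = λ { zero → h ; (suc i) → to i } }
  where open Equivalence E

equivalence-gl : ∀ {g n} (R : Mat g n) (G : GL g) → (∀ j s → (GL.X G ∙ col R j) s ≡ R s j) → Equivalence R R
equivalence-gl R G h = record { π = Perm.id ; ε = const 1ℤ ; unit = λ _ → refl ; X = GL.X G ; Y = GL.Y G ; XY = GL.XY G ; YX = GL.YX G
  ; to = λ i r → trans (h i r) (sym (ℤₚ.*-identityˡ (R r i))) }

equivalence-head : ∀ {g m n} {A : Mat g (suc m)} {B : Mat g n} → Equivalence (col A zero ∷ᶜ tailCols A) B → Equivalence A B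
equivalence-head E = record { π = π ; ε = ε ; unit = unit ; X = X ; Y = Y ; XY = XY ; YX = YX ; to = λ { zero → to zero ; (suc i) → to (suc i) } }
  where open Equivalence E

embedding-tail : ∀ {g n} (A : Mat g (suc n)) → Embedding (tailCols A) A
embedding-tail A = record { f = suc ; inj = Finₚ.suc-injective ; ε = const 1ℤ ; unit = λ _ → refl ; X = idℤ ; Y = idℤ
  ; to = λ i r → trans (id∙ (col A (suc i)) r) (sym (ℤₚ.*-identityˡ (A r (suc i))))
  ; from = λ i r → trans (id∙ (col A (suc i)) r) (sym (ℤₚ.*-identityˡ (A r (suc i)))) }

Good : ∀ {g n} → Mat g n → Set
Good A = Liftable A × Reduced A × Cographic A

embedding-good : ∀ {g m n} {A : Mat g m} {B : Mat g n} → Embedding A B → Good B → Good A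
embedding-good E (l , r , c) = embedding-liftable E l , embedding-reduced E r , embedding-cographic E c

-- Echelon form of rank `r`: every unit vector of the first `r` coordinates occurs among the
-- columns, and nothing lies beyond. `kind j` tells which unit vector, if any, column `j` serves as.
record Frame {g n} (R : Mat g n) (r : ℕ) : Set where
  field
    kind : Fin n → Maybe (Fin g)
  unitRow : Fin n → Row g
  unitRow j t = Data.Maybe.maybe′ (λ t′ → idℤ t′ t) 0ℤ (kind j)
  field
    is-unit : ∀ j t → kind j ≡ just t → ∀ s → R s j ≡ idℤ s t
    spans   : ∀ t → toℕ t ℕ.< r → ∀ s → sumℤ (λ j → unitRow j t * R s j) ≡ idℤ t s
    beyond  : ∀ s → r ℕ.≤ toℕ s → ∀ j → R s j ≡ 0ℤ

-- Take the entry v i itself as the modulus. Subtracting from `v` its other entries times unit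
-- columns leaves v i times the unit vector `i`, a relation modulo v i. Its lift uses no column with
-- a nonzero entry in row `i` except `v`, so the lifted coefficient of `v` times v i is 0. Since
-- that coefficient is congruent to 1 modulo v i, either v i is 0 or it divides 1.
module _ {g n} {R : Mat g n} {r : ℕ} (F : Frame R r) (v : Row g) (lift : Liftable (v ∷ᶜ R))
  (i : Fin g) (low : ∀ t → t ≢ i → r ℕ.≤ toℕ t → v t ≡ 0ℤ) where
  open Frame F
  private
    vᵢ : Row g
    vᵢ t = v t - v i * idℤ i t
    vᵢ-i : vᵢ i ≡ 0ℤ
    vᵢ-i = trans (cong (λ x → v i - v i * x) (idℤ-diag i)) (trans (cong (λ x → v i - x) (ℤₚ.*-identityʳ (v i))) (ℤₚ.+-inverseʳ (v i)))
    vᵢ-beyond : ∀ t → r ℕ.≤ toℕ t → vᵢ t ≡ 0ℤ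
    vᵢ-beyond t h with t ≟ i
    ... | yes refl = vᵢ-i
    ... | no ne    = trans (cong₂ (λ x y → x - v i * y) (low t ne h) (idℤ-off (ne ∘ sym))) (cong (λ z → 0ℤ - z) (ℤₚ.*-zeroʳ (v i)))
    e : Row n
    e j = dot vᵢ (unitRow j)
    c : Row (suc n)
    c = 1ℤ ◂ λ j → - e j
    combine : ∀ s → sumℤ (λ j → e j * R s j) ≡ vᵢ s
    combine s = begin
      sumℤ (λ j → sumℤ (λ t → vᵢ t * unitRow j t) * R s j)      ≡⟨ sum-cong (λ j → trans (sym (sum-*ʳ (R s j) (λ t → vᵢ t * unitRow j t))) (sum-cong λ t → ℤₚ.*-assoc (vᵢ t) (unitRow j t) (R s j))) ⟩
      sumℤ (λ j → sumℤ (λ t → vᵢ t * (unitRow j t * R s j)))    ≡⟨ sum-swap (λ j t → vᵢ t * (unitRow j t * R s j)) ⟩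
      sumℤ (λ t → sumℤ (λ j → vᵢ t * (unitRow j t * R s j)))    ≡⟨ sum-cong (λ t → trans (sum-*ˡ (vᵢ t) (λ j → unitRow j t * R s j)) (term t (toℕ t ℕ.<? r))) ⟩
      sumℤ (λ t → vᵢ t * idℤ t s)                               ≡⟨ sum-idʳ s vᵢ ⟩
      vᵢ s ∎
      where
      open ≡-Reasoning
      term : ∀ t → Dec (toℕ t ℕ.< r) → vᵢ t * sumℤ (λ j → unitRow j t * R s j) ≡ vᵢ t * idℤ t s
      term t (yes lt) = cong (vᵢ t *_) (spans t lt s)
      term t (no ge)  = trans (cong (_* sumℤ (λ j → unitRow j t * R s j)) (vᵢ-beyond t (ℕₚ.≮⇒≥ ge))) (sym (cong (_* idℤ t s) (vᵢ-beyond t (ℕₚ.≮⇒≥ ge))))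
    value : ∀ s → ((v ∷ᶜ R) ∙ c) s ≡ idℤ i s * v i
    value s = trans (cong (1ℤ * v s +_) (trans (sum-cong λ j → sym (ℤₚ.neg-distribˡ-* (e j) (R s j))) (trans (sum-neg (λ j → e j * R s j)) (cong -_ (combine s)))))
      (ring (v s) (v i) (idℤ i s))
      where
      ring : ∀ x y d → 1ℤ * x + - (x - y * d) ≡ d * y
      ring = solve-∀
    idle : ∀ (c′ : Row (suc n)) → (∀ j → c j ≡ 0ℤ → c′ j ≡ 0ℤ) → ∀ j → c′ (suc j) * R i j ≡ 0ℤ
    idle c′ supp j = by-kind (kind j) refl
      where
      gone : e j ≡ 0ℤ → c′ (suc j) * R i j ≡ 0ℤ
      gone z = cong (_* R i j) (supp (suc j) (cong -_ z))
      by-kind : ∀ k → kind j ≡ k → c′ (suc j) * R i j ≡ 0ℤ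
      by-kind nothing k = gone (sum-zero λ t → trans (cong (λ w → vᵢ t * Data.Maybe.maybe′ (λ t′ → idℤ t′ t) 0ℤ w) k) (ℤₚ.*-zeroʳ (vᵢ t)))
      by-kind (just t) k with t ≟ i
      ... | yes refl = gone (trans (sum-cong λ u → trans (cong (λ w → vᵢ u * Data.Maybe.maybe′ (λ t′ → idℤ t′ u) 0ℤ w) k) (cong (vᵢ u *_) (idℤ-sym t u))) (trans (sum-idʳ t vᵢ) vᵢ-i))
      ... | no ne    = trans (cong (c′ (suc j) *_) (trans (is-unit j t k i) (idℤ-off (ne ∘ sym)))) (ℤₚ.*-zeroʳ (c′ (suc j)))

  unit-entry : Sgn (v i)
  unit-entry = finish (lift (v i) c λ s → divides (idℤ i s) (value s))
    where
    ∣1 : ∀ x → x ∣ 0ℤ - 1ℤ → Sgn x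
    ∣1 x d = cases x (ℕ∣.∣1⇒≡1 (∣⇒∣ᵤ d))
      where
      cases : ∀ x → ℤ.∣ x ∣ ≡ 1 → Sgn x
      cases (pos .1) refl = inj₂ (inj₁ refl)
      cases -[1+ 0 ] refl = inj₂ (inj₂ refl)
    finish : Lift (v ∷ᶜ R) (v i) c → Sgn (v i)
    finish (c′ , rel , cong-p , supp) = [ (λ z → ∣1 (v i) (subst (λ x → v i ∣ x - 1ℤ) z (cong-p zero))) , inj₁ ]′
      (ℤₚ.i*j≡0⇒i≡0∨j≡0 (c′ zero) (trans (sym (ℤₚ.+-identityʳ (c′ zero * v i)))
        (trans (cong (c′ zero * v i +_) (sym (sum-zero (idle c′ supp)))) (rel i))))

data NormalForm {g n} (R : Mat g n) (r : ℕ) (v : Row g) : Set where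
  coloop : ∀ s₀ → toℕ s₀ ≡ r → Equivalence (v ∷ᶜ R) (idℤ s₀ ∷ᶜ R) → NormalForm R r v
  inSpan : ∀ w → (∀ s → Sgn (w s)) → (∀ s → r ℕ.≤ toℕ s → w s ≡ 0ℤ) → Equivalence (v ∷ᶜ R) (w ∷ᶜ R) → NormalForm R r v

-- It subtracts multiples of coordinate `s₀` from the coordinates, and so fixes every vector whose
-- coordinate `s₀` is 0.
shear : ∀ {g} → Row g → Fin g → Mat g g
shear q s₀ a b = idℤ a b - q a * idℤ s₀ b

shear∙ : ∀ {g} (q : Row g) s₀ c a → (shear q s₀ ∙ c) a ≡ c a - q a * c s₀
shear∙ q s₀ c a = trans (∙-clear c (idℤ a) (idℤ s₀) (q a)) (cong₂ (λ x y → x - q a * y) (id∙′ a) (id∙′ s₀))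
  where
  id∙′ : ∀ a → sumℤ (λ b → c b * idℤ a b) ≡ c a
  id∙′ a = id∙ c a

shear-cancel : ∀ {g} (p q : Row g) s₀ → q s₀ ≡ 0ℤ → (∀ a → p a ≡ - q a) → ∀ c r → (shear p s₀ ∙ (shear q s₀ ∙ c)) r ≡ c r
shear-cancel p q s₀ q₀ h c r = begin
  (shear p s₀ ∙ (shear q s₀ ∙ c)) r                   ≡⟨ shear∙ p s₀ (shear q s₀ ∙ c) r ⟩
  (shear q s₀ ∙ c) r - p r * (shear q s₀ ∙ c) s₀      ≡⟨ cong₂ (λ x y → x - p r * y) (shear∙ q s₀ c r) (trans (shear∙ q s₀ c s₀) (cong (λ z → c s₀ - z * c s₀) q₀)) ⟩
  (c r - q r * c s₀) - p r * (c s₀ - 0ℤ * c s₀)       ≡⟨ cong (λ z → (c r - q r * c s₀) - z * (c s₀ - 0ℤ * c s₀)) (h r) ⟩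
  (c r - q r * c s₀) - - q r * (c s₀ - 0ℤ * c s₀)     ≡⟨ ring (c r) (q r) (c s₀) ⟩
  c r ∎
  where
  open ≡-Reasoning
  ring : ∀ x q y → (x - q * y) - - q * (y - 0ℤ * y) ≡ x
  ring = solve-∀

gl-shear : ∀ {g} (q : Row g) s₀ → q s₀ ≡ 0ℤ → GL g
gl-shear q s₀ q₀ = gl (shear q s₀) (shear (λ a → - q a) s₀) (shear-cancel q (λ a → - q a) s₀ (cong -_ q₀) (λ a → sym (ℤₚ.neg-involutive (q a))))
  (shear-cancel (λ a → - q a) q s₀ q₀ (λ a → refl))

-- After the reduction only entry `r` can be nonzero beyond the span. If it is 0, `unit-entry`
-- bounds all the entries. If not, `unit-entry` makes it 1 or -1, and a shear with this pivot clears
-- the rest of the column without moving `R`.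
normalForm : ∀ {g n} {R : Mat g n} {r} → Frame R r → ∀ v → Liftable (v ∷ᶜ R) → NormalForm R r v
normalForm {g} {n} {R} {r} F v lift = go (Finₚ.any? λ s → (toℕ s ℕ.≟ r) ×-dec ¬? (w s ℤ.≟ 0ℤ))
  where
  open Frame F
  open Reduction (reduction r v)
  w : Row g
  w = GL.X G ∙ v
  E : Equivalence (v ∷ᶜ R) (w ∷ᶜ R)
  E = equivalence-cons (equivalence-gl R G λ j s → fixes (col R j) (λ t h → beyond t h j) s) v w 1ℤ refl (λ s → sym (ℤₚ.*-identityˡ (w s)))
  lift-w : Liftable (w ∷ᶜ R)
  lift-w = embedding-liftable (equivalence⇒embedding (equivalence-sym E)) lift
  go : Dec (∃ λ s → toℕ s ≡ r × w s ≢ 0ℤ) → NormalForm R r v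
  go (no none) = inSpan w (λ s → unit-entry F w lift-w s (λ t _ → zero-beyond t)) zero-beyond E
    where
    zero-beyond : ∀ t → r ℕ.≤ toℕ t → w t ≡ 0ℤ
    zero-beyond t h with w t ℤ.≟ 0ℤ | toℕ t ℕ.≟ r
    ... | yes e | _     = e
    ... | no ne | yes e = contradiction (t , e , ne) none
    ... | no ne | no e  = cleared t (ℕₚ.≤∧≢⇒< h (e ∘ sym))
  go (yes (s₀ , s₀≡r , w≢0)) = coloop s₀ s₀≡r (equivalence-trans E
      (equivalence-cons (equivalence-gl R (gl-shear q s₀ q₀) fixed) w (idℤ s₀) η unit sheared))
    where
    η : ℤ
    η = w s₀
    unit : η * η ≡ 1ℤ
    unit = sgn-square (unit-entry F w lift-w s₀ λ t ne h → cleared t (ℕₚ.≤∧≢⇒< h λ e → ne (Finₚ.toℕ-injective (trans (sym e) (sym s₀≡r))))) w≢0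
    q : Row g
    q a = (w a - η * idℤ s₀ a) * η
    q₀ : q s₀ ≡ 0ℤ
    q₀ = trans (cong (λ z → (η - η * z) * η) (idℤ-diag s₀)) (ring η)
      where
      ring : ∀ η → (η - η * 1ℤ) * η ≡ 0ℤ
      ring = solve-∀
    fixed : ∀ j s → (shear q s₀ ∙ col R j) s ≡ R s j
    fixed j s = trans (shear∙ q s₀ (col R j) s) (trans (cong (λ z → R s j - q s * z) (beyond s₀ (ℕₚ.≤-reflexive (sym s₀≡r)) j)) (ring (R s j) (q s)))
      where
      ring : ∀ x q → x - q * 0ℤ ≡ x
      ring = solve-∀
    sheared : ∀ s → (shear q s₀ ∙ w) s ≡ η * idℤ s₀ s
    sheared s = trans (shear∙ q s₀ w s) (trans (ring (w s) η (idℤ s₀ s)) (trans (cong (λ z → w s - (w s - η * idℤ s₀ s) * z) unit) (ring′ (w s) (η * idℤ s₀ s))))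
      where
      ring : ∀ x η d → x - (x - η * d) * η * η ≡ x - (x - η * d) * (η * η)
      ring = solve-∀
      ring′ : ∀ x y → x - (x - y) * 1ℤ ≡ y
      ring′ = solve-∀

-- Camion's criterion: a relation c modulo 2, tested against a row combination y that is even on the support of c.
camion : ∀ {g n} (A : Mat g n) → Liftable A → ∀ (c : Row n) (y : Row g) → (∀ s → pos 2 ∣ (A ∙ c) s) →
  (∀ j → c j ≡ 0ℤ ⊎ pos 2 ∣ dot y (col A j)) → pos 4 ∣ dot y (A ∙ c)
camion A lift c y even supp-even = finish (lift (pos 2) c even)
  where
  ring : ∀ d z e → (z - e) * d ≡ z * d - e * d
  ring = solve-∀
  four : ∀ x {a b} → x ≡ a * pos 2 * (b * pos 2) → pos 4 ∣ x
  four x {a} {b} e = divides (a * b) (trans e (four-ring a b))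
    where
    four-ring : ∀ a b → a * pos 2 * (b * pos 2) ≡ a * b * pos 4
    four-ring = solve-∀
  -- As A c′ = 0, the number y · (A c) is minus the sum of (c′ j - c j)(y · A j). On the support of
  -- `c` both factors are even; off it the lift has not changed the coefficient.
  finish : Lift A (pos 2) c → pos 4 ∣ dot y (A ∙ c)
  finish (c′ , rel , cong-2 , supp) = subst (pos 4 ∣_) total (∣m⇒∣-m (∣-sum (λ j → (c′ j - c j) * dot y (col A j)) λ j → term j (cong-2 j) (supp-even j)))
    where
    term : ∀ j → pos 2 ∣ c′ j - c j → c j ≡ 0ℤ ⊎ pos 2 ∣ dot y (col A j) → pos 4 ∣ (c′ j - c j) * dot y (col A j)
    term j _ (inj₁ z) = divides 0ℤ (cong (_* dot y (col A j)) (trans (cong₂ _-_ (supp j z) z) refl))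
    term j (divides a e) (inj₂ (divides b f)) = four ((c′ j - c j) * dot y (col A j)) {a} {b} (cong₂ _*_ e f)
    total : - sumℤ (λ j → (c′ j - c j) * dot y (col A j)) ≡ dot y (A ∙ c)
    total = trans (cong -_ (trans (sum-cong λ j → ring (dot y (col A j)) (c′ j) (c j)) (trans (sum-minus (λ j → c′ j * dot y (col A j)) (λ j → c j * dot y (col A j)))
        (cong₂ _-_ (sym (dot-∙ y A c′)) (sym (dot-∙ y A c))))))
      (trans (cong (λ z → - (z - dot y (A ∙ c))) (sum-zero λ r → trans (cong (y r *_) (rel r)) (ℤₚ.*-zeroʳ (y r)))) (ring′ (dot y (A ∙ c))))
      where
      ring′ : ∀ x → - (0ℤ - x) ≡ x
      ring′ = solve-∀

-- Certificates

does-sound : ∀ {P : Set} (d : Dec P) → does d ≡ true → P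
does-sound (yes p) _ = p

∧-true : ∀ {a b} → a ∧ b ≡ true → a ≡ true × b ≡ true
∧-true {true} {true} _ = refl , refl

mat : ∀ {g n} → Vec (Vec ℤ g) n → Mat g n
mat cs r i = lookup (lookup cs i) r

-- The vector x c + w. The separate clauses for 0, 1 and -1 spare multiplications when the
-- certificates are evaluated.
axpy : ∀ {g} → ℤ → Vec ℤ g → Vec ℤ g → Vec ℤ g
axpy (pos 0)   c w = w
axpy (pos 1)   c w = Vec.zipWith _+_ c w
axpy -[1+ 0 ]  c w = Vec.zipWith (λ a b → b - a) c w
axpy x         c w = Vec.zipWith (λ a b → x * a + b) c w

lookup-axpy : ∀ {g} x (c w : Vec ℤ g) r → lookup (axpy x c w) r ≡ x * lookup c r + lookup w r
lookup-axpy (pos 0)   c w r = sym (ℤₚ.+-identityˡ (lookup w r))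
lookup-axpy (pos 1)   c w r = trans (Vecₚ.lookup-zipWith _+_ r c w) (cong (_+ lookup w r) (sym (ℤₚ.*-identityˡ (lookup c r))))
lookup-axpy (pos (suc (suc x))) c w r = Vecₚ.lookup-zipWith (λ a b → pos (suc (suc x)) * a + b) r c w
lookup-axpy -[1+ 0 ]  c w r = trans (Vecₚ.lookup-zipWith (λ a b → b - a) r c w) (ring (lookup w r) (lookup c r))
  where
  ring : ∀ x y → x - y ≡ - 1ℤ * y + x
  ring = solve-∀
lookup-axpy -[1+ suc x ] c w r = Vecₚ.lookup-zipWith (λ a b → -[1+ suc x ] * a + b) r c w

apply : ∀ {g n} → Vec (Vec ℤ g) n → Vec ℤ n → Vec ℤ g
apply []       []       = Vec.replicate _ 0ℤ
apply (c ∷ cs) (x ∷ xs) = axpy x c (apply cs xs)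

lookup-apply : ∀ {g n} (cs : Vec (Vec ℤ g) n) xs r → lookup (apply cs xs) r ≡ (mat cs ∙ lookup xs) r
lookup-apply []       []       r = Vecₚ.lookup-replicate r 0ℤ
lookup-apply (c ∷ cs) (x ∷ xs) r = trans (lookup-axpy x c (apply cs xs) r) (cong (x * lookup c r +_) (lookup-apply cs xs r))

infix 4 _≟ᵛ_
_≟ᵛ_ : ∀ {g} (u v : Vec ℤ g) → Dec (u ≡ v)
_≟ᵛ_ = Vecₚ.≡-dec ℤ._≟_

scale : ∀ {g} → ℤ → Vec ℤ g → Vec ℤ g
scale η = Vec.map (η *_)

units : ∀ g → Vec (Vec ℤ g) g
units g = Vec.tabulate λ t → Vec.tabulate λ s → idℤ s t

lookup-units : ∀ {g} t s → lookup (lookup (units g) t) s ≡ idℤ s t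
lookup-units {g} t s = trans (cong (λ u → lookup u s) (Vecₚ.lookup∘tabulate (λ t → Vec.tabulate λ s → idℤ s t) t)) (Vecₚ.lookup∘tabulate (λ s → idℤ s t) s)

zeros : ∀ {g} → Vec ℤ g
zeros = Vec.replicate _ 0ℤ

digits : ∀ b .{{_ : ℕ.NonZero b}} n → ℕ → Vec ℕ n
digits b zero    c = []
digits b (suc n) c = c ℕ.% b ∷ digits b n (c ℕ./ b)

trit : ℕ → ℤ
trit 0 = 0ℤ
trit 1 = 1ℤ
trit _ = -[1+ 0 ]

ternary : ∀ g → ℕ → Vec ℤ g
ternary g c = Vec.map trit (digits 3 g c)

binary : ∀ g → ℕ → Vec ℤ g
binary g c = Vec.map pos (digits 2 g c)

-- a base-32 digit 2 j + b stands for the index j with the sign (-1)^b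
signed : ∀ n → ℕ → Vec (ℕ × ℤ) n
signed n c = Vec.map (λ d → d ℕ./ 2 , (if d ℕ.% 2 ℕ.≡ᵇ 0 then 1ℤ else -[1+ 0 ])) (digits 32 n c)

fill : ∀ {A : Set} {n} → Vec A n → List A → Vec A n
fill []       xs       = []
fill (d ∷ ds) []       = d ∷ ds
fill (d ∷ ds) (x ∷ xs) = x ∷ fill ds xs

nth : ∀ {A : Set} → A → List A → ℕ → A
nth d []       k       = d
nth d (x ∷ xs) zero    = x
nth d (x ∷ xs) (suc k) = nth d xs k

-- Nothing is promised if neither `v` nor its negative occurs: the last index is then a default, and
-- `Carries` rejects the result.
locate : ∀ {g n} → Vec (Vec ℤ g) (suc n) → Vec ℤ g → Fin (suc n) × ℤ
locate {n = zero}  (b ∷ []) v = zero , (if does (v ≟ᵛ b) then 1ℤ else -[1+ 0 ])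
locate {n = suc n} (b ∷ bs) v = if does (v ≟ᵛ b) then (zero , 1ℤ) else if does (v ≟ᵛ scale -[1+ 0 ] b) then (zero , -[1+ 0 ])
  else (let (j , η) = locate bs v in suc j , η)

position : ∀ {n m} → Vec (Fin n × ℤ) (suc m) → Fin n → Fin (suc m)
position {m = zero}  _        j = zero
position {m = suc m} (x ∷ xs) j = if does (proj₁ x ≟ j) then zero else suc (position xs j)

module _ {g m n} (A : Vec (Vec ℤ g) m) (B : Vec (Vec ℤ g) n) (X Y : Vec (Vec ℤ g) g) (f : Vec (Fin n × ℤ) m) where
  private
    F : Fin m → Fin n
    F i = proj₁ (lookup f i)
    η : Fin m → ℤ
    η i = proj₂ (lookup f i)

  Carries : Set
  Carries = ∀ i → η i * η i ≡ 1ℤ × apply X (lookup A i) ≡ scale (η i) (lookup B (F i))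

  carries? : Dec Carries
  carries? = Finₚ.all? λ i → (η i * η i ℤ.≟ 1ℤ) ×-dec (apply X (lookup A i) ≟ᵛ scale (η i) (lookup B (F i)))

  Inverse : Vec (Fin m) n → Set
  Inverse f′ = (∀ s → apply X (lookup Y s) ≡ lookup (units g) s × apply Y (lookup X s) ≡ lookup (units g) s) ×
    (∀ i → lookup f′ (F i) ≡ i) × (∀ j → F (lookup f′ j) ≡ j)

  inverse? : ∀ f′ → Dec (Inverse f′)
  inverse? f′ = (Finₚ.all? λ s → (apply X (lookup Y s) ≟ᵛ lookup (units g) s) ×-dec (apply Y (lookup X s) ≟ᵛ lookup (units g) s))
    ×-dec ((Finₚ.all? λ i → lookup f′ (F i) ≟ i) ×-dec (Finₚ.all? λ j → F (lookup f′ j) ≟ j))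

  carried : Carries → ∀ i r → (mat X ∙ col (mat A) i) r ≡ η i * mat B r (F i)
  carried h i r = trans (sym (lookup-apply X (lookup A i) r)) (trans (cong (λ v → lookup v r) (proj₂ (h i))) (Vecₚ.lookup-map r (η i *_) (lookup B (F i))))

  equivalence : ∀ f′ → Carries → Inverse f′ → Equivalence (mat A) (mat B)
  equivalence f′ h (inv , l , r) = record
    { π = Perm.permutation F (lookup f′) r l ; ε = η ; unit = proj₁ ∘ h ; X = mat X ; Y = mat Y
    ; XY = cancel X Y (proj₁ ∘ inv) ; YX = cancel Y X (proj₂ ∘ inv) ; to = carried h }
    where
    cancel : ∀ (X Y : Vec (Vec ℤ g) g) → (∀ s → apply X (lookup Y s) ≡ lookup (units g) s) → ∀ c r → (mat X ∙ (mat Y ∙ c)) r ≡ c r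
    cancel X Y e c r = trans (∙-assoc (mat X) (mat Y) c r) (trans (sum-cong λ s → cong (c s *_)
      (trans (sym (lookup-apply X (lookup Y s) r)) (trans (cong (λ v → lookup v r) (e s)) (trans (lookup-units s r) (idℤ-sym r s))))) (sum-idʳ r c))

  Embeds : Set
  Embeds = (∀ i → apply Y (lookup B (F i)) ≡ scale (η i) (lookup A i)) × (∀ i j → i ≡ j ⊎ F i ≢ F j)

  embeds? : Dec Embeds
  embeds? = (Finₚ.all? λ i → apply Y (lookup B (F i)) ≟ᵛ scale (η i) (lookup A i)) ×-dec
    (Finₚ.all? λ i → Finₚ.all? λ j → (i ≟ j) ⊎-dec ¬? (F i ≟ F j))

  embedding : Carries → Embeds → Embedding (mat A) (mat B)
  embedding h (b , inj) = record { f = F ; inj = λ {i} {j} e → [ id , (λ ne → contradiction e ne) ]′ (inj i j) ; ε = η ; unit = proj₁ ∘ h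
    ; X = mat X ; Y = mat Y ; to = carried h
    ; from = λ i r → trans (sym (lookup-apply Y (lookup B (F i)) r)) (trans (cong (λ v → lookup v r) (b i)) (Vecₚ.lookup-map r (η i *_) (lookup A i))) }

-- A certificate tree prescribes, for every vector v with entries 0, 1, -1 (up to sign), what adding the column v does.
data Tree : Set where
  node : Tree → Tree → Tree → Tree
  par  : Tree
  kill : ℕ → Tree
  iso  : ℕ → ℕ → Tree
  bad  : ℕ → ℕ → ℕ → Tree

-- Trees are packed into numbers, lowest bits first; the first argument bounds the depth.
unpack : ℕ → ℕ → Tree × ℕ
unpack zero    c = par , c
unpack (suc d) c = token (c ℕ.% 4) (c ℕ./ 4)
  where
  leaf : ℕ → ℕ → Tree × ℕ
  -- Labels from 96 on denote bad matroids, as 96 exceeds the 92 representatives. The 25 bits are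
  -- five base-32 digits, for the images of at most 5 unit vectors. The 55 bits are the places of at
  -- most 11 columns, and the 40 bits hold five base-256 digits, the columns of the backward matrix.
  -- The 12 bits of `kill` are 5 for the row vector and 7 for the columns outside the identity.
  leaf l c = if l ℕ.<ᵇ 96 then (iso l (c ℕ.% 2 ℕ.^ 25) , c ℕ./ 2 ℕ.^ 25)
    else (bad (l ℕ.∸ 96) (c ℕ.% 2 ℕ.^ 55) (c ℕ./ 2 ℕ.^ 55 ℕ.% 2 ℕ.^ 40) , c ℕ./ 2 ℕ.^ 95)
  token : ℕ → ℕ → Tree × ℕ
  token 0 c = let (t₀ , c₀) = unpack d c ; (t₁ , c₁) = unpack d c₀ ; (t₂ , c₂) = unpack d c₁ in node t₀ t₁ t₂ , c₂
  token 1 c = par , c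
  token 2 c = kill (c ℕ.% 2 ℕ.^ 12) , c ℕ./ 2 ℕ.^ 12
  token _ c = leaf (c ℕ.% 128) (c ℕ./ 128)

-- Lists of numbers are packed into one, in base 16 (parents, pairs) or 256 (body, duals), lowest digits first. The tree
-- is for adding a column in the span of the others, and the leaf packed in up for adding a coloop.
record Rep : Set where
  constructor rep
  field
    rank corank body parents pairs duals forest up : ℕ
  size′ : ℕ
  size′ = corank ℕ.+ rank
  tree extra : Tree
  tree  = proj₁ (unpack 6 forest)
  extra = proj₁ (unpack 1 up)
open Rep

bodyCols : ∀ g R → Vec (Vec ℤ g) (corank R)
bodyCols g R = Vec.map (ternary g) (digits 256 (corank R) (body R))

cols : ∀ g R → Vec (Vec ℤ g) (size′ R)
cols g R = bodyCols g R Vec.++ Vec.tabulate λ t → Vec.tabulate λ s → if toℕ s ℕ.≡ᵇ toℕ t then 1ℤ else 0ℤ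

-- The data of an `Obstruction` on a matrix [C | I]: `excess` is one less than the corank, to match
-- `m` there; `rows` packs `count` row vectors that certify independence; `weights` packs the 0/1
-- weights, and `girth` is `t`. A weight 0 discounts an element in series with another.
record Bad : Set where
  constructor mkBad
  field
    badRank excess badBody count rows weights girth : ℕ
  badRep : Rep
  badRep = rep badRank (suc excess) badBody 0 0 0 0 0
open Bad

module Certificates {g N M : ℕ} (table : Vec (∃ λ n → Vec (Vec ℤ g) n) N) (ranks : Vec ℕ N) (bads : Vec Bad M) where

  module _ {n m} (A : Vec (Vec ℤ g) (suc n)) (B : Vec (Vec ℤ g) (suc m)) (r′ : ℕ) where
    -- The check is cut into stages that receive their data as arguments, so that evaluation
    -- computes each datum once and shares it.
    checkInverse : Vec (Vec ℤ g) g → Vec (Fin (suc m) × ℤ) (suc n) → Vec (Fin (suc n)) (suc m) → Vec (Vec ℤ g) g → Bool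
    checkInverse X f f′ Y = does (carries? A B X Y f) ∧ does (inverse? A B X Y f f′)

    checkIndices : Vec (Vec ℤ g) g → Vec (Fin (suc m) × ℤ) (suc n) → Vec (Fin (suc n)) (suc m) → Bool
    -- The last `r′` columns of `B` are unit vectors, so the inverse of `X` has as columns the
    -- signed columns of `A` that `X` carries to them. Beyond the rank it is the identity.
    checkIndices X f f′ = checkInverse X f f′ (fill (units g)
      (List.drop (suc m ℕ.∸ r′) (Vec.toList (Vec.map (λ i → scale (proj₂ (lookup f i)) (lookup A i)) f′))))

    checkImages : Vec (Vec ℤ g) g → Vec (Fin (suc m) × ℤ) (suc n) → Bool
    checkImages X f = checkIndices X f (Vec.tabulate (position f))

    checkMatrix : Vec (Vec ℤ g) g → Bool
    checkMatrix X = checkImages X (Vec.map (λ a → locate B (apply X a)) A)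

    checkInverse-sound : ∀ X f f′ Y → checkInverse X f f′ Y ≡ true → Equivalence (mat A) (mat B)
    checkInverse-sound X f f′ Y h = equivalence A B X Y f f′ (does-sound (carries? A B X Y f) (proj₁ (∧-true h)))
      (does-sound (inverse? A B X Y f f′) (proj₂ (∧-true {does (carries? A B X Y f)} h)))

    checkMatrix-sound : ∀ X → checkMatrix X ≡ true → Equivalence (mat A) (mat B)
    checkMatrix-sound X h = indices X (Vec.map (λ a → locate B (apply X a)) A) (Vec.tabulate (position (Vec.map (λ a → locate B (apply X a)) A))) h
      where
      indices : ∀ X f f′ → checkIndices X f f′ ≡ true → Equivalence (mat A) (mat B)
      indices X f f′ h = checkInverse-sound X f f′ (fill (units g)
        (List.drop (suc m ℕ.∸ r′) (Vec.toList (Vec.map (λ i → scale (proj₂ (lookup f i)) (lookup A i)) f′)))) h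

  -- The first `r` unit vectors are columns on the source side, so an equivalence sends them to
  -- signed columns of `B`. These images are all that the code has to list.
  isoMatrix : ∀ {m} → Vec (Vec ℤ g) m → ℕ → ℕ → Vec (Vec ℤ g) g
  isoMatrix B r code = fill (units g) (Vec.toList (Vec.map (λ { (j , η) → scale η (nth zeros (Vec.toList B) j) }) (signed r code)))

  isoCheck : ∀ {n m} → Vec (Vec ℤ g) (suc n) → ℕ → Vec (Vec ℤ g) m → ℕ → ℕ → Bool
  isoCheck {n} {zero}  A r B r′ code = false
  isoCheck {n} {suc m} A r B r′ code = checkMatrix A B r′ (isoMatrix B r code)

  isoCheck-sound : ∀ {n m} (A : Vec (Vec ℤ g) (suc n)) r (B : Vec (Vec ℤ g) m) r′ code →
    isoCheck A r B r′ code ≡ true → Equivalence (mat A) (mat B)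
  isoCheck-sound {n} {suc m} A r B r′ code h = checkMatrix-sound A B r′ (isoMatrix B r code) h

  module _ {n} (A : Vec (Vec ℤ g) (suc n)) (b : Bad) where
    private
      D = cols g (badRep b)

    checkEmbedding : Vec (Fin (suc n) × ℤ) (size′ (badRep b)) → Vec (Vec ℤ g) g → Vec (Vec ℤ g) g → Bool
    checkEmbedding f X Y = does (carries? D A X Y f) ∧ does (embeds? D A X Y f)

    -- The bad matrix ends in unit vectors, so `X` is read off from the places of these. `Y` cannot
    -- be read off in this way and is part of the certificate.
    checkPlaces : Vec (Fin (suc n) × ℤ) (size′ (badRep b)) → Vec (Vec ℤ g) g → Bool
    checkPlaces f Y = checkEmbedding f (fill (Vec.replicate g zeros)
      (List.drop (suc (excess b)) (Vec.toList (Vec.map (λ { (j , η) → scale η (lookup A j) }) f)))) Y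

    checkPlaces-sound : ∀ f Y → checkPlaces f Y ≡ true → Embedding (mat D) (mat A)
    checkPlaces-sound f Y h = finish (fill (Vec.replicate g zeros)
        (List.drop (suc (excess b)) (Vec.toList (Vec.map (λ { (j , η) → scale η (lookup A j) }) f)))) h
      where
      finish : ∀ X → checkEmbedding f X Y ≡ true → Embedding (mat D) (mat A)
      finish X h = embedding D A X Y f (does-sound (carries? D A X Y f) (proj₁ (∧-true h)))
        (does-sound (embeds? D A X Y f) (proj₂ (∧-true {does (carries? D A X Y f)} h)))

    badPlaces : ℕ → Vec (Fin (suc n) × ℤ) (size′ (badRep b))
    badPlaces code = Vec.map (λ { (j , η) → j ℕ/.mod suc n , η }) (signed (size′ (badRep b)) code)

    badCheck : ℕ → ℕ → Bool
    badCheck code ys = checkPlaces (badPlaces code) (fill (Vec.replicate g zeros) (Vec.toList (Vec.map (ternary g) (digits 256 g ys))))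

    badCheck-sound : ∀ code ys → badCheck code ys ≡ true → Embedding (mat D) (mat A)
    badCheck-sound code ys h = checkPlaces-sound (badPlaces code) (fill (Vec.replicate g zeros) (Vec.toList (Vec.map (ternary g) (digits 256 g ys)))) h

  Kills : ∀ {n} → Vec (Vec ℤ g) n → Vec ℤ n → Vec ℤ g → Set
  Kills A c y = (∀ s → parity (lookup (apply A c) s) ≡ 0) × (∀ j → lookup c j ≡ 0ℤ ⊎ parity (dot (lookup y) (lookup (lookup A j))) ≡ 0) ×
    ℤ.∣ dot (lookup y) (lookup (apply A c)) ∣ ℕ.% 4 ≢ 0

  kills? : ∀ {n} (A : Vec (Vec ℤ g) n) c y → Dec (Kills A c y)
  kills? A c y = (Finₚ.all? λ s → parity (lookup (apply A c) s) ℕ.≟ 0) ×-dec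
    ((Finₚ.all? λ j → (lookup c j ℤ.≟ 0ℤ) ⊎-dec (parity (dot (lookup y) (lookup (lookup A j))) ℕ.≟ 0)) ×-dec
      ¬? (ℤ.∣ dot (lookup y) (lookup (apply A c)) ∣ ℕ.% 4 ℕ.≟ 0))

  kills-sound : ∀ {n} (A : Vec (Vec ℤ g) n) c y → Kills A c y → ¬ Liftable (mat A)
  kills-sound A c y (even , supp , odd) lift = odd (ℕ∣.n∣m⇒m%n≡0 ℤ.∣ dot (lookup y) (lookup (apply A c)) ∣ 4 (∣⇒∣ᵤ
      (subst (pos 4 ∣_) (sum-cong λ r → cong (lookup y r *_) (sym (lookup-apply A c r)))
        (camion (mat A) lift (lookup c) (lookup y) (λ s → subst (pos 2 ∣_) (lookup-apply A c s) (halved (lookup (apply A c) s) (even s)))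
          λ j → [ inj₁ , (λ e → inj₂ (halved (dot (lookup y) (lookup (lookup A j))) e)) ]′ (supp j)))))
    where
    halved : ∀ x → parity x ≡ 0 → pos 2 ∣ x
    halved x e = divides (proj₁ (halve x)) (trans (proj₂ (halve x)) (trans (cong (λ p → pos p + proj₁ (halve x) * pos 2) e) (ℤₚ.+-identityˡ (proj₁ (halve x) * pos 2))))

  module _ (R : Rep) (C : Vec (Vec ℤ g) (size′ R)) (v : Vec ℤ g) where
    -- Only `y` and the part `J` of the relation outside the identity are encoded. A unit column is
    -- even against the 0/1 vector `y` just if `y` is 0 there, and then its coefficient is chosen to
    -- cancel its row. In the rows where `y` is 1 no unit column is used, and evenness is left to
    -- the check.
    relation : Vec ℤ g → Vec ℤ (corank R) → Vec ℤ (suc (size′ R))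
    relation y J = 1ℤ ∷ (J Vec.++ fill (Vec.replicate (rank R) 0ℤ)
      (Vec.toList (Vec.zipWith (λ { (pos 0) s → - s ; _ s → 0ℤ }) y (axpy 1ℤ v (apply (bodyCols g R) J)))))

    checkKill : Vec ℤ (suc (size′ R)) → Vec ℤ g → Bool
    checkKill c y = does (kills? (v ∷ C) c y)

    killWith : Vec ℤ g → Vec ℤ (corank R) → Bool
    killWith y J = checkKill (relation y J) y

    killCheck : ℕ → Bool
    killCheck code = killWith (binary g (code ℕ.% 32)) (binary (corank R) (code ℕ./ 32))

    killCheck-sound : ∀ code → killCheck code ≡ true → ¬ Liftable (mat (v ∷ C))
    killCheck-sound code h = finish (binary g (code ℕ.% 32)) (binary (corank R) (code ℕ./ 32)) h
      where
      finish : ∀ y J → killWith y J ≡ true → ¬ Liftable (mat (v ∷ C))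
      finish y J h = kills-sound (v ∷ C) (relation y J) y (does-sound (kills? (v ∷ C) (relation y J) y) h)

  parallel? : ∀ {n} (C : Vec (Vec ℤ g) n) v → Dec (∃ λ j → v ≡ lookup C j ⊎ v ≡ scale -[1+ 0 ] (lookup C j))
  parallel? C v = Finₚ.any? λ j → (v ≟ᵛ lookup C j) ⊎-dec (v ≟ᵛ scale -[1+ 0 ] (lookup C j))

  parallel-sound : ∀ {n} (C : Vec (Vec ℤ g) n) v → (∃ λ j → v ≡ lookup C j ⊎ v ≡ scale -[1+ 0 ] (lookup C j)) → ¬ Reduced (mat (v ∷ C))
  parallel-sound C v (j , inj₁ e) (_ , np) = np zero (suc j) 1ℤ (λ ()) λ r → trans (cong (λ u → lookup u r) e) (sym (ℤₚ.*-identityˡ (lookup (lookup C j) r)))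
  parallel-sound C v (j , inj₂ e) (_ , np) = np zero (suc j) -[1+ 0 ] (λ ()) λ r → trans (cong (λ u → lookup u r) e) (Vecₚ.lookup-map r (-[1+ 0 ] *_) (lookup C j))

  index : ∀ n → ℕ → Maybe (Fin n)
  index zero    k       = nothing
  index (suc n) zero    = just zero
  index (suc n) (suc k) = Data.Maybe.map suc (index n k)

  toRep : ∀ {n} → Vec (Vec ℤ g) (suc n) → ℕ → ℕ → Maybe (Fin N) → Bool
  toRep A r code nothing  = false
  toRep A r code (just l) = isoCheck A r (proj₂ (lookup table l)) (lookup ranks l) code

  toBad : ∀ {n} → Vec (Vec ℤ g) (suc n) → ℕ → ℕ → Maybe (Fin M) → Bool
  toBad A code ys nothing  = false
  toBad A code ys (just b) = badCheck A (lookup bads b) code ys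

  leafCheck : (R : Rep) → Vec (Vec ℤ g) (size′ R) → ℕ → Vec ℤ g → Tree → Bool
  leafCheck R C r v par             = does (parallel? C v)
  leafCheck R C r v (kill code)     = killCheck R C v code
  leafCheck R C r v (iso l code)    = toRep (v ∷ C) r code (index N l)
  leafCheck R C r v (bad b code ys) = toBad (v ∷ C) code ys (index M b)
  leafCheck R C r v (node _ _ _)    = false

  Outcome : ∀ {n} → Mat g n → Set
  Outcome A = (∃ λ l → Equivalence A (mat (proj₂ (lookup table l)))) ⊎ ¬ Good A

  leafCheck-sound : (∀ b → ¬ Cographic (mat (cols g (badRep (lookup bads b))))) →
    ∀ R C r v t → leafCheck R C r v t ≡ true → Outcome (mat (v ∷ C))
  leafCheck-sound nc R C r v par h = inj₂ λ good → parallel-sound C v (does-sound (parallel? C v) h) (proj₁ (proj₂ good))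
  leafCheck-sound nc R C r v (kill code) h = inj₂ λ good → killCheck-sound R C v code h (proj₁ good)
  leafCheck-sound nc R C r v (iso l code) h = go (index N l) h
    where
    go : ∀ k → toRep (v ∷ C) r code k ≡ true → Outcome (mat (v ∷ C))
    go (just l) h = inj₁ (l , isoCheck-sound (v ∷ C) r (proj₂ (lookup table l)) (lookup ranks l) code h)
  leafCheck-sound nc R C r v (bad b code ys) h = go (index M b) h
    where
    go : ∀ k → toBad (v ∷ C) code ys k ≡ true → Outcome (mat (v ∷ C))
    go (just b) h = inj₂ λ good → nc b (embedding-cographic (badCheck-sound (v ∷ C) (lookup bads b) code ys h) (proj₂ (proj₂ good)))

-- Enumeration of the candidate columns

-- Of the `d` entries still to be read the first `r` are free and the others 0, so one tree serves
-- every ambient dimension. The flag `s` records that a nonzero entry has occurred; before that -1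
-- is not tried, vectors being taken up to sign. A `kill` at an inner node is tried on all vectors
-- below it.
treeCheck : ∀ {g} → (Vec ℤ g → Tree → Bool) → ∀ d → ℕ → (Vec ℤ d → Vec ℤ g) → Bool → Tree → Bool
branch : ∀ {g} → (Vec ℤ g → Tree → Bool) → ∀ d → ℕ → (Vec ℤ (suc d) → Vec ℤ g) → Bool → Tree → Tree → Tree → Bool

treeCheck leaf zero    r       v s     (node _ _ _) = false
treeCheck leaf zero    r       v false t            = true
treeCheck leaf zero    r       v true  t            = leaf (v []) t
treeCheck leaf (suc d) zero    v s     t            = treeCheck leaf d zero (v ∘ (0ℤ ∷_)) s t
treeCheck leaf (suc d) (suc r) v s     (node a b c) = branch leaf d r v s a b c
treeCheck leaf (suc d) (suc r) v s     (kill k)     = branch leaf d r v s (kill k) (kill k) (kill k)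
treeCheck leaf (suc d) (suc r) v s     t            = false

branch leaf d r v s a b c = treeCheck leaf d r (v ∘ (0ℤ ∷_)) s a ∧ (treeCheck leaf d r (v ∘ (1ℤ ∷_)) true b ∧
  (if s then treeCheck leaf d r (v ∘ (-[1+ 0 ] ∷_)) true c else true))

Canonical : ∀ {d} → Bool → Vec ℤ d → Set
Canonical true  w       = ⊤
Canonical false []      = ⊤
Canonical false (x ∷ w) = (x ≡ 0ℤ × Canonical false w) ⊎ x ≡ 1ℤ

-- The second alternative is the zero vector, which no leaf treats. As a column it would be a loop,
-- and `Reduced` excludes it.
Reached : ∀ {g d} → (Vec ℤ g → Tree → Bool) → (Vec ℤ d → Vec ℤ g) → Bool → Vec ℤ d → Set
Reached leaf v s w = (∃ λ t → leaf (v w) t ≡ true) ⊎ (s ≡ false × (∀ i → lookup w i ≡ 0ℤ))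

treeCheck-sound : ∀ {g} (leaf : Vec ℤ g → Tree → Bool) d r v s t → treeCheck leaf d r v s t ≡ true →
  ∀ w → (∀ i → Sgn (lookup w i)) → (∀ i → r ℕ.≤ toℕ i → lookup w i ≡ 0ℤ) → Canonical s w → Reached leaf v s w
branch-sound : ∀ {g} (leaf : Vec ℤ g → Tree → Bool) d r v s a b c → branch leaf d r v s a b c ≡ true →
  ∀ w → (∀ i → Sgn (lookup w i)) → (∀ i → suc r ℕ.≤ toℕ i → lookup w i ≡ 0ℤ) → Canonical s w → Reached leaf v s w

treeCheck-sound leaf zero r v false par h [] sg z can = inj₂ (refl , λ ())
treeCheck-sound leaf zero r v false (kill x) h [] sg z can = inj₂ (refl , λ ())
treeCheck-sound leaf zero r v false (iso x y) h [] sg z can = inj₂ (refl , λ ())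
treeCheck-sound leaf zero r v false (bad x y ys) h [] sg z can = inj₂ (refl , λ ())
treeCheck-sound leaf zero r v true par h [] sg z can = inj₁ (par , h)
treeCheck-sound leaf zero r v true (kill x) h [] sg z can = inj₁ (kill x , h)
treeCheck-sound leaf zero r v true (iso x y) h [] sg z can = inj₁ (iso x y , h)
treeCheck-sound leaf zero r v true (bad x y ys) h [] sg z can = inj₁ (bad x y ys , h)
treeCheck-sound leaf (suc d) zero v s t h (x ∷ w) sg z can = go (z zero z≤n) can
  where
  tail-can : ∀ s → Canonical s (0ℤ ∷ w) → Canonical s w
  tail-can true  _ = tt
  tail-can false (inj₁ (_ , c)) = c
  go : x ≡ 0ℤ → Canonical s (x ∷ w) → Reached leaf v s (x ∷ w)
  go refl c = [ inj₁ , (λ { (s≡ , zs) → inj₂ (s≡ , λ { zero → refl ; (suc i) → zs i }) }) ]′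
    (treeCheck-sound leaf d zero (v ∘ (0ℤ ∷_)) s t h w (sg ∘ suc) (λ i _ → z (suc i) z≤n) (tail-can s c))
treeCheck-sound leaf (suc d) (suc r) v s (node a b c) h = branch-sound leaf d r v s a b c h
treeCheck-sound leaf (suc d) (suc r) v s (kill k) h = branch-sound leaf d r v s (kill k) (kill k) (kill k) h

branch-sound leaf d r v s a b c h (x ∷ w) sg z can = go (∧-true h) (sg zero) can
  where
  below : ∀ i → r ℕ.≤ toℕ i → lookup w i ≡ 0ℤ
  below i le = z (suc i) (s≤s le)
  tail-can : ∀ s → Canonical s (0ℤ ∷ w) → Canonical s w
  tail-can true  _ = tt
  tail-can false (inj₁ (_ , c)) = c
  started : ∀ {v′ : Vec ℤ d → Vec ℤ _} → Reached leaf v′ true w → ∃ λ t → leaf (v′ w) t ≡ true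
  started (inj₁ p) = p
  negative : ∀ s → Canonical s (-[1+ 0 ] ∷ w) → (if s then treeCheck leaf d r (v ∘ (-[1+ 0 ] ∷_)) true c else true) ≡ true → Reached leaf v s (-[1+ 0 ] ∷ w)
  negative true  _ e = inj₁ (started {v ∘ (-[1+ 0 ] ∷_)} (treeCheck-sound leaf d r (v ∘ (-[1+ 0 ] ∷_)) true c e w (sg ∘ suc) below tt))
  negative false (inj₁ (() , _)) e
  negative false (inj₂ ()) e
  go : treeCheck leaf d r (v ∘ (0ℤ ∷_)) s a ≡ true × (treeCheck leaf d r (v ∘ (1ℤ ∷_)) true b ∧
    (if s then treeCheck leaf d r (v ∘ (-[1+ 0 ] ∷_)) true c else true)) ≡ true → Sgn x → Canonical s (x ∷ w) → Reached leaf v s (x ∷ w)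
  go (e , _) (inj₁ refl) can = [ inj₁ , (λ { (s≡ , zs) → inj₂ (s≡ , λ { zero → refl ; (suc i) → zs i }) }) ]′
    (treeCheck-sound leaf d r (v ∘ (0ℤ ∷_)) s a e w (sg ∘ suc) below (tail-can s can))
  go (_ , e) (inj₂ (inj₁ refl)) can = inj₁ (started {v ∘ (1ℤ ∷_)} (treeCheck-sound leaf d r (v ∘ (1ℤ ∷_)) true b (proj₁ (∧-true e)) w (sg ∘ suc) below tt))
  go (_ , e) (inj₂ (inj₂ refl)) can = negative s can (proj₂ (∧-true {treeCheck leaf d r (v ∘ (1ℤ ∷_)) true b} e))

canonical : ∀ {d} (w : Vec ℤ d) → (∀ i → Sgn (lookup w i)) → Canonical false w ⊎ Canonical false (scale -[1+ 0 ] w)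
canonical []      sg = inj₁ tt
canonical (x ∷ w) sg with sg zero
... | inj₁ refl        = [ (λ c → inj₁ (inj₁ (refl , c))) , (λ c → inj₂ (inj₁ (refl , c))) ]′ (canonical w (sg ∘ suc))
... | inj₂ (inj₁ refl) = inj₁ (inj₂ refl)
... | inj₂ (inj₂ refl) = inj₂ (inj₂ refl)


-- Completeness of the catalogue

module Completeness {g N M : ℕ} (reps : Vec Rep N) (bads : Vec Bad M) where

  columns : Rep → ∃ λ n → Vec (Vec ℤ g) n
  columns R = size′ R , cols g R

  catalogue : Vec (∃ λ n → Vec (Vec ℤ g) n) N
  catalogue = Vec.map columns reps

  open Certificates catalogue (Vec.map rank reps) bads public

  spanCheck : ∀ R → Vec (Vec ℤ g) (size′ R) → Bool
  spanCheck R C = treeCheck (leafCheck R C (rank R)) g (rank R) id false (tree R)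

  coloopCheck : ∀ R → Vec (Vec ℤ g) (size′ R) → Bool
  -- At full rank no index equals the rank, so the condition is vacuous: there is no room for a
  -- coloop.
  coloopCheck R C = does (Finₚ.all? λ s → ¬? (toℕ s ℕ.≟ rank R) ⊎-dec (leafCheck R C (suc (rank R)) (lookup (units g) s) (extra R) Boolₚ.≟ true))

  stepCheck : Rep → Bool
  stepCheck R = spanCheck R (cols g R) ∧ coloopCheck R (cols g R)

  module _ (steps : ∀ k → stepCheck (lookup reps k) ≡ true)
    (frames : ∀ k → Frame (mat (cols g (lookup reps k))) (rank (lookup reps k)))
    (nc : ∀ b → ¬ Cographic (mat (cols g (badRep (lookup bads b)))))
    (empty : ∃ λ k → size′ (lookup reps k) ≡ 0) where
    private
      Classified : ∀ {n} → Mat g n → Set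
      Classified A = ∃ λ k → Equivalence A (mat (cols g (lookup reps k)))

    conclude : ∀ {n m} {A : Mat g n} {B : Mat g m} → Good A → Equivalence A B → Outcome B → Classified A
    conclude {A = A} good E (inj₁ (l , F)) = l , subst (λ (p : ∃ λ n → Vec (Vec ℤ g) n) → Equivalence A (mat (proj₂ p)))
      (Vecₚ.lookup-map l columns reps) (equivalence-trans E F)
    conclude good E (inj₂ ¬good)   = contradiction (embedding-good (equivalence⇒embedding (equivalence-sym E)) good) ¬good

    equivalence-vec : ∀ {n} (w : Row g) (V : Vec ℤ g) (C : Vec (Vec ℤ g) n) η → η * η ≡ 1ℤ → (∀ r → w r ≡ η * lookup V r) →
      Equivalence (w ∷ᶜ mat C) (mat (V ∷ C))
    equivalence-vec w V C η u h = record { π = Perm.id ; ε = η ◂ const 1ℤ ; unit = λ { zero → u ; (suc i) → refl } ; X = idℤ ; Y = idℤ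
      ; XY = λ c r → trans (id∙ (idℤ ∙ c) r) (id∙ c r) ; YX = λ c r → trans (id∙ (idℤ ∙ c) r) (id∙ c r)
      ; to = λ { zero r → trans (id∙ w r) (h r) ; (suc i) r → trans (id∙ (lookup (lookup C i)) r) (sym (ℤₚ.*-identityˡ (lookup (lookup C i) r))) } }

    module _ {n} (A : Mat g (suc n)) (good : Good A) (k : Fin N) (E : Equivalence (tailCols A) (mat (cols g (lookup reps k)))) where
      private
        R : Rep
        R = lookup reps k
        C : Vec (Vec ℤ g) (size′ R)
        C = cols g R
        v : Row g
        v = Equivalence.X E ∙ col A zero
        A≃v : Equivalence A (v ∷ᶜ mat C)
        A≃v = equivalence-head (equivalence-cons E (col A zero) v 1ℤ refl λ r → sym (ℤₚ.*-identityˡ (v r)))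
        lift : Liftable (v ∷ᶜ mat C)
        lift = embedding-liftable (equivalence⇒embedding (equivalence-sym A≃v)) (proj₁ good)
        spanOK : spanCheck R C ≡ true
        spanOK = proj₁ (∧-true (steps k))
        coloopOK : coloopCheck R C ≡ true
        coloopOK = proj₂ (∧-true {spanCheck R C} (steps k))

      extend-span : ∀ (w : Row g) → Equivalence A (w ∷ᶜ mat C) → (V : Vec ℤ g) → ∀ η → η * η ≡ 1ℤ → (∀ r → w r ≡ η * lookup V r) →
        (∀ s → Sgn (lookup V s)) → (∀ s → rank R ℕ.≤ toℕ s → lookup V s ≡ 0ℤ) → Canonical false V → Classified A
      extend-span w F V η u h sg z can = go (treeCheck-sound (leafCheck R C (rank R)) g (rank R) id false (tree R) spanOK V sg z can)
        where
        A≃V : Equivalence A (mat (V ∷ C))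
        A≃V = equivalence-trans F (equivalence-vec w V C η u h)
        go : Reached (leafCheck R C (rank R)) id false V → Classified A
        go (inj₁ (t , ok))  = conclude good A≃V (leafCheck-sound nc R C (rank R) V t ok)
        go (inj₂ (_ , zs)) = contradiction zs (proj₁ (embedding-reduced (equivalence⇒embedding (equivalence-sym A≃V)) (proj₁ (proj₂ good))) zero)

      extend : NormalForm (mat C) (rank R) v → Classified A
      extend (coloop s₀ s₀≡r F) = conclude good
        (equivalence-trans A≃v (equivalence-trans F (equivalence-vec (idℤ s₀) (lookup (units g) s₀) C 1ℤ refl
          λ r → trans (idℤ-sym s₀ r) (trans (sym (lookup-units s₀ r)) (sym (ℤₚ.*-identityˡ (lookup (lookup (units g) s₀) r)))))))
        (leafCheck-sound nc R C (suc (rank R)) (lookup (units g) s₀) (extra R)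
          ([ (λ ne → contradiction s₀≡r ne) , id ]′ (does-sound (Finₚ.all? λ s → ¬? (toℕ s ℕ.≟ rank R) ⊎-dec (leafCheck R C (suc (rank R)) (lookup (units g) s) (extra R) Boolₚ.≟ true)) coloopOK s₀)))
      extend (inSpan w sg z F) = go (canonical W λ s → subst Sgn (sym (W-at s)) (sg s))
        where
        W : Vec ℤ g
        W = Vec.tabulate w
        W-at : ∀ s → lookup W s ≡ w s
        W-at = Vecₚ.lookup∘tabulate w
        V-at : ∀ s → lookup (scale -[1+ 0 ] W) s ≡ -[1+ 0 ] * w s
        V-at s = trans (Vecₚ.lookup-map s (-[1+ 0 ] *_) W) (cong (-[1+ 0 ] *_) (W-at s))
        ring : ∀ x → x ≡ -[1+ 0 ] * (-[1+ 0 ] * x)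
        ring x = sym (unit-cancel -[1+ 0 ] refl x)
        go : Canonical false W ⊎ Canonical false (scale -[1+ 0 ] W) → Classified A
        go (inj₁ can) = extend-span w (equivalence-trans A≃v F) W 1ℤ refl (λ r → trans (sym (W-at r)) (sym (ℤₚ.*-identityˡ (lookup W r))))
          (λ s → subst Sgn (sym (W-at s)) (sg s)) (λ s h → trans (W-at s) (z s h)) can
        go (inj₂ can) = extend-span w (equivalence-trans A≃v F) (scale -[1+ 0 ] W) -[1+ 0 ] refl
          (λ r → trans (ring (w r)) (cong (-[1+ 0 ] *_) (sym (V-at r))))
          (λ s → subst Sgn (sym (V-at s)) (sgn-* (inj₂ (inj₂ refl)) (sg s))) (λ s h → trans (V-at s) (cong (-[1+ 0 ] *_) (z s h))) can

      extended : Classified A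
      extended = extend (normalForm (frames k) v lift)

    complete : ∀ n (A : Mat g n) → Good A → Classified A
    complete zero    A good = proj₁ empty , none (cols g (lookup reps (proj₁ empty))) (proj₂ empty)
      where
      none : ∀ {m} (B : Vec (Vec ℤ g) m) → m ≡ 0 → Equivalence A (mat B)
      none B refl = record { π = Perm.id ; ε = λ () ; unit = λ () ; X = idℤ ; Y = idℤ
        ; XY = λ c r → trans (id∙ (idℤ ∙ c) r) (id∙ c r) ; YX = λ c r → trans (id∙ (idℤ ∙ c) r) (id∙ c r) ; to = λ () }
    complete (suc n) A good = let (k , E) = complete n (tailCols A) (embedding-good (embedding-tail A) good) in extended A good k E

-- The representatives are network matrices of rooted trees: column j is the edge from vertex j + 1 to its parent, and
-- row i is the path between the i-th pair of vertices.
module NetworkCheck {g n : ℕ} (C : Vec (Vec ℤ g) n) (up : Vec (Fin (suc n)) n) (ends : Vec (Fin (suc n) × Fin (suc n)) g) where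

  -- 1 if edge j lies on the path from vertex x to the root
  above : ℕ → Fin n → Fin (suc n) → ℤ
  above zero       j x       = 0ℤ
  above (suc fuel) j zero    = 0ℤ
  above (suc fuel) j (suc k) = if does (k ≟ j) then 1ℤ else above fuel j (lookup up k)

  -- The condition on all potentials is linear, so it is checked on the indicators of vertices,
  -- where it says that the chain of edges in row `i` has the right boundary. The second half
  -- confirms that `above` gives dual potentials, hence that the parents do form a tree.
  Valid : Set
  Valid = (∀ i x → idℤ (proj₁ (lookup ends i)) x - idℤ (proj₂ (lookup ends i)) x ≡
      sumℤ (λ j → (idℤ (suc j) x - idℤ (lookup up j) x) * mat C i j)) ×
    (∀ j k → above n j (suc k) - above n j (lookup up k) ≡ idℤ k j)

  valid? : Dec Valid
  valid? = (Finₚ.all? λ i → Finₚ.all? λ x → (idℤ (proj₁ (lookup ends i)) x - idℤ (proj₂ (lookup ends i)) x) ℤ.≟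
      sumℤ (λ j → (idℤ (suc j) x - idℤ (lookup up j) x) * mat C i j))
    ×-dec (Finₚ.all? λ j → Finₚ.all? λ k → (above n j (suc k) - above n j (lookup up k)) ℤ.≟ idℤ k j)

  network : Valid → Network (mat C) (const true)
  network (path , dual) = record
    { ρ = λ i → proj₂ (lookup ends i) , proj₁ (lookup ends i) ; κ = λ j → lookup up j , suc j
    ; path = λ p i → trans (sym (boundary p (proj₁ (lookup ends i)) (proj₂ (lookup ends i)))) (trans (sum-cong λ x → cong (p x *_) (path i x)) (spread p i))
    ; idle = λ j () ; dual = λ j _ → above n j , λ k _ → dual j k }
    where
    ring : ∀ p a b → p * (a - b) ≡ p * a - p * b
    ring = solve-∀
    boundary : ∀ (p : Fin (suc n) → ℤ) a b → sumℤ (λ x → p x * (idℤ a x - idℤ b x)) ≡ p a - p b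
    boundary p a b = trans (sum-cong λ x → ring (p x) (idℤ a x) (idℤ b x)) (trans (sum-minus (λ x → p x * idℤ a x) (λ x → p x * idℤ b x))
      (cong₂ _-_ (value a) (value b)))
      where
      value : ∀ a → sumℤ (λ x → p x * idℤ a x) ≡ p a
      value a = trans (sum-cong λ x → cong (p x *_) (idℤ-sym a x)) (sum-idʳ a p)
    spread : ∀ (p : Fin (suc n) → ℤ) i → sumℤ (λ x → p x * sumℤ (λ j → (idℤ (suc j) x - idℤ (lookup up j) x) * mat C i j)) ≡
      sumℤ (λ j → (p (suc j) - p (lookup up j)) * mat C i j)
    spread p i = begin
      sumℤ (λ x → p x * sumℤ (λ j → (idℤ (suc j) x - idℤ (lookup up j) x) * mat C i j))
        ≡⟨ sum-cong (λ x → sym (sum-*ˡ (p x) (λ j → (idℤ (suc j) x - idℤ (lookup up j) x) * mat C i j))) ⟩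
      sumℤ (λ x → sumℤ (λ j → p x * ((idℤ (suc j) x - idℤ (lookup up j) x) * mat C i j)))
        ≡⟨ sum-swap (λ x j → p x * ((idℤ (suc j) x - idℤ (lookup up j) x) * mat C i j)) ⟩
      sumℤ (λ j → sumℤ (λ x → p x * ((idℤ (suc j) x - idℤ (lookup up j) x) * mat C i j)))
        ≡⟨ sum-cong (λ j → trans (sum-cong λ x → sym (ℤₚ.*-assoc (p x) (idℤ (suc j) x - idℤ (lookup up j) x) (mat C i j)))
             (trans (sum-*ʳ (mat C i j) (λ x → p x * (idℤ (suc j) x - idℤ (lookup up j) x))) (cong (_* mat C i j) (boundary p (suc j) (lookup up j))))) ⟩
      sumℤ (λ j → (p (suc j) - p (lookup up j)) * mat C i j) ∎
      where open ≡-Reasoning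

-- Checking the representatives

couples : ∀ b .{{_ : ℕ.NonZero b}} n → ℕ → Vec (ℕ × ℕ) n
couples b zero    c = []
couples b (suc n) c = (c ℕ.% b , c ℕ./ b ℕ.% b) ∷ couples b n (c ℕ./ b ℕ./ b)

module RepCheck (g : ℕ) (R : Rep) where
  private
    n = size′ R

  networkDec : (C : Vec (Vec ℤ g) n) → Dec _
  networkDec C = NetworkCheck.valid? C (Vec.map (ℕ/._mod suc n) (digits 16 n (parents R)))
    (Vec.map (λ { (a , b) → a ℕ/.mod suc n , b ℕ/.mod suc n }) (couples 16 g (pairs R)))

  functionals : Vec (Vec ℤ g × Vec ℤ g) n
  functionals = Vec.map (λ { (a , b) → ternary g a , ternary g b }) (couples 256 n (duals R))

  IsDual : Vec (Vec ℤ g) n → Vec (Vec ℤ g × Vec ℤ g) n → Set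
  IsDual C F = ∀ i j → dot (lookup (proj₁ (lookup F j))) (lookup (lookup C i)) * dot (lookup (proj₂ (lookup F j))) (lookup (lookup C i)) ≡ idℤ i j

  isDual? : ∀ C F → Dec (IsDual C F)
  isDual? C F = Finₚ.all? λ i → Finₚ.all? λ j →
    (dot (lookup (proj₁ (lookup F j))) (lookup (lookup C i)) * dot (lookup (proj₂ (lookup F j))) (lookup (lookup C i))) ℤ.≟ idℤ i j

  kindOf : (C : Vec (Vec ℤ g) n) → ∀ j → Dec (∃ λ t → lookup C j ≡ lookup (units g) t)
  kindOf C j = Finₚ.any? λ t → lookup C j ≟ᵛ lookup (units g) t

  kinds : Vec (Vec ℤ g) n → Vec (Maybe (Fin g)) n
  kinds C = Vec.tabulate λ j → decided (kindOf C j)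
    where
    decided : ∀ {j} → Dec (∃ λ t → lookup C j ≡ lookup (units g) t) → Maybe (Fin g)
    decided (yes (t , _)) = just t
    decided (no _)        = nothing

  kinds-unit : ∀ C j t → lookup (kinds C) j ≡ just t → ∀ s → mat C s j ≡ idℤ s t
  kinds-unit C j t h s with kindOf C j | trans (sym (Vecₚ.lookup∘tabulate _ j)) h
  ... | yes (t , e) | refl = trans (cong (λ u → lookup u s) e) (lookup-units t s)

  unitEntry : Maybe (Fin g) → Fin g → ℤ
  unitEntry k t = Data.Maybe.maybe′ (λ t′ → idℤ t′ t) 0ℤ k

  IsFrame : Vec (Vec ℤ g) n → Vec (Maybe (Fin g)) n → Set
  IsFrame C K = (∀ t → rank R ℕ.≤ toℕ t ⊎ (∀ s → sumℤ (λ j → unitEntry (lookup K j) t * mat C s j) ≡ idℤ t s)) ×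
    (∀ s → toℕ s ℕ.< rank R ⊎ (∀ j → mat C s j ≡ 0ℤ))

  isFrame? : ∀ C K → Dec (IsFrame C K)
  isFrame? C K = (Finₚ.all? λ t → (rank R ℕ.≤? toℕ t) ⊎-dec (Finₚ.all? λ s → sumℤ (λ j → unitEntry (lookup K j) t * mat C s j) ℤ.≟ idℤ t s)) ×-dec
    (Finₚ.all? λ s → (toℕ s ℕ.<? rank R) ⊎-dec (Finₚ.all? λ j → mat C s j ℤ.≟ 0ℤ))

  checks : Vec (Vec ℤ g) n → Bool
  checks C = does (networkDec C) ∧ (does (isDual? C functionals) ∧ does (isFrame? C (kinds C)))

  repCheck : Bool
  repCheck = checks (cols g R)

  module _ (ok : repCheck ≡ true) where
    private
      C = cols g R
      okₙ : does (networkDec C) ≡ true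
      okₙ = proj₁ (∧-true ok)
      ok′ : does (isDual? C functionals) ∧ does (isFrame? C (kinds C)) ≡ true
      ok′ = proj₂ (∧-true {does (networkDec C)} ok)

    rep-network : Network (mat C) (const true)
    rep-network = NetworkCheck.network C (Vec.map (ℕ/._mod suc n) (digits 16 n (parents R)))
      (Vec.map (λ { (a , b) → a ℕ/.mod suc n , b ℕ/.mod suc n }) (couples 16 g (pairs R))) (does-sound (networkDec C) okₙ)

    rep-dual : Dual (mat C)
    rep-dual = record { x = λ j → lookup (proj₁ (lookup functionals j)) ; y = λ j → lookup (proj₂ (lookup functionals j))
      ; dual = does-sound (isDual? C functionals) (proj₁ (∧-true ok′)) }

    rep-frame : Frame (mat C) (rank R)
    rep-frame = record { kind = lookup (kinds C) ; is-unit = kinds-unit C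
      ; spans = λ t lt → [ (λ le → contradiction lt (ℕₚ.≤⇒≯ le)) , id ]′ (proj₁ frame t)
      ; beyond = λ s le → [ (λ lt → contradiction lt (ℕₚ.≤⇒≯ le)) , id ]′ (proj₂ frame s) }
      where
      frame : IsFrame C (kinds C)
      frame = does-sound (isFrame? C (kinds C)) (proj₂ (∧-true {does (isDual? C functionals)} ok′))

    admissible : Admissible g
    admissible = adm n (mat C) (network-tu (mat C) (const true) rep-network) (dual⇒simple rep-dual) (network-cographic (mat C) rep-network)


-- Checking the obstructions

everySubset : ∀ n → (Vec Bool n → Bool) → Bool
everySubset zero    P = P []
everySubset (suc n) P = everySubset n (P ∘ (false ∷_)) ∧ everySubset n (P ∘ (true ∷_))

everySubset-sound : ∀ n P → everySubset n P ≡ true → ∀ S → P S ≡ true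
everySubset-sound zero    P h []          = h
everySubset-sound (suc n) P h (false ∷ S) = everySubset-sound n (P ∘ (false ∷_)) (proj₁ (∧-true h)) S
everySubset-sound (suc n) P h (true  ∷ S) = everySubset-sound n (P ∘ (true ∷_)) (proj₂ (∧-true {everySubset n (P ∘ (false ∷_))} h)) S

module Isolation {g n q : ℕ} (C : Vec (Vec ℤ g) n) (Y : Vec (Vec ℤ g) q) where
  values : Vec (Vec ℤ n) q
  values = Vec.map (λ y → Vec.map (λ a → dot (lookup y) (lookup a)) C) Y

  values-at : ∀ k j → lookup (lookup values k) j ≡ dot (lookup (lookup Y k)) (col (mat C) j)
  values-at k j = trans (cong (λ v → lookup v j) (Vecₚ.lookup-map k (λ y → Vec.map (λ a → dot (lookup y) (lookup a)) C) Y))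
    (Vecₚ.lookup-map j (λ a → dot (lookup (lookup Y k)) (lookup a)) C)

  -- A set is independent exactly if each of its elements can be separated from the rest of the set
  -- by a vector of the row space. `Y` supplies row vectors for this.
  Isolated : Vec (Vec ℤ n) q → Vec Bool n → Set
  Isolated D S = ∀ i → lookup S i ≡ false ⊎ (∃ λ k → lookup (lookup D k) i ≢ 0ℤ ×
    (∀ j → j ≡ i ⊎ lookup S j ≡ false ⊎ lookup (lookup D k) j ≡ 0ℤ))

  isolated? : ∀ D S → Dec (Isolated D S)
  isolated? D S = Finₚ.all? λ i → (lookup S i Boolₚ.≟ false) ⊎-dec (Finₚ.any? λ k → ¬? (lookup (lookup D k) i ℤ.≟ 0ℤ) ×-dec
    (Finₚ.all? λ j → (j ≟ i) ⊎-dec ((lookup S j Boolₚ.≟ false) ⊎-dec (lookup (lookup D k) j ℤ.≟ 0ℤ))))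

  isolated⇒indep : ∀ S → Isolated values S → Indep (mat C) (lookup S)
  isolated⇒indep S sep c supp h i = [ supp i , found ]′ (sep i)
    where
    found : (∃ λ k → lookup (lookup values k) i ≢ 0ℤ × (∀ j → j ≡ i ⊎ lookup S j ≡ false ⊎ lookup (lookup values k) j ≡ 0ℤ)) → c i ≡ 0ℤ
    found (k , ne , others) = isolate (mat C) (lookup (lookup Y k)) i c h (λ e → ne (trans (values-at k i) e)) λ j j≢i →
      [ (λ e → contradiction e j≢i) , [ (λ e → cong (_* dot (lookup (lookup Y k)) (col (mat C) j)) (supp j e)) ,
        (λ e → trans (cong (c j *_) (trans (sym (values-at k j)) e)) (ℤₚ.*-zeroʳ (c j))) ]′ ]′ (others j)

module BadCheck (g : ℕ) (b : Bad) where
  private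
    n = size′ (badRep b)
    C : Vec (Vec ℤ g) n
    C = cols g (badRep b)
    Y : Vec (Vec ℤ g) (count b)
    Y = Vec.map (ternary g) (digits 256 (count b) (rows b))
    e : Fin (suc (excess b)) → Fin n
    e i = i ↑ˡ badRank b
    basisSet : Vec Bool n
    basisSet = Vec.replicate (suc (excess b)) false Vec.++ Vec.replicate (badRank b) true
    w : Vec ℕ n
    w = digits 2 n (weights b)
    -- The fundamental circuit of the column `e i` over the identity columns, which form the basis.
    circuit : Fin (suc (excess b)) → Vec ℤ n
    circuit i = Vec.tabulate (λ j → idℤ i j) Vec.++ fill (Vec.replicate (badRank b) 0ℤ) (Vec.toList (scale -[1+ 0 ] (lookup C (e i))))
  open Isolation C Y

  Circuit : ∀ i → Vec ℤ n → Set
  Circuit i c = lookup c (e i) ≢ 0ℤ × apply C c ≡ zeros × (∀ j → insert (lookup basisSet) (e i) j ≡ true ⊎ lookup c j ≡ 0ℤ)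

  circuit? : ∀ i c → Dec (Circuit i c)
  circuit? i c = ¬? (lookup c (e i) ℤ.≟ 0ℤ) ×-dec ((apply C c ≟ᵛ zeros) ×-dec
    (Finₚ.all? λ j → (insert (lookup basisSet) (e i) j Boolₚ.≟ true) ⊎-dec (lookup c j ℤ.≟ 0ℤ)))

  -- Only subsets lighter than `girth` have to be certified independent, which is why a short list
  -- of row vectors can do.
  heavyOrIsolated? : ∀ D S → Dec (girth b ℕ.≤ weight (lookup w) (lookup S) ⊎ Isolated D S)
  heavyOrIsolated? D S = (girth b ℕ.≤? weight (lookup w) (lookup S)) ⊎-dec isolated? D S

  heavyCheck : Vec (Vec ℤ n) (count b) → Bool
  heavyCheck D = everySubset n λ S → does (heavyOrIsolated? D S)

  Shape : Set
  Shape = (∀ i j → i ≡ j ⊎ e i ≢ e j) × (∀ i → lookup basisSet (e i) ≡ false) × (∀ i → Circuit i (circuit i)) × Isolated values basisSet ×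
    sumℕ (lookup w) ℕ.+ sumℕ (lookup w) ℕ.< girth b ℕ.* suc (suc (excess b))

  shape? : Dec Shape
  shape? = (Finₚ.all? λ i → Finₚ.all? λ j → (i ≟ j) ⊎-dec ¬? (e i ≟ e j)) ×-dec ((Finₚ.all? λ i → lookup basisSet (e i) Boolₚ.≟ false) ×-dec
    ((Finₚ.all? λ i → circuit? i (circuit i)) ×-dec (isolated? values basisSet ×-dec
      (sumℕ (lookup w) ℕ.+ sumℕ (lookup w) ℕ.<? girth b ℕ.* suc (suc (excess b))))))

  obstructionCheck : Bool
  obstructionCheck = does shape? ∧ heavyCheck values

  not-cographic : obstructionCheck ≡ true → ¬ Cographic (mat C)
  not-cographic ok = build (does-sound shape? (proj₁ (∧-true ok))) (proj₂ (∧-true {does shape?} ok))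
    where
    build : Shape → heavyCheck values ≡ true → ¬ Cographic (mat C)
    build (inj , off , circ , basis , few) heavyOK = obstruction {A = mat C} record
      { b = e ; b-inj = λ i j ne → [ (λ e → contradiction e ne) , id ]′ (inj i j) ; B = lookup basisSet ; B-b = off
      ; basis = isolated⇒indep basisSet basis ; dep = λ i → dependent i (circ i)
      ; w = lookup w ; t = girth b ; heavy = heavy ; few = few }
      where
      dependent : ∀ i → Circuit i (circuit i) → ¬ Indep (mat C) (insert (lookup basisSet) (e i))
      dependent i (ne , kernel , supp) ind = ne (ind (lookup (circuit i))
        (λ j off → [ (λ on → contradiction (trans (sym on) off) λ ()) , id ]′ (supp j))
        (λ r → trans (sym (lookup-apply C (circuit i) r)) (trans (cong (λ v → lookup v r) kernel) (Vecₚ.lookup-replicate r 0ℤ))) (e i))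
      heavy : ∀ S x → S x ≡ true → ¬ Indep (mat C) S → girth b ℕ.≤ weight (lookup w) S
      heavy S x _ ¬ind = [ subst (girth b ℕ.≤_) (sumℕ-cong λ j → cong (λ s → weigh s (lookup w j)) (S-at j)) , (λ sep → contradiction (indep sep) ¬ind) ]′
          (does-sound (heavyOrIsolated? values S′) (everySubset-sound n (λ S → does (heavyOrIsolated? values S)) heavyOK S′))
        where
        S′ : Vec Bool n
        S′ = Vec.tabulate S
        S-at : ∀ j → lookup S′ j ≡ S j
        S-at = Vecₚ.lookup∘tabulate S
        indep : Isolated values S′ → Indep (mat C) S
        indep sep c supp = isolated⇒indep S′ sep c λ j off → supp j (trans (sym (S-at j)) off)

-- Evaluating the invariant

module FastInvariant {g n : ℕ} (C : Vec (Vec ℤ g) n) where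
  points : Vec (Vec ℤ g) (2 ℕ.^ g)
  points = Vec.tabulate λ k → Vec.tabulate (bitsOf g k)

  -- All parities are tabulated once and handed on as an argument. Evaluated literally, `invariant`
  -- would compute the weights of the whole code anew for each column.
  codewords : Vec (Vec ℕ n) (2 ℕ.^ g)
  codewords = Vec.map (λ z → Vec.map (λ a → parity (dot (lookup z) (lookup a))) C) points

  codewords-at : ∀ k i → lookup (lookup codewords k) i ≡ parity (dot (bitsOf g k) (col (mat C) i))
  codewords-at k i = trans (cong (λ v → lookup v i) (Vecₚ.lookup-map k (λ z → Vec.map (λ a → parity (dot (lookup z) (lookup a))) C) points))
    (trans (Vecₚ.lookup-map i (λ a → parity (dot (lookup (lookup points k)) (lookup a))) C)
      (cong parity (sum-cong λ r → cong (_* mat C r i) (trans (cong (λ v → lookup v r) (Vecₚ.lookup∘tabulate (λ k → Vec.tabulate (bitsOf g k)) k))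
        (Vecₚ.lookup∘tabulate (bitsOf g k) r)))))

  weightsOf : Vec (Vec ℕ n) (2 ℕ.^ g) → Vec ℕ (2 ℕ.^ g)
  weightsOf P = Vec.map (λ row → fourth (sumℕ (lookup row))) P

  combine : Vec (Vec ℕ n) (2 ℕ.^ g) → Vec ℕ (2 ℕ.^ g) → ℕ
  combine P W = sumℕ λ i → (sumℕ λ k → lookup W k ℕ.* lookup (lookup P k) i) ℕ.^ 2

  fromCodewords : Vec (Vec ℕ n) (2 ℕ.^ g) → ℕ
  fromCodewords P = combine P (weightsOf P)

  fast : ℕ
  fast = fromCodewords codewords

  fast-≡ : fast ≡ invariant (mat C)
  fast-≡ = sumℕ-cong λ i → cong (ℕ._^ 2) (sumℕ-cong λ k → cong₂ ℕ._*_
    (trans (Vecₚ.lookup-map k (λ row → fourth (sumℕ (lookup row))) codewords) (cong fourth (sumℕ-cong (codewords-at k)))) (codewords-at k i))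

-- Assembling the classification

module Cells {g N M : ℕ} (reps : Vec Rep N) (bads : Vec Bad M) where
  open Completeness {g} reps bads

  invariants : Vec ℕ N
  invariants = Vec.map (λ R → FastInvariant.fast (cols g R)) reps

  Separated : Vec ℕ N → Set
  Separated T = ∀ k l → k ≡ l ⊎ lookup T k ≢ lookup T l

  separated? : ∀ T → Dec (Separated T)
  separated? T = Finₚ.all? λ k → Finₚ.all? λ l → (k ≟ l) ⊎-dec ¬? (lookup T k ℕ.≟ lookup T l)

  repsCheck badsCheck stepsCheck : Bool
  repsCheck  = does (Finₚ.all? λ k → RepCheck.repCheck g (lookup reps k) Boolₚ.≟ true)
  badsCheck  = does (Finₚ.all? λ b → BadCheck.obstructionCheck g (lookup bads b) Boolₚ.≟ true)
  stepsCheck = does (Finₚ.all? λ k → stepCheck (lookup reps k) Boolₚ.≟ true)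

  Counts : List ℕ → Set
  Counts counts = (d : Fin (List.length counts)) → countEq (λ k → size′ (lookup reps k)) (toℕ d) ≡ List.lookup counts d

  counts? : ∀ counts → Dec (Counts counts)
  counts? counts = Finₚ.all? λ d → countEq (λ k → size′ (lookup reps k)) (toℕ d) ℕ.≟ List.lookup counts d

  -- All finite verifications enter as equations between closed Booleans, so for a concrete
  -- catalogue `refl` proves each of them.
  hasCells : ∀ counts → repsCheck ≡ true → badsCheck ≡ true → stepsCheck ≡ true → does (separated? invariants) ≡ true →
    does (counts? counts) ≡ true → (∃ λ k → size′ (lookup reps k) ≡ 0) → HasCells g N counts
  hasCells counts repsOK badsOK stepsOK separatedOK countsOK empty =
    (λ k → RepCheck.admissible g (lookup reps k) (ok k)) , (λ k → size′ (lookup reps k)) , (λ k → dual⇒dim (D k)) ,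
    (λ k l S → [ id , (λ ne → contradiction (trans (value k) (trans (sym (sameOrbit⇒invariant (D k) (D l) S)) (sym (value l)))) ne) ]′
      (does-sound (separated? invariants) separatedOK k l)) ,
    (λ a → classify (complete (does-sound (Finₚ.all? λ k → stepCheck (lookup reps k) Boolₚ.≟ true) stepsOK) (λ k → RepCheck.rep-frame g (lookup reps k) (ok k))
      (λ b → BadCheck.not-cographic g (lookup bads b) (does-sound (Finₚ.all? λ b → BadCheck.obstructionCheck g (lookup bads b) Boolₚ.≟ true) badsOK b)) empty
      (Admissible.n a) (Admissible.A a)
      (tu⇒liftable (Admissible.A a) (Admissible.tu a) , simple⇒reduced (Admissible.A a) (Admissible.simp a) , Admissible.cogr a))) ,
    does-sound (counts? counts) countsOK
    where
    ok : ∀ k → RepCheck.repCheck g (lookup reps k) ≡ true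
    ok = does-sound (Finₚ.all? λ k → RepCheck.repCheck g (lookup reps k) Boolₚ.≟ true) repsOK
    D : ∀ k → Dual (mat (cols g (lookup reps k)))
    D k = RepCheck.rep-dual g (lookup reps k) (ok k)
    value : ∀ k → lookup invariants k ≡ invariant (mat (cols g (lookup reps k)))
    value k = trans (Vecₚ.lookup-map k (λ R → FastInvariant.fast (cols g R)) reps) (FastInvariant.fast-≡ (cols g (lookup reps k)))
    classify : ∀ {n} {A : Mat g n} → (∃ λ k → Equivalence A (mat (cols g (lookup reps k)))) →
      Σ (Fin N) λ k → SameOrbit A (mat (cols g (lookup reps k)))
    classify (k , E) = k , equivalence⇒sameOrbit E

-- sorted by rank: the first 9, 25 and 92 are those of rank at most 3, 4 and 5
representatives : Vec Rep 92
representatives =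
    rep 0 0 0 0 0 0 1 7
  ∷ rep 1 0 0 0 1 257 84 32779
  ∷ rep 2 0 0 0 513 0x3030101 0x40000c00f00002003d150 0x208013
  ∷ rep 2 1 8 0 4882 0x30501070103 0x408e5150 0x308017
  ∷ rep 3 0 0 0 197121 0x90903030101 0x1000a3006c0020c01b000c3005c000a2006c0020801b000c2005c00066005c001180174100060305c00100c174540 0x6208027
  ∷ rep 3 1 8 0 267026 0x909030501070103 0x408e00067007c0011c01f400061407c0010501f4100049007c001a401f4540 0x830c02b
  ∷ rep 3 1 26 0 0x141312 0x90b030501070103 0x408e025900047007c02580038801f4102680020801f4540 0x231002f
  ∷ rep 3 2 5132 69632 0x250423 0x13150317011301090309 0x1045809a000e3008c045800120023067804594102694540 0x419c037
  ∷ rep 3 3 0x150816 200960 0x362524 0x90c071801070709010c0112 0x408e409640c7809641409a4540 0xc408047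
  ∷ rep 4 0 0 0 0x4030201 0x1b1b090903030101
      0x101ca300cc0628c033008e500bc01c8300cc0620c033008c500bc01c4500bc0611402f020c200ac007288033018a200cc0239002f0072080330188200cc0231002f00711002f0184400bc0830c02b001ca200bc0628802f0204600ac01c8200bc0620802f0206600ac0090600ac0341802b4040728042f018a010bc08100c2b00720042f0188010bc08180c2b002400c2b00d0030ad0402020c2b00c0830ad1500
      0x106208067
  ∷ rep 4 1 4 69904 0x15140302 0x1b1b0909030501070103
      0x102380939443f020e510fc043ac03700931443f020c510fc0432c03700722c0370188b00dd0020c200fc0930803f010e110dc020e200fc0938803f010c110dc01c8110dc062044374040830043f024c010fc0430c03700838043f024e010fc0438c03700620c03701c8300dd040711403b0184500ed1500
      0x10620806b
  ∷ rep 4 1 78 0 0x15141302 0x1b220910031701010309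
      0x40b49c43f02a806208043009a010c2010c0aa020c110fc009a02a80a41843f01ca3010c02a80538c043024e010fc00b38c04302c80809843f00b2028c2010c0901c43f00141843f0012710fd0102680aa40658083700aa02cc020dd040b2020c020dd1500
      0x10610086f
  ∷ rep 4 1 80 0 0x15141312 0x1b34090b030501070103
      0x408e02580a6402520c3f00a60284830fc0831443f002580a60290230fc0829843f00a60150610fd0102680aa0290610fc08288c3f00aa0150230fd040b20144830fd1500
      0x14728c073
  ∷ rep 4 2 6195 0x100110 0x6252413 0x1b1e091003170101091e0336
      0x40aa00584112c0558804f009a02a80350505301026112c009a001a5112c0aa01143013c00960414c0aa01407112c00b201560414c0430444b00450505302c80538044b00661044b01da5112d01026902a900b10184702a9040810184702c91500
      0x18340147b
  ∷ rep 4 2 15370 65792 0x26052403 0x1b22090b033b0113031b0109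
      0x409603164112c12a01569112c03064312c12a01469312c009604a80d59444b01168112c04a80d194c4b01068312c009602565112c0859044b402465312c08190c4b40412a034e5112c043a044b012a030e4112c053a444b012a5040839044b024e5112d1500
      0x18440807f
  ∷ rep 4 2 20263 0x111200 0x26252403 0x1b21090f0315010401060409
      0x50498046a4053011603489014c12603100314c010e03524014c12603008314c045800620c5304990102680aa40061044b00aa03004112d040b203080112d1500 0x18b394483
  ∷ rep 4 2 15941 65808 0x26052423 0x241d090c0718010701030312
      0x410e04980c22005306d8026812640442c0530067812602c80c5a0053012602d04014d0102a900d40414c02680aa02883013d040328105302c91500 0x18830c08f
  ∷ rep 4 3 984084 0x2322000 0x27163514 0x1b1b090e030e0119031201030109
      0x1043809608680612405701c49015d002580648805701d22015d00620585701c81615d0101900115c0740045740868072340570188d015d0407690057019a4015d1500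
      0x1cc50809b
  ∷ rep 4 3 0x3c0a04 0x212010 0x37163504 0x1b22090b033b0713031b01090103
      0x408e045822a03169216c06134057022a00ce1615d00458065a485b0ab90053858570ab90108a80c7a485b0188d015c067822a5043be019e9216d1500 0x1c2020c9f
  ∷ rep 4 3 0x3c0c04 0x221010 0x37163504 0x1b220910153b0107031b03090103
      0x408e046822a0ef8065b4057022a02ccd015d00ce82ae018ad015c0678053340570ab901046822a02c0d315d022a50405034c570ce91500 0x1c92080a3
  ∷ rep 4 3 0x27280a 0x3332210 0x17061504 0x1b21131503150113030b0103010f
      0x10438096049903161216c0a78025812603460216d01260ad901046812a40d78085b012a03807115d0413203121216d1500 0x1cc0188a7
  ∷ rep 4 4 0x2418050a 0x44211000 0x18373625 0x1b2e094703160116091b030901060109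
      0x1025821a18e84b64010e025843203980117d00860045f12d901086843203982017d00860805f18e90443251500 0x20b1a40cf
  ∷ rep 4 4 0x131e2026 0x31340210 0x8471625 0x1c21090a0339040a09380d1b0106091b
      0x40823805f02982ae009640a60ab8010e40a6402580742c45f02990104a80b202065018c067812a5040b214d91500 0x20a7200db
  ∷ rep 4 5 0x183f403307 0x240323110 0x49585706 0x1b241024031601160324161b010903360106
      0x4216046812a0899002382164226001337211b030c2021e48497830cbe089901046904a90a3a04a90504c91500 0x25020c10b
  ∷ rep 4 5 0x140f4a3e1e 0x141032200 0x39584756 0x3739090e1921011909370312091b01031936
      0x10438216106812642ae008581265012632f90102a8232410680aa50423224d91500 0x247110123
  ∷ rep 5 0 0 0 0x504030201 0x51511b1b090903030101
      0x52728c07741ca301dd4620807312628c077418a301dd472080730ca2080733a88201cd0438c06f049c8301dd0720c077518a201cc4988301dd0620c07751ca201cc328a201ccea288073410c301bc0c45080733914201cd0720c06f0c55080733954201cd0620c06f0e820c06f3208301bd0620c06b012728807741ca201dd4620c073126288077418a201dd4720c0730ca20c0733a88301cd0438806f049c8201dd07208077518a301cc4988201dd0620807751ca301cc328a301ccea28c073410c201bc0c450c0733914301cd0720806f0c550c0733954301cd0620806f0e820806f3208201bd0620806b00c41280733904a01cd0719006f0c51280733944a01cd0619006f0e819006f3206401bd0619006b03106a01cce41a807341c4401bc3146a01cce51a80734184401bc3a04401bcc811006f4184401ac0e341006f30d0401bd0331006b0e241006f3090401bd0231006b06831006b120c401ad004c41014733904051cd0718086f0c51014733944051cd0618086f0e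818086f3206021bd0618086b03106051cce418147341c4021bc3146051cce51814734184021bc3a04021bcc810086f4184021ac0e340086f30d0021bd0330086b0e240086f3090021bd0230086b06830086b120c021ad0138c0821bcc302086f40c0621ac3880821bcc202086f4080621ac1a00621ac4801886b411810621ac4041886b45400
      1
  ∷ rep 5 1 164 0 0x1605040312 0x51531b1b0909030301a30151
      0x40c662082322ce820808b00c662482322ce920808b00c64b0e5120c6c3940830031988288c8b3a0a2022c031989288c8b3a4a2022c03192c3144831b0c5020c00c649d85120c6761408300c649985120c6661408300c64314301ec6c504c7b000c662083322ce820c08b00c662483322ce920c08b00c64b0e4120c6c390083003198828cc8b3a0a3022c03198928cc8b3a4a3022c03192c3104831b0c4020c00c649d84120c6761008300c649984120c6661008300c64314201ec6c500c7b000c649cac120c672b008300c6498ac120c662b008300c64306a01ec6c0a8c7b003192723048319c8c020c0319262304831988c020c03190c12807b1b00a31ec00c640d8a01ec61628c7b00c64098a01ec60628c7b00c650042820cc8b0a4a2322d4620048702920cc8b0a0a2322d4720048702c3904830b0c5120d0c28807f00a0a3322c29208c8b518a0121c0a4a3322c28208c8b51ca0121c0b0c4120c2c3944834308201fc02761048309985120d0560807f02661048309d85120d0460807f0cc50807b3314301ed0109c8c120c262b04834144c01fc0988c120c272b04834104c01fc3304a01eccc1a807b413098a01ecc362807b45400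
      1
  ∷ rep 5 1 182 0 0x1605140312 0x51661b1b090b030301130109
      0x40960319a538809322900125c0319a438809322d00125c03194c30c88333082023c00c642880125c8718109300c642c80125c8618109300c6230c2023ccc208083000960319a538c09322901125c0319a438c09322d01125c03194c30888333083023c00c642881125c8718509300c642c81125c8618509300c6230c3023ccc20c083000960319433308833088c023c03194233088330c8c023c03191310a01ec00c621c6c023cc223008300c62186c023cc323008300c64304a01ed004ca2044970348e548c0930cb2044970348e448c09314c30c08f0348cc00888300348cb20049739122024c0348ca20049739522024c03494c30808f33003220c12538c093490e2024ceb28808712438c093494e2024cea28808700c308883030c3220d010349061b008f3080c220c0349071b008f30c0c220c0348ac12807b41008cc220c0333088345400
      1
  ∷ rep 5 1 40 0x111110 0x1605040302 0x51511b34090b030501070103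
      0x408e02580a632904122cea41048b428d8a025c8362809760946220c00a62b06a025c8c1a809762846220c2ac28125c8b0a049761889120c002580a62b143025c8c50c097628c2220c2ad01125c8b40449761924120c00a62a161125c88584497624c4120c324a3022ce928c08b40102680aa23561125cad584497628c4120c22923025caa48c09761922220c00aa22543025ca950c097624c2220c3a081122cc820448b4040b22246a025ca91a809762446220c3a024122cc809048b4138504122cc141048b45400
      1
  ∷ rep 5 1 242 0 0x1615141312 0x516a1b34090b030501070103
      0x408e02580a603193a904122c03194741048b20da7024c00a603194839048b23467024c0319a419c0934946c322c002580a603194821c48b234e3024c0319a438c09349583322c00a60319a720c0934b0a3322c03198928cc8b40102680aa03296928cc8b3a883024c03294720c093411a7122c00aa03294438c09343487122c0329a821c48b4040b203494419c093434e4122c0349a839048b410389a741048b45400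
      1
  ∷ rep 5 2 1048 0x2202200 0x2726151403 0x51511b1b09100317010701030309
      0x1043809a69d6802cd875a00b371d24029c6996802cd865a00b371924029c3b924029cce4900a773102026c1033048af48cc122bdc309c89f1023048af488c122bdc209c89f06e09c89f13827227d01a71a00b361c6802cdc75900a71a61a00b36186802cdc65900a70ee5900a733964029dcc58809b00679223058af408c162bdc1120c9f1233058af40cc162bdc0120c9f02e120c9f03848327d00409a40c8132bd23204caf708a6027c4088132bd22204caf70ca6027c138a6027c6e29809f412530c0b7414c302ddc82080a312430c0b7410c302ddc92080a310e2080a34b882028d014898132bd02604caf70d06027c48d8132bd03604caf70906027c1b906027c4e41809f416808612ad802184ab45400
      1
  ∷ rep 5 2 2120 4368 0x716152423 0x51511b2e0941030501070103091b
      0x410e1208702ec6821c0bb72c6d027c02c84569c0bb195a702edc243409f002c84929c0bb1a4a702edca13409f04461c0bb1918702edc34b409f0134a702ec6d29c0bb7204d027c1308702ec6c21c0bb7246d027c2300812acac0204ab401182462ec660918bb72840327c02c8407918bb181e462edc3480c9f002c8470118bb19c0462edcb180c9f0417118bb185c462edc2400c9f013c0462ec6f0118bb72460327c1382462ec6e0918bb72040327c2b00232ac8c008cab4011a4af02ec492bc0bb72846027c02c86463c0bb1118f02edc349809f002c86823c0bb1208f02edcb19809f0656bc0bb115af02edc241809f01b08f02ec4c23c0bb72466027c1b4af02ec4d2bc0bb72046027c2b00612ac8c0184ab4040b22204c02aca81300ab4288cc02ac823300ab412984c02ac861300ab45400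
      1
  ∷ rep 5 2 18238 131088 0x726152423 0x51511b1d090a030501070112030a
      0x408e0298cb2a44af3aca912bd1022380bf4888e02fdc90b0ca7004580a63380822dcee0208b741b88c030c4e2300c37106d027c002990e2080bf4b88202fdcc400ca712e5804bf4396012fdcc2980a7004580a61b08e030c4c2380c373464027c2a82362ec8a08d8bb40102a90e2004bf4b88012fdcc4180a712e5880bf4396202fdcc280ca7004680aa1b080730c4c201cc373460227c22c0d12ecab0344bb405025b80bf4896e02fdc02b0ca7013232c0912bceb0244af412340b12ecad02c4bb45400
      1
  ∷ rep 5 2 55309 69888 0x2726050403 0x51881bbf090b030501071b510103
      0x102380967196912bc1623816912bc0589e75a44af3056912bc01d6912bc265a44af41041300c30588a71300c301624944c030c861300c30e51300c33104c030d802a04ab0009641182030c16229d82030c0589256080c321982030c39582030cc46080c36010512ac1c640d8af0588e040d8af016279d0362bcc140d8af00740d8af0990362bd00409a49562030c16221962030c0589045880c329d62030c31162030ce55880c36016512ac1e74b44af0588c14b44af01627192d12bce04b44af0264b44af01d2d12bd0179da912bc162305a912bc0589c66a44af381a912bc099a912bc076a44af41058945400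
      1
  ∷ rep 5 2 40532 0x2112110 0x726250423 0x585a1b1e090c0ca7010401060451
      0x4116049905192e604cb30e45804bb05194971c0bf00498eb2004bb05194e49c0bf1c91188af05194c3240b30010e04581260b98932cc14672d2612bc3a5ca02fc14640ce402ec01263b92a02fc14641c6402ec4b0ca02cc14640103290a1900bb3b52a02fc04a80ca7248612bd4c024cb3004680ca7112612bd40624cb3012a03294041325352702fc1523a08012ec4b16132cc152414ad8132cc16245400
      1
  ∷ rep 5 2 17726 131088 0x726152413 0x5151241d090c0718010703120103
      0x408e02996e2004c753880131dcc4180a701b6011a02988c181cc32b060730d0245184c701146131dc83080a70019e02981325b900131d4e4004c773046029c00a65a004131d480104c7708c8029c2b060330c8c180cc340102a8ab7080c322dc2030d1664880c751922031dca180ca7004680aa3aca3032ccb28c0cb72d05028c2b846030c8e1180c3405662880c7518a2031dca480ca701322acc2030c8b3080c3412984e030c861380c345400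
      1
  ∷ rep 5 2 9565 0x1221210 0x716050413 0x51581b3013150317011301090309
      0x1045809a04998e1200bf03296e48c0c71ea4044c7032900128cbf0011604980ca6384a031d0e1280bf00ca6004832fd603104c700678045812603494e1200bf403488a4044c741d8322bc01264384a031c1d64b9a232bc5004832fc1d640102681320329861200bf59523031c0329325a512bc00ca6184a031d061280bf01ba0329c96984af4041320349061280c7495a232bc0348a96984af415184802fc1f245400
      1
  ∷ rep 5 2 6880 65552 0x1716252423 0x518e1b1d090b0305010701090313
      0x408e04580a60319a93380bf4944e02fc0318a91380bf400a603192b84c030c0319c51300c3494ea02dc004580a606e80c60769862880b3002980c66200612fd04008cbf00c62200232fd00411a02a81b603281d66194202cc00aa032988008cbf4100612fc0328880184bf405a91380bf0389253380bf01b62a4ce02fc1d6410389251300c345400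
      1
  ∷ rep 5 3 266004 0x33233000 0x3837162514 0x51511b1b090e030e0119010303120109
      0x108380960469656180d751586035e0b6140cf1646180d751186035e0a6140cf1706140cf54185033d00096594cc035d453300d782cac033c590cc035d443300d7828ac033c5c0ac033d502b00cf41444804d759120135e0b4044cf1454804d759520135e0a4044cf1704044cf54101133d005653818d7514e0635e0b2018cf1643818d7510e0635e0a2018cf1702018cf54080633d00469444080d759102035e0a40c0cf1454080d759502035e0b40c0cf15040c0cf5c103033d0151048035d641200d782868033c51448035d651200d782c68033c54068033d701a00cf4171903034de640c0d345400
      1
  ∷ rep 5 3 268317 0x31033000 0x3807262514 0x51511b1c09100317071c010303090136
      0x420e04688d7180ef2b5c603be0e4100db00a60a1ab23ac086ac8eb82da1133c00d4154eb0b50553ae0d58c0cf00a620107139ca041c4e7402350603bcad4180ef83944036c0298281ac8eb0206b23ae0b4844cf00c788d484cdf2b521337d00a6204eb138ca13ac4e340104682ae209c603bca27180ef81904036c2a5a7037c8969c0df402ae00d0553ac234154eb82563033c29c23538c8708d4e3404a24180ef2090603be065100db03be22447037ca911c0df4120921337ca2484cdf45400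
      1
  ∷ rep 5 3 0x4e1e3e 0x22120100 0x2837363514 0x51511b21091003390107030910360103
      0x408e08680a65c10c03dd504300f7838ea033c0ad80298cd2020e33b480838d16969c0f7525a703de065a00cf000a608c9703300f7540cc03de0e4a80cf00a780a659da903dd476a40f782166033c3b480538ccd2014e340108680aa3a224038cc88900e34588e063dd423818f781500533c00aa4c08303cd1020c0f343c0aa038cd02a80e34042325092063dd624818f7814c0533c32164038ce85900e3413a8b0038cca2c00e345400
      1
  ∷ rep 5 3 795210 0x32332000 0x3817162514 0x51511b30091103160116030901060109
      0x409608680a64c5a303ad1168c0eb443d4c33fd2f530cff825c1136c004380960299311300eb4444c03ad10f6accff4bdab33fe0e2204db0029971304503544c1140e0e4854cf10f200cfb4bc8033ed00421a02c812a6386153ddae1854f7410f094cff4bc2533fe0e69c4db012a4c4e503ad113940eb4040b24bc8033fd0f200cff838cc136c4448603ad312180eb4149ca173ed07285cfb45400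
      1
  ∷ rep 5 3 0x1408d8 0x211210 0x1817362534 0x51881bbf090b03050713010901031b51
      0x104382168218013ec0e24998013ec038a296004fb41d8013ec3258013ece86004fb79983034c20442c0df0388a242c0df00e28950b037c8342c0df04542c0df1910b037d0021681168037c0e228968037c038a255a00df20d68037c11568037c645a00df41c72804e30388ca2804e300e2798a0138ceb2804e31462804e359ca0138d006085004fb0389265004fb00e28a54013ed075004fb0c95004fb3a14013ede640c0d300c7a2541c0df03888341c0df00e281107037ca241c0df06441c0df11507037d01894e8037c0e220ce8037c038a043a00df288e8037c190e8037c453a00df41038945400
      1
  ∷ rep 5 3 0x882752 0x32223110 0x837161504 0x51531b220910031701a3013603091c51
      0x40c6805eb63dd688100ef02260cb804680c671c0d43ac0c41c8ff02260cb8011a04a82260319c78810eb0320823fc012a08980c681d4063dd6820c0ef000c671da043ac0c3a08ff02260cd804c8226031a070298f75a06403bc00c65835100d702260319401046812a38a2553bc26240da88c8200ff819c8237c012a2310703fc2628190a237c0da8292894ef404132230e803fc26281948237c0dc8291154ef4100d44635c26245400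
      1
  ∷ rep 5 3 0xe315e9 0x320100 0x3837261534 0x515a1b240a0c030c010a011803140103
      0x408e02980c65f06048ef00c683d8123be2559d8ef0025831e00a603197c04023bc031a0f1008ef8942663bc009602980c68282c235df000d0fb00c683c0343ed0040aa032a257998ef83d4023bc0329f05008ef4009a02a833a032835a4062541d8ef034a0f3048ef00b27c0c123bc0d241038a29089cfb45400
      1
  ∷ rep 5 3 0xc41c2e 0x23023210 0x3807163504 0x51521b1d090a0304013701060d1b0112
      0x40a68394143ac2460b8e343ac0ae802580a64246334b1038c8ad2033ac24609d0353ac008380a61b8e143ac24640bc824659925035c0096029a2d2980e309190674054eb09190040b208a824a838e143ac2e50d0eb00a7824a81d0153ac0b488ceb022a0929ed2980e34042620b59667940d700b21b94143ac2d64112d2033ac26245400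
      1
  ∷ rep 5 3 0x3c7552 0x22211110 0x837163504 0x66531b340941033b01a3031b091b0151
      0x40c605498f018507022a0ce804c822a03198f898507075800c60588682380ef022a0318682198ef0fb8008a8132031815263c08141c022a03194682050707580ce808a80c61a08e63bc1e600c60da8682180ef000c60548867a40fb013203181525182913ec01320318077204fb07580318866a40fb075800c60588440254eb00c61100963ac1e600c6500422a04c8e57050fb0548eb00d0fb008a8152381c243ece56050fb033a022a0588a30b50eb428c2b43ac36a404132054918168237c0548606208df4105886a4140e745400
      1
  ∷ rep 5 3 741067 0x1310100 0x1827262534 0x51541b210a0f0315010a0115030a0106
      0x40c65316814eb00a60318275c45074182a23fc00960c7802380c60c567141d0a0988ff00a60319712a40ff400960cd80a60319711140ef40102680aa7c44503bc0ca40fd80ca2bc0b13bc00aa3c4a903fc0ca0b96863ac44567141c0ca4040b20f780d22ac0f13bc0f780d24141d71141c0e245400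
      1
  ∷ rep 5 3 547802 0x20212100 0x1817063534 0x519c1b1d090b0305193701030109011b
      0x420e04580a60ef80c67a0c223fde86808ff002980c67990223fded4008ff00c622c47040d0011602980c67b42933ec1f200c64403248eb002980c64460248eb00c681406538d0041b60ab9e83008ff0549e86888ff00c79e64008ff0389ed4088ff02ae22c48040c2ce4041520389e40a4cfb01b60548406248eb4103884c0248eb45400
      1
  ∷ rep 5 3 0x264ecb 0x3310100 0x1827262534 0x51541c210a0f0315010a0115030a0106
      0x40c658f5a40f700a60cb8025831e008e031950410cff402980c6095136a949001cd80c065a49874282623fc0096031826886cf6d4007b203024865e1d015188ff00a60318114988ff40102680aa5c52623fc0ca412a21b49a9001ec888044acd8703292b010cff002a84944dad4f4007362202cc44e1c0ca4816433fc0c10433fc0ca4040b20f780d2545a903dc0f780d2410fb80e245400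
      1
  ∷ rep 5 3 0x886455 0x32113210 0x837260504 0x51531b1c090a0305101c013601120103
      0x408e0ef8226031a2b60050307680116031a2c5805030ba808980c648a19c103000c68b02a140c37202260319228c2040c0116031921942040c08980c66208303cd00419e0ab833603281528ace0140c02ae032826289d60140c03288a1b0103404262054a270a85030336229a2040c1524123542040c26245400
      1
  ∷ rep 5 4 0x20323c14 0x40403110 0x928372645 0x51511b21090b03390413030b0312041b0409
      0x40964cd85546d1361551b4089a02624d1f88989347e5069410b044984346d32610d1b4089a0868c11f8a1a3047e4e38450b0020e025a09608d1f8a582347e4579c10b02264c984046d1261011b42036a011f88da8047e4c2bc50b022624149146cb052451b401127821a04a8b2680517249a0145d20561851389586144d0112d823244984043d3261010f4181985144e2661451345400
      1
  ∷ rep 5 4 0x6c181a14 0x440100210 0x908373625 0x51881bbf1315031501131b51030b0103010f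
      0x1043809694189144c46289989144c118a7162451381d89144c34589144cf06245134029e009694148144c46289948144c118a7152051381d48144c34548144cf052051342501b4113118a261b411304629c46d044e071b41130d11b41133c06d044d00411a9c5e8144c46281de8144c118a507a0513899e8144c3c1e8144cd17a05134271105913118a07105913046294041644e261059130f010591334441644d019c429144c46281c29144c118a500a451389829144c3c029144cd10a451341118945400
      1
  ∷ rep 5 4 0x3fc41c14 0x234230200 0x3948173615 0x51521b2609260304014909360106041b0109
      0x1025812610ca4a34191f091a0c5a4d1f00499091a0a6145132445c011f091a2e38891f0020e025812610c92c5c0d1f091900498aa640513091904e3c491f091900429e092a4c5c0d1f828c3647c08a863a024a9b8f1247e045a411f022a092a4a6405134042621a8d0647d04320b586724149170047c26245400
      1
  ∷ rep 5 4 0x15084030 0x112421000 0x1928473635 0x51511b22090e030e0119092201030109031b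
      0x1083811602680aa049920530d274014c349d00116894cf04be0533c12f40498d069012b3c1a404ae507b410b081ca304ce2728c13393882048c049a0702052f89c0814bd0040aa49964049d06590127441a02049d268081274009a02a853a4022e349d208b8d27404f078812b341e204ae5020810b00b28144904be2512412f4188c8d34be03234d2f45400
      1
  ∷ rep 5 4 0x3ee94738 0x203103210 0x3948174645 0x515a1b1d090a03050137030a015101b4071b
      0x410e0298246502463911104dd2232c127004580a609191211611340918e244413b8a4a2644c00298246348a884bd3230490f02467811114ee2758592f004580a609187359912740918903a053740104a824a940e814dd2032c527024a0cd66449d126a891b0046812a0928e044453b8b0a9144c0929d22a212f405e244413b094a0d500d2f01326c845844c252410989a444413745400
      1
  ∷ rep 5 4 0x215654b1 0x341321200 0x1918074635 0x51571b1e090c1ea50104033601060d510312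
      0x409a10a86be2c126144c2460b58042a81123349c2463ad0d149c424639122046c008384ba18b80d20918b071851300a7a0048cd270918e5434527062e3a0ae546c246401032a25389127885a2449c10a80ca4c903c91b002680ca7aca2045d042a032940621389127034a2568912704ba3256f246c0d24113a9ec28811745400
      1
  ∷ rep 5 4 0x1c541f31 0x340342210 0x2908170605 0x51581b1d090a03a70137071b0351030a0112
      0x408e029824a748a884bd024a7110c04fe2f28812f002580a60929b249c91b40928248a192f2b122546c00298322a212f0b39325b891b0c443013f0b3a2470992f002580a65c927246c2ce47122864bc2ce40102a824a3114c04fe2408992f024a0c9a884bd326b891b002680aa0928af8ac12f4b0ae546c09294042da7114c04fe2f68812f00b20b69d26a212f416be2b04bc2ea45400
      1
  ∷ rep 5 4 0x3b1c1895 0x131431000 0x948272645 0x51521b1d090f04150137010f041b04090112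
      0x40a640c64c9ab246c92c2544ec0c63b1c924ac00960298b27a612f031905fa031a0c190d1f0008e14780960298f3009127031907072893b031900409a032a7072893b3122904ac02a80ca5cc02449d003285de81864647c02a80ca17790114e80b20348f27a612f4132c2544ec0e245400
      1
  ∷ rep 5 4 0x38c9281f 0x233320210 0x3948170645 0x51543739090f070f01370121071201090115
      0x10238116029a703205370929062e00a60d5824a418b801160a780a60b3826240b381032053740104680aa424a804a744bc9ac3044ec24a8a5a7147c00aa9015114ec24a8b527047c3916c04fc24a4041329116c04fc2528a58504cc7815114ec2524172c3044ec26245400
      1
  ∷ rep 5 4 0x1c1f6d2e 0x240343210 0x1908172605 0x518a1b1d090a030501370ac3010301510112
      0x420e02981460f789248c11702ba00960298146448a3045d01460da88f028517000a6051912110117405181f223d61145c009602981465014653ca1145d00429e08a80b2075834e24963045c022a058834e23c08145c548a3045c34e4041d605888f48451700b20759521101174105890f28451745400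
      1
  ∷ rep 5 4 0xb65a1ff2 0x323221000 0x4918471645 0x519c1b1d09cc03050713070913a203130309
      0x408e02580a603193cd51147c031a61428d27a2121b033d0026e8b002415787002980c654cf1147d00c651123603a90024f8b00558918792d20149c002580a6031a6a404d27a2091b06490026e8340812cb8700c64d35c411f002980c651093606b50024f8340b2a05879012b149c03197334411f401026851e02a80ca153a3341410f00ca15390102c8536034941038856645400
      1
  ∷ rep 5 4 0x52c8188b 0x433141000 0x3918272635 0x51531b1c0910031701a31051011203090103
      0x408e04682160319249e704ec02980c69142884bc124b493b000c649233813b00a6031a4548212f0498824ec0216031a4470e113601c3550c02980c6500411a08c80aa0328252400ca049e724ee453b212f00aa0328924b413b404232048ce24ec252915a684bc2498804ec252415b1e2050c0e245400
      1
  ∷ rep 5 4 0x5bbf1894 0x434141000 0x3918272635 0x666c1b1c13150315131c010f0736030b0103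
      0x10238096031919c802980c69402534ae8aa524246c009a9820262f3e1c051e0096031a4271a11f19c802980c65d264513b0031988cef04ec02980c699c61449d00409a18d80aa032944f6d424d80092d8203ce98e1d0032855a9102284cc02a80ca15690118d80b2034a3262013b4171c6144ec0e245400
      1
  ∷ rep 5 4 0x27138d29 0x244431000 0x928372615 0x51541b210a0f0339010a030a0115151b0106
      0x414a8482624ad00a605281e63402e24ac0096187802381620738f16bc92b00a67482624ac1ce4009618d80a61d781ce40102680aa8cc6724ac14a407c814a3c46f24ac00aa414a24c41645c71802550c14a4040b207681623414e24ac0769f319c92b4189802550c16245400
      1
  ∷ rep 5 4 0x1d71187e 0x340313110 0x908272645 0x525a1c24154a0415011c0436010603090936
      0x40b208980d2091a4579c53f004690919457b413f022616f8020e0c7a413bc93b09182d602260ad8804eb14ec246408984e6091900411a08a80b209280d24022a092a6379c93b1bb80929037ac13b4050349e38ac13f00b24956f04ec0d241038a2559c53b45400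
      1
  ∷ rep 5 5 0x154b1c160b 0x3315342200 0x3a49580716 0x51511b200a0c030c0140032f0336011b01030118
      0x1043822610a80472cd47091cb351d0025849e022610c82793894b01e4e252d002582260ccc8252c1332094b40c865451c1219514740104ccc552c3333154b410a823928d4700e4a351d00468abe10a82878954b021e2552d0110c96084dc4cd82d29c4b9a20ea62e9c84dc4cd82d29c4b9a20eae2c00dc6c2484107080a69649360c0b04f252c0c13c94b4100da9252c236a494b45400
      1
  ∷ rep 5 5 0x1e08bc1a18 0x2505103210 0x3a09384746 0x516a1b22090f153b0107031b0115015109a30712
      0x410e045882a32f82465020a8246095156bd490024aa1c08834787025eb252c091920289d4b40045849e09182688821ed4009ae8703468861c067ac94b092e0918e178c94b401026882a0928254526f5580092a87009914e1c282a9d4b024a405e3252d020a824a1b79024a1b79010948268ad61c80009ae8704522661c272a9d4b08ba0948c0289d4b413bf8a6a45400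
      1
  ∷ rep 5 5 0x56c830f10 0x4425133010 0xa09382756 0x518b1bc5090c040c010401181c5101360412091c
      0x4096424661e74153c0898ec9d054f09190a0146652c246208c8554c08984432155309190008e025891ea8506252c24628134754c0898054d1d53091900422a092a8061954b20948354c092844520d534009a08a8b3e0928b5e406a18a0d4b0948817d51530232091f5454c25241098945400
      1
  ∷ rep 5 5 0xf102b05b9 0x352443010 0x1a09185726 0x51541b1e090c040c010404123fa3011b01180151
      0x409608980c681a74153d00c65008980c60bc83381054700c698604151d0008e025891e08980c60ba833614d4700c698585351d0042e603282a614d47022a50585351c0ca4009a2cf822a27780ca40423203482e60aa04151c0349418105474171a74153c2e645400
      1
  ∷ rep 5 5 0x2408bc1a18 0x2550103210 0x3a09384746 0x516a1b2e0945070f0107091b0115015109a30712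
      0x410e0458832091a207d11530aa05151c0919402468b5f4454c2e81454709360919c148c94740045849e32f89360918e013954b40102688320928efe0b4aa752c09298013954b4024a1b78262a9d4b08ba09286de40483209484d7d1153409494148c94741101f4454ca7245400
      1
  ∷ rep 5 5 0x75181a7404 0x5551123200 0xa09484736 0x51641b2e0945070f0107091b0712010901360130
      0x1023821620c81262148146410518b13255530126894c9554c14640085849e32f81263378146401086883204a885205290a7510f03369352e01c512aeb8b052944d880dc4800a4da901143861c04aa886d5a8c4800ac9a900e04561c14a4048322149235f4454c2149a47d115341058aa1834d4b45400
      1
  ∷ rep 5 5 0x14073d4e24 0x110423200 0xa39584756 0x51511b2e09410316011601090341013603091636
      0x1205811a7ad06255dcb41895740899ed2c8557734b2155d0020e20580b20899f199055774664155d014b82267c162055dd0588157401046812a7c0e2255dd038895740ae804a8cbe798a0155dc62805574040b272d82255deb608957472824155dea0905574178066255dc019895745400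
      1
  ∷ rep 5 5 0x5a1805244f 0x5253121000 0x2a19484736 0x51641b313fb10415010409510409010f0a1b0112
      0x135e88524029a8aa61c982400aad820266e2e1c85202d02251c009614e80a6235944f6f5702400a2982038a99e1d0008e18780962358e5e7b422255c02988d6397900409a02a885235e82f190d4b08524424f654d002a853a5c24f654c8da4040b22149467809534214941a19e0254c8f245400
      1
  ∷ rep 5 5 0x38c6074a27 0x1441321000 0x4a59283756 0x515a373f093f0316013a012d0923010601090309
      0x1045809a04980aa15584da400838116049a889ad4f4dc00aa166044727e1c452422d8049855611890556515c49a9a300289598127c478740102680aa601d3156c452438f802a84da1189603c4c0ce5270384b64cb0a62c136a8074c55b4040b244520cd42351c64921156c45241a4921156c46245400
      1
  ∷ rep 5 5 0xd915086ce2 0x2214510000 0x5a59483736 0x518a1bc3090e030e071c1336031201031c510109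
      0x10838096106a804a9d4b0319aa88c95b00a653623256c0c64002590319753c455b00a6aacf1156c0c6a8567252c1031914185d5300a6a2061754c0c640102c80d2abce5155ea972c55f00d24d5cb157d010682ae12e82ce13690138f80b239780d241038945400
      1
  ∷ rep 5 5 0x5186d7678 0x3325310210 0xa09484756 0x51591b230911031616370106093a161b0109031b
      0x1045809a04980aa05180ca402038116049814642d602b6012605199d162057c051a9358815f40102680aa03299d222257c032a9388895f400aa14e80ca15690102c8e3e0348e5e41038a8e39055745400
      1
  ∷ rep 5 5 0xa08a5487b 0x1153511000 0x3a29284746 0x51541b2e094107a80119010901030ca20c1b0312
      0x11038816026a641a015f032a8f58455f00aa4902b754c0ca4020580b20348b240c15f2a161754c0349d50ac55f404ae22d84ce2359005032ab01bc15300aa8d1e3054c0ca6466f554c009a34f80aa40ca4040b20348e5e40348e5e4103884b60115f45400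
      1
  ∷ rep 5 5 0x71439b280 0x1123521000 0x2a39485746 0x51521b1f090b031f0413030b091f033603120136
      0x1025822a02990319b0a4d153008a80a635560157c0c640043809640c601288556c029a0a2b81530319035780c6a912a249130022a98c08abc98700a635780c6401227811a05280e2408a814a23390138f80b275633156c0d24103888390515f45400
      1
  ∷ rep 5 5 0x38185b1ef2 0x3232311000 0x1a59484756 0x519c3739131515391337131b030b010f151b0103
      0x1023809602980c668a3b895f092e061e0096029853a0319a2e2f157c00a6031aac2ae55f4031a4050d15f40102680aa28d80ca98e80257d002a80ca299900ca19690102c8a36034a8b43055f410388a6645400
      1
  ∷ rep 5 5 0x30d8085a31 0x2525110000 0x4a49583736 0x519a1bc30cab0718010707091b51010c09510112
      0x408e029846205492207b555b054a033b555b002580a6118a0e0b555b8984d556c07584e64028780960298a2e07584e640102a8462054920172555b054a2232555b002680aa118a2f02555b81c69556c07684ea404152118aa511d94f00b2054941118945400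
      1
  ∷ rep 5 6 0x184e1e0b29c9 0x4341502210 0x1b5a696837 0x51541b210a0f1021010a09391b5b151b0115010603a2
      0x1032829945563404980ca0798001cb42c6c0e3941352591a60c01160a78043943a04980d20739004582b6049ae9945563073900409a02a903291137d41630329002a84ad41544800081ee2055a5761c0ca453e80ca4040b250e849584e89240089ae20328f261c0d24134df5058c0e245400
      1
  ∷ rep 5 6 0x2113343318ae 0x6115443200 0x1b2a596837 0x51541b1e0a0f103c010a1536011501060a361e5a03a2
      0x110980ca2bd900ca0926a95c0700148b0c109d0d8700360f120705624030d3429d830105889e040e10990ba03484ce404161098a361220b5561300148b881381a987133900409a449f5058c0ca408a9032900bc80ca408aa1524816303290142e823245492058c0d241849f5058c2ea45400
      1
  ∷ rep 5 6 0x330b04d8840c 0x26544211000 0x3b3a696857 0x51881ebd0910031701100387011201031e5103a2091e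
      0x440e0268816822c0158c14a8b2c0158c04a926a052900132054a26b0056384ec0158c05492724081614b8936153895640102690529012a49a814a42267ac563052a137ac563012a49a814a406087ac563054a2c7ac563013249c815241058945400
      1
  ∷ rep 5 6 0xa5db394c2404 0x42263543110 0x6b5a390807 0x51541e2d094446a801071ea21b513f5401120a1b030a
      0x408e53b884a4089853a021653b884a1912ba58c0898a662129004ae08988ce55e80930c967008584ae08988ce13bd3db509001ab718112a6787401a22612bd56002ec99809750587212932a14163022a14e808692129022a484a4041322188a5a455e8a5a41218926a45400
      1
  ∷ rep 5 6 0xa9bb2426c3a8 0x4406523210 0x6b1a596837 0x51571b30094503a5040a031403090a1b041203361f51
      0x104a8226484655d8021604a822648469c4c1159c020381622119022654f80858c3608983134c567211900481a48780ca5eb604967012a0329404232214816242149256417a2e1259c16245400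
      1
  ∷ rep 5 6 0xbdbf0ccbb058 0x16441533200 0x6b2a091857 0x546c1b6c090f0415041c1ca804360409031b0938010f
      0x40c650e602260319a2a912261b002ee99c03ac1787004580c656053712b5001a78880fb24b87439808980c6687b8816f0008e12781160319439808980c6b2e08058d00411a08a88ae4bd80ca4022a22b89149856b03290108c8936136815241426245400
      1
  ∷ rep 5 6 0x7380cc9c7be 0x3446203210 0x3b5a196857 0x51551b2309110316163701063fa4093a031b010916a2
      0x1045821a029822a09280c6404038116029903182d602b600a640c6429980c6401086822a424a4da0015ac6050f15ac24a4022a14e855a09290104c94be537815241980e4159c0e245400
      1
  ∷ rep 5 7 0x38243e154a75ec 0x266405233100 0x1c7b4a5978 0x5166301d0942030e0137013337660103031201ab13a20151
      0x1203809610680a60318356494f8009602980c65093600a603183564031835640120a80b21db587510f0024828817734d8703490106882a03888ce0037211b0b0496803ea6b4598304da23390102c80d2500d21b0b37001506083030f0a5dd834103898f645400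
      1
  ∷ rep 5 7 0x6c6f0badb3e981 0x775606143200 0x4c2b1a3958 0x905739900a0c0721010a39b40c1b01b401570139011b0314
      0x410e049814644ce014644ce0045849e01260ab81465004581260ab814623590040aa03295168032a56e5168009a02a80ca626a00ca95b90148e80b2abf80d241038945400 1
  ∷ rep 5 7 0x2d3334196aa4ad 0x371056543010 0x2c4b7a6928 0x51531b240a24031504a3151b030a011b037503a20a510115
      0x120980c693e900c650025909e020e209922e0319adf80096209922e031940108684ce0929082aa2f888e882a133824a4045560349083215580d24153b88e645400 1
  ∷ rep 5 7 0xa8de131631533e 0x230456143010 0x7c6b5a7928 0x51581b21090a03a70a583951073607120139093601a2030a
      0x102380a641281464412814640216029904a0519104a05197014dc4c24007a203061aa361c0029942e532605b55600146714138587870519008580a650b9051900489e08680aa4129a2092013050032bb0c0e2a6987104a50112d8232496835641418a0ea45400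
      1 ∷ []

-- M(K₅), M(K₃,₃) and M(K₅) with one edge subdivided
obstructions : Vec Bad 3
obstructions =
    mkBad 4 5 0x3f3915371307 8 0x1b0103090d1c1e24 1023 3
  ∷ mkBad 5 3 0x5c562620 12 0x39a5db3fab016d03090d1b51 511 4
  ∷ mkBad 5 5 0x3f3915371358 10 0xa309541b01030d1f5124 1023 3 ∷ []

theorem6p4 : HasCells 3 9 (1 ∷ 1 ∷ 1 ∷ 2 ∷ 2 ∷ 1 ∷ 1 ∷ [])
    × HasCells 4 25 (1 ∷ 1 ∷ 1 ∷ 2 ∷ 3 ∷ 4 ∷ 5 ∷ 4 ∷ 2 ∷ 2 ∷ [])
    × HasCells 5 92 (1 ∷ 1 ∷ 1 ∷ 2 ∷ 3 ∷ 5 ∷ 9 ∷ 12 ∷ 15 ∷ 17 ∷ 15 ∷ 7 ∷ 4 ∷ [])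
theorem6p4 =
  -- Among the bad matroids only M(K₅) has rank 4 and the others have rank 5: none can occur for g =
  -- 3 and only the first for g = 4. The empty representative comes first in every case.
  Cells.hasCells {3} (Vec.take 9 representatives) [] _ refl refl refl refl refl (zero , refl) ,
  Cells.hasCells {4} (Vec.take 25 representatives) (Vec.take 1 obstructions) _ refl refl refl refl refl (zero , refl) ,
  Cells.hasCells {5} representatives obstructions _ refl refl refl refl refl (zero , refl)
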